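{- For every finite graph $F$ and every integer $k$ with $3\leq k\leq 5$, we have $\mathrm{sat}_k(n,\text{Berge- }F)=O(n)$ as $n\to\infty$ (the implied constant may depend on $F$ and $k$).
   Context: For a graph $F$, a hypergraph $H$ is Berge-$F$ if there is a bijection $\phi:E(F)\to E(H)$ with $e\subseteq\phi(e)$ for all $e\in E(F)$, where $V(F)$ is identified with a subset of $V(H)$; a hypergraph contains a Berge-$F$ if some subhypergraph of it is Berge-$F$. A $k$-uniform hypergraph $H$ on $n$ vertices is Berge-$F$-saturated if it contains no Berge-$F$ but adding any new $k$-element hyperedge creates a hypergraph containing a Berge-$F$. $\mathrm{sat}_k(n,\text{Berge- }F)$ is the minimum number of hyperedges in a $k$-uniform Berge-$F$-saturated hypergraph on $n$ vertices. -}

module Defs where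

open import Data.Nat using (ℕ; _<_; _≤_; _*_)
open import Data.Fin using (Fin; toℕ)
open import Data.Fin.Subset using (Subset; _∈_; ∣_∣)
open import Data.List using (List; length; lookup; _∷_)
open import Data.List.Relation.Unary.All using (All)
open import Data.List.Relation.Unary.Unique.Propositional using (Unique)
open import Data.Product using (Σ; _×_; proj₁; proj₂; ∃)
open import Function.Definitions using (Injective)
open import Relation.Binary.PropositionalEquality using (_≡_)
open import Relation.Nullary using (¬_)
open import Data.List.Membership.Propositional using () renaming (_∈_ to _∈ₗ_; _∉_ to _∉ₗ_)

-- A finite simple graph on vertex set Fin p: a duplicate-free list of
-- edges, each edge {u,v} stored once as an ordered pair with u < v.
record Graph : Set where
  field
    p      : ℕ
    edges  : List (Fin p × Fin p)
    ordered : All (λ e → toℕ (proj₁ e) < toℕ (proj₂ e)) edges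
    nodup  : Unique edges
open Graph public

record Hypergraph (n : ℕ) : Set where
  field
    hedges : List (Subset n)
    hnodup : Unique hedges
open Hypergraph public

size : ∀ {n} → Hypergraph n → ℕ
size H = length (hedges H)

Uniform : ∀ {n} → ℕ → Hypergraph n → Set
Uniform k H = All (λ e → ∣ e ∣ ≡ k) (hedges H)

-- H contains a Berge-F: an injective identification ψ of V(F) with vertices
-- of H, and an injective map φ from E(F) to E(H) (i.e. a bijection onto a
-- subhypergraph) with e ⊆ φ(e) for every edge e of F.
ContainsBerge : ∀ {n} → Graph → List (Subset n) → Set
ContainsBerge {n} F Es =
  Σ (Fin (p F) → Fin n) λ ψ →
  Σ (Fin (length (edges F)) → Fin (length Es)) λ φ →
    Injective _≡_ _≡_ ψ × Injective _≡_ _≡_ φ ×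
    (∀ i → (ψ (proj₁ (lookup (edges F) i)) ∈ lookup Es (φ i))
         × (ψ (proj₂ (lookup (edges F) i)) ∈ lookup Es (φ i)))

BergeSaturated : ∀ {n} → ℕ → Graph → Hypergraph n → Set
BergeSaturated {n} k F H =
  Uniform k H ×
  ¬ ContainsBerge F (hedges H) ×
  (∀ (S : Subset n) → ∣ S ∣ ≡ k → S ∉ₗ hedges H → ContainsBerge F (S ∷ hedges H))

-- sat_k(n, Berge-F) ≤ m : some k-uniform Berge-F-saturated hypergraph on n
-- vertices has at most m hyperedges (sat is the minimum of such sizes).
SatAtMost : ℕ → Graph → ℕ → ℕ → Set
SatAtMost k F n m = Σ (Hypergraph n) λ H → BergeSaturated k F H × size H ≤ m

{-# OPTIONS --safe #-}

-- Complete a Berge-F-free hypergraph H₀ greedily to a saturated one, H. Outside a bounded set of vertices, either H has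
-- O(n) hyperedges or it contains a large star and a large matching whose touched vertices lie in pairwise different groups
-- of a given partition into bounded groups. So it suffices to choose H₀ such that H₀ with such a star and matching
-- always contains a Berge-F.
--
-- If F has no vertex cover of size k, let s be maximal such that F has no cover of size s, and let H₀ consist of all
-- k-sets with at most one vertex outside a fixed s-set; the hub of the star is the missing cover vertex.
--
-- If F has a cover of size k, let S_s have the hyperedges {aᵢ} ∪ P_j for s core vertices aᵢ and disjoint groups P_j of
-- size k − 1, and few further ones. Let s decrease from 4, always knowing that F embeds in S_s with a star and a
-- matching, until F is not contained in S_s; then H₀ = S_s works. In the step, F ⊆ S_{s+1}, and the hub replaces
-- the last core vertex: an edge of F using a hyperedge of its colour becomes a star edge if it leaves the core, and if it is a
-- bridge inside its group, the group is divided between the two ends of a matching edge. Since groups have at most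
-- 4 vertices, this fails only for a triangle or a 4-cycle, nearly isolated in F, which is then drawn
-- on two groups joined by one matching edge, with the rest of F placed by a small cover. The one case left over is k = 5,
-- s = 2 and an isolated triangle in a graph without a cover of size 4: there the hyperedges {a₀, d₀, d₁} ∪ P_j and
-- {a₁, d₀, d₁} ∪ P_j with |P_j| = 2 form a suitable H₀, unless they contain F, which then is simple enough for S_2.
module Submission where

open import Defs
open import Data.Bool using (Bool; true; false)
import Data.Bool.Properties as Boolₚ
open import Data.Empty using (⊥; ⊥-elim)
open import Data.Unit using (⊤; tt)
open import Data.Nat using (ℕ; zero; suc; _+_; _*_; _∸_; _^_; _≤_; _<_; _>_; z≤n; s≤s)
import Data.Nat as ℕ
import Data.Nat.Properties as ℕₚ
open import Data.Nat.DivMod using (_/_; _%_; m≡m%n+[m/n]*n; m%n<n)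
open import Data.Fin using (Fin; zero; suc; toℕ; fromℕ<; punchOut; punchIn; _↑ˡ_; _↑ʳ_)
import Data.Fin.Properties as Finₚ
open import Data.Fin.Properties using (any?; all?; +↔⊎; *↔×)
open import Data.Fin.Subset using (Subset; inside; outside; _∈_; _∉_; ∣_∣)
open import Data.Fin.Subset.Properties using (_∈?_; ⊆-antisym; ∣⊥∣≡0)
open import Data.Fin.Permutation.Components using (transpose; transpose-inverse)
import Data.Vec as Vec
open import Data.Vec using (_∷_; []; here; there)
import Data.Vec.Properties as Vecₚ
import Data.Vec.Functional as Fun
open import Data.List using (List; []; _∷_; _++_; concatMap; length; lookup; map; filter; allFin; tabulate)
import Data.List.Properties as Listₚ
open import Data.List.Membership.Propositional using (find) renaming (_∈_ to _∈ₗ_; _∉_ to _∉ₗ_)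
open import Data.List.Membership.Propositional.Properties
  using (∈-map⁺; ∈-map⁻; ∈-++⁺ˡ; ∈-++⁺ʳ; ∈-++⁻; ∈-filter⁺; ∈-filter⁻; ∈-allFin; ∈-tabulate⁺; ∈-lookup)
import Data.List.Membership.DecPropositional as DecMem
open import Data.List.Relation.Unary.All using (All; []; _∷_)
import Data.List.Relation.Unary.All as All
import Data.List.Relation.Unary.All.Properties as Allₚ
import Data.List.Relation.Unary.Any as Any
open import Data.List.Relation.Unary.Any using (Any; here; there; index)
open import Data.List.Relation.Unary.Any.Properties using (lookup-index)
open import Data.List.Relation.Unary.AllPairs using ([]; _∷_)
open import Data.List.Relation.Unary.Unique.Propositional using (Unique)
import Data.List.Relation.Unary.Unique.Propositional.Properties as Uniqueₚ
open import Data.Maybe using (Maybe; just; nothing)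
open import Data.Maybe.Properties using (just-injective)
import Data.Maybe.Properties as Maybeₚ
open import Data.Product using (Σ; ∃; _×_; _,_; proj₁; proj₂)
import Data.Product.Properties as Productₚ
open import Data.Sum using (_⊎_; inj₁; inj₂; [_,_]′)
import Data.Sum.Properties as Sumₚ
open import Function using (_∘_; id; case_of_)
open import Function.Bundles using (_↔_; Inverse)
import Function.Construct.Composition as Comp
import Function.Construct.Identity as Ident
open import Data.Sum.Function.Propositional using (_⊎-↔_)
open import Data.Product.Function.NonDependent.Propositional using (_×-↔_)
open import Function.Definitions using (Injective)
open import Relation.Binary.Definitions using (DecidableEquality)
open import Relation.Binary.PropositionalEquality using (_≡_; _≢_; refl; sym; trans; cong; cong₂; subst; module ≡-Reasoning)
open import Relation.Nullary using (¬_; Dec; yes; no)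
open import Relation.Nullary.Decidable using (map′; _×-dec_; _⊎-dec_; _→-dec_; ¬?; dec-true; dec-false)

-- The completion decides where the star and the matching meet the groups, so embeddings are built
-- for arbitrary touched positions `tp`; positions within a group are interchangeable in `H₀`, so a
-- transposition adjusts them. The count behind the descent: a group of S_{s+1} lies in at most s +
-- 1 hyperedges, a touched group of S_s in s hyperedges of `H₀` and one star or matching edge. That
-- edge is known to meet the group in one vertex only, so it can replace the lost hyperedge only at
-- a core vertex or along a bridge. An edge that is no bridge lies on a cycle of at most k - 1
-- vertices: with k at most 5 its length is 3 or 4, and since s + 1 is at most 4 the cycle uses up
-- the colours of its group but for at most one. The start s = 4 is chosen because four core
-- vertices and the hub hold a vertex cover of size 5, and the descent must stop, since S_0 has no
-- hyperedges while F has an edge. In the redrawing of a triangle, one core vertex is spent on its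
-- apex while two vertices of a cover are saved, which asks for a cover of size s + 2. For s = 3
-- that is granted; for s = 2 it is what may fail when k = 5.

module _ {A : Set} where

  lookup-injective : ∀ {xs : List A} → Unique xs → ∀ {i j} → lookup xs i ≡ lookup xs j → i ≡ j
  lookup-injective (x∉ ∷ u) {zero}  {zero}  eq = refl
  lookup-injective (x∉ ∷ u) {zero}  {suc j} eq = ⊥-elim (All.lookup x∉ (∈-lookup j) eq)
  lookup-injective (x∉ ∷ u) {suc i} {zero}  eq = ⊥-elim (All.lookup x∉ (∈-lookup i) (sym eq))
  lookup-injective (x∉ ∷ u) {suc i} {suc j} eq = cong suc (lookup-injective u eq)

  ∉⇒All≢ : ∀ {x} {xs : List A} → x ∉ₗ xs → All (x ≢_) xs
  ∉⇒All≢ x∉ = All.tabulate λ y∈ x≡y → x∉ (subst (_∈ₗ _) (sym x≡y) y∈)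

retract-inj : ∀ {A B : Set} {f : A → B} (g : B → A) → (∀ a → g (f a) ≡ a) → ∀ {a b} → f a ≡ f b → a ≡ b
retract-inj g gf {a} {b} eq = trans (sym (gf a)) (trans (cong g eq) (gf b))

retract-injᵐ : ∀ {A B : Set} {f : A → B} (g : B → Maybe A) → (∀ a → g (f a) ≡ just a) → ∀ {a b} → f a ≡ f b → a ≡ b
retract-injᵐ g gf {a} {b} eq = just-injective (trans (sym (gf a)) (trans (cong g eq) (gf b)))

-- Decidable search over finite functions, and the list of all subsets

choose⊎ : ∀ {n} {A B : Fin n → Set} → (∀ i → A i ⊎ B i) → (∀ i → A i) ⊎ (∃ B)
choose⊎ {zero}  f = inj₁ λ ()
choose⊎ {suc n} f with f zero | choose⊎ (f ∘ suc)
... | inj₂ b | _            = inj₂ (zero , b)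
... | inj₁ a | inj₂ (i , b) = inj₂ (suc i , b)
... | inj₁ a | inj₁ g       = inj₁ λ { zero → a ; (suc i) → g i }

-- Functions are enumerated as iterated `Fun.∷`, which agree with a given function only pointwise;
-- `resp` stands in for function extensionality.
anyFun? : ∀ {a b} {P : (Fin a → Fin b) → Set} →
          (∀ {f g} → (∀ i → f i ≡ g i) → P f → P g) →
          (∀ f → Dec (P f)) → Dec (∃ P)
anyFun? {zero} resp P? =
  map′ (λ Pf → _ , Pf) (λ { (f , Pf) → resp (λ ()) Pf }) (P? λ ())
anyFun? {suc a} {P = P} resp P? =
  map′ (λ { (x , f , Pxf) → (x Fun.∷ f) , Pxf })
       (λ { (f , Pf) → f zero , f ∘ suc , resp (λ { zero → refl ; (suc i) → refl }) Pf })
       (any? λ x → anyFun? {P = λ f → P (x Fun.∷ f)}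
         (λ f≗g → resp λ { zero → refl ; (suc i) → f≗g i })
         (λ f → P? (x Fun.∷ f)))

injective? : ∀ {a b} (f : Fin a → Fin b) → Dec (Injective _≡_ _≡_ f)
injective? f = map′ (λ inj {x} {y} → inj x y) (λ inj x y → inj {x} {y})
  (all? λ x → all? λ y → (f x Finₚ.≟ f y) →-dec (x Finₚ.≟ y))

injective-resp : ∀ {A B : Set} {f g : A → B} → (∀ i → f i ≡ g i) → Injective _≡_ _≡_ f → Injective _≡_ _≡_ g
injective-resp f≗g inj {x} {y} gx≡gy = inj (trans (f≗g x) (trans gx≡gy (sym (f≗g y))))

subsets : ∀ n → List (Subset n)
subsets zero    = [] ∷ []
subsets (suc n) = map (inside ∷_) (subsets n) ++ map (outside ∷_) (subsets n)

∈-subsets : ∀ {n} (S : Subset n) → S ∈ₗ subsets n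
∈-subsets []            = here refl
∈-subsets (inside ∷ S)  = ∈-++⁺ˡ (∈-map⁺ _ (∈-subsets S))
∈-subsets (outside ∷ S) = ∈-++⁺ʳ _ (∈-map⁺ _ (∈-subsets S))

subsets-unique : ∀ n → Unique (subsets n)
subsets-unique zero    = [] ∷ []
subsets-unique (suc n) = Uniqueₚ.++⁺
  (Uniqueₚ.map⁺ Vecₚ.∷-injectiveʳ (subsets-unique n))
  (Uniqueₚ.map⁺ Vecₚ.∷-injectiveʳ (subsets-unique n))
  λ { (l , r) → case ∈-map⁻ _ l of λ { (_ , _ , eq) → case ∈-map⁻ _ r of λ { (_ , _ , eq′) →
        case trans (sym eq) eq′ of λ () } } }

_≟S_ : ∀ {n} → DecidableEquality (Subset n)
_≟S_ = Vecₚ.≡-dec Boolₚ._≟_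

-- Abstract incidence embeddings and the edges of F

record EmbedsIn {V D : Set} (F : Graph) (inc : V → D → Set) : Set where
  field
    ψ     : Fin (p F) → V
    φ     : Fin (length (edges F)) → D
    ψ-inj : Injective _≡_ _≡_ ψ
    φ-inj : Injective _≡_ _≡_ φ
    incˡ  : ∀ i → inc (ψ (proj₁ (lookup (edges F) i))) (φ i)
    incʳ  : ∀ i → inc (ψ (proj₂ (lookup (edges F) i))) (φ i)

-- Copies are built in symbolic models and only then transported to real hypergraphs; this is why
-- vertices and hyperedges are arbitrary types.
embed-map : ∀ {V D V′ D′ : Set} {F} {inc : V → D → Set} {inc′ : V′ → D′ → Set}
  (f : V → V′) (g : D → D′) → Injective _≡_ _≡_ f → Injective _≡_ _≡_ g →
  (∀ {v d} → inc v d → inc′ (f v) (g d)) → EmbedsIn F inc → EmbedsIn F inc′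
embed-map f g f-inj g-inj pres E = record
  { ψ = f ∘ ψ ; φ = g ∘ φ ; ψ-inj = ψ-inj ∘ f-inj ; φ-inj = φ-inj ∘ g-inj
  ; incˡ = pres ∘ incˡ ; incʳ = pres ∘ incʳ }
  where open EmbedsIn E

module Graphs (F : Graph) where

  P m : ℕ
  P = p F
  m = length (edges F)

  src tgt : Fin m → Fin P
  src i = proj₁ (lookup (edges F) i)
  tgt i = proj₂ (lookup (edges F) i)

  src<tgt : ∀ i → toℕ (src i) < toℕ (tgt i)
  src<tgt i = All.lookup (ordered F) (∈-lookup {xs = edges F} i)

  src≢tgt : ∀ i → src i ≢ tgt i
  src≢tgt i eq = ℕₚ.<⇒≢ (src<tgt i) (cong toℕ eq)

  Ends : Fin m → Fin P → Fin P → Set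
  Ends i u v = (src i ≡ u × tgt i ≡ v) ⊎ (src i ≡ v × tgt i ≡ u)

  Touches : Fin m → Fin P → Set
  Touches i u = src i ≡ u ⊎ tgt i ≡ u

  Ends? : ∀ i u v → Dec (Ends i u v)
  Ends? i u v = ((src i Finₚ.≟ u) ×-dec (tgt i Finₚ.≟ v)) ⊎-dec ((src i Finₚ.≟ v) ×-dec (tgt i Finₚ.≟ u))

  Ends-swap : ∀ {i u v} → Ends i u v → Ends i v u
  Ends-swap (inj₁ e) = inj₂ e
  Ends-swap (inj₂ e) = inj₁ e

  -- If the orientations are crossed, `src<tgt` for the two edges is contradictory; if they agree,
  -- distinctness of the list decides.
  edge-unique : ∀ {i j u v} → Ends i u v → Ends j u v → i ≡ j
  edge-unique (inj₁ (a , b)) (inj₁ (c , d)) =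
    lookup-injective (nodup F) (cong₂ _,_ (trans a (sym c)) (trans b (sym d)))
  edge-unique (inj₂ (a , b)) (inj₂ (c , d)) =
    lookup-injective (nodup F) (cong₂ _,_ (trans a (sym c)) (trans b (sym d)))
  edge-unique {i} {j} (inj₁ (refl , refl)) (inj₂ (c , d)) = ⊥-elim (ℕₚ.<-asym (src<tgt i)
    (subst (λ v → toℕ (tgt i) < toℕ v) d (subst (λ v → toℕ v < toℕ (tgt j)) c (src<tgt j))))
  edge-unique {i} {j} (inj₂ (refl , refl)) (inj₁ (c , d)) = ⊥-elim (ℕₚ.<-asym (src<tgt i)
    (subst (λ v → toℕ (tgt i) < toℕ v) d (subst (λ v → toℕ v < toℕ (tgt j)) c (src<tgt j))))

  Ends-≢ : ∀ {i u v} → Ends i u v → u ≢ v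
  Ends-≢ {i} (inj₁ (refl , refl)) = src≢tgt i
  Ends-≢ {i} (inj₂ (refl , refl)) = src≢tgt i ∘ sym

  Ends-cancel : ∀ {i u v v′} → Ends i u v → Ends i u v′ → v ≡ v′
  Ends-cancel {i} (inj₁ (a , b)) (inj₁ (c , d)) = trans (sym b) d
  Ends-cancel {i} (inj₁ (a , b)) (inj₂ (c , d)) = ⊥-elim (src≢tgt i (trans a (sym d)))
  Ends-cancel {i} (inj₂ (a , b)) (inj₁ (c , d)) = ⊥-elim (src≢tgt i (trans c (sym b)))
  Ends-cancel {i} (inj₂ (a , b)) (inj₂ (c , d)) = trans (sym a) c

-- Berge copies and greedy completion

-- A Berge copy whose hyperedges are given by value rather than by position.
module Berge (F : Graph) {n : ℕ} where
  open Graphs F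

  Copy : List (Subset n) → Set
  Copy Es = Σ (EmbedsIn F (_∈_ {n})) λ E → ∀ i → EmbedsIn.φ E i ∈ₗ Es

  copy⇒contains : ∀ {Es} → Copy Es → ContainsBerge F Es
  copy⇒contains {Es} (E , φ∈) = ψ , (λ i → index (φ∈ i)) , ψ-inj ,
    (λ {i} {j} eq → φ-inj (trans (lookup-index (φ∈ i)) (trans (cong (lookup Es) eq) (sym (lookup-index (φ∈ j)))))) ,
    λ i → subst (_ ∈_) (lookup-index (φ∈ i)) (incˡ i) , subst (_ ∈_) (lookup-index (φ∈ i)) (incʳ i)
    where open EmbedsIn E

  contains⇒copy : ∀ {Es} → Unique Es → ContainsBerge F Es → Copy Es
  contains⇒copy {Es} u (ψ , φ , ψ-inj , φ-inj , inc) = record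
    { ψ = ψ ; φ = lookup Es ∘ φ ; ψ-inj = ψ-inj ; φ-inj = φ-inj ∘ lookup-injective u
    ; incˡ = proj₁ ∘ inc ; incʳ = proj₂ ∘ inc } , λ i → ∈-lookup (φ i)

  contains-mono : ∀ {Es Es′} → Unique Es → (∀ {e} → e ∈ₗ Es → e ∈ₗ Es′) →
                  ContainsBerge F Es → ContainsBerge F Es′
  contains-mono u Es⊆ c with E , φ∈ ← contains⇒copy u c = copy⇒contains (E , Es⊆ ∘ φ∈)

  contains? : ∀ Es → Dec (ContainsBerge F Es)
  contains? Es = anyFun? respψ λ ψ → anyFun? (respφ ψ) λ φ →
    injective? ψ ×-dec injective? φ ×-dec
    all? λ i → (ψ (src i) ∈? lookup Es (φ i)) ×-dec (ψ (tgt i) ∈? lookup Es (φ i))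
    where
    Inc : (Fin P → Fin n) → (Fin m → Fin (length Es)) → Set
    Inc ψ φ = ∀ i → (ψ (src i) ∈ lookup Es (φ i)) × (ψ (tgt i) ∈ lookup Es (φ i))
    respφ : ∀ ψ {f g} → (∀ i → f i ≡ g i) →
            Injective _≡_ _≡_ ψ × Injective _≡_ _≡_ f × Inc ψ f → Injective _≡_ _≡_ ψ × Injective _≡_ _≡_ g × Inc ψ g
    respφ ψ f≗g (a , b , c) = a , injective-resp f≗g b ,
      λ i → subst (λ j → (ψ (src i) ∈ lookup Es j) × (ψ (tgt i) ∈ lookup Es j)) (f≗g i) (c i)
    respψ : ∀ {f g} → (∀ i → f i ≡ g i) →
            (∃ λ φ → Injective _≡_ _≡_ f × Injective _≡_ _≡_ φ × Inc f φ) →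
            (∃ λ φ → Injective _≡_ _≡_ g × Injective _≡_ _≡_ φ × Inc g φ)
    respψ f≗g (φ , a , b , c) = φ , injective-resp f≗g a , b ,
      λ i → subst (_∈ _) (f≗g (src i)) (proj₁ (c i)) , subst (_∈ _) (f≗g (tgt i)) (proj₂ (c i))

  module Completion (k : ℕ) where
    open DecMem (_≟S_ {n}) using () renaming (_∈?_ to _∈ₗ?_)

    record Extension (todo acc : List (Subset n)) : Set where
      field
        all     : List (Subset n)
        unique  : Unique all
        uniform : All (λ e → ∣ e ∣ ≡ k) all
        free    : ¬ ContainsBerge F all
        extends : ∀ {e} → e ∈ₗ acc → e ∈ₗ all
        closed  : ∀ {S} → S ∈ₗ todo → ∣ S ∣ ≡ k → S ∉ₗ all → ContainsBerge F (S ∷ all)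

    -- A set is rejected only if it completes a copy with the hyperedges accepted so far. Those are
    -- all kept, so by `contains-mono` the rejection stays justified for the final list.
    extend : ∀ todo acc → Unique acc → All (λ e → ∣ e ∣ ≡ k) acc → ¬ ContainsBerge F acc → Extension todo acc
    extend [] acc u unif free = record
      { all = acc ; unique = u ; uniform = unif ; free = free ; extends = id ; closed = λ () }
    extend (S ∷ todo) acc u unif free with ∣ S ∣ ℕ.≟ k
    ... | no ≢k = record { Extension E ; closed = λ { (here refl) ≡k → ⊥-elim (≢k ≡k) ; (there S∈) → Extension.closed E S∈ } }
      where E = extend todo acc u unif free
    ... | yes ≡k with S ∈ₗ? acc
    ...   | yes S∈ = record { Extension E ; closed = λ { (here refl) _ S∉ → ⊥-elim (S∉ (Extension.extends E S∈)) ; (there S′∈) → Extension.closed E S′∈ } }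
      where E = extend todo acc u unif free
    ...   | no S∉ with contains? (S ∷ acc)
    ...     | yes c = record { Extension E ; closed = λ { (here refl) _ _ → contains-mono (∉⇒All≢ S∉ ∷ u)
                                 (λ { (here refl) → here refl ; (there e∈) → there (Extension.extends E e∈) }) c
                             ; (there S∈) → Extension.closed E S∈ } }
      where E = extend todo acc u unif free
    ...     | no ¬c = record { Extension E ; extends = Extension.extends E ∘ there
                             ; closed = λ { (here refl) _ S∉ → ⊥-elim (S∉ (Extension.extends E (here refl))) ; (there S∈) → Extension.closed E S∈ } }
      where E = extend todo (S ∷ acc) (∉⇒All≢ S∉ ∷ u) (≡k ∷ unif) ¬c

    saturate : ∀ H₀ → Unique H₀ → All (λ e → ∣ e ∣ ≡ k) H₀ → ¬ ContainsBerge F H₀ →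
               Σ (Hypergraph n) λ H → BergeSaturated k F H × (∀ {e} → e ∈ₗ H₀ → e ∈ₗ hedges H)
    saturate H₀ u unif free = record { hedges = all ; hnodup = unique } ,
      (uniform , free′ , λ S → closed (∈-subsets S)) , extends
      where open Extension (extend (subsets n) H₀ u unif free) renaming (free to free′)

-- Counting: many hyperedges force a star and a matching

module _ {A : Set} {Q : A → Set} (Q? : ∀ x → Dec (Q x)) where

  length-split : ∀ xs → length xs ≡ length (filter Q? xs) + length (filter (¬? ∘ Q?) xs)
  length-split []       = refl
  length-split (x ∷ xs) with Q? x
  ... | yes _ = cong suc (length-split xs)
  ... | no  _ = trans (cong suc (length-split xs)) (sym (ℕₚ.+-suc _ _))

all-equal⇒length≤1 : ∀ {A : Set} {xs : List A} → Unique xs → (∀ {x y} → x ∈ₗ xs → y ∈ₗ xs → x ≡ y) → length xs ≤ 1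
all-equal⇒length≤1 {xs = []}         _        _  = z≤n
all-equal⇒length≤1 {xs = x ∷ []}     _        _  = s≤s z≤n
all-equal⇒length≤1 {xs = x ∷ y ∷ xs} (x∉ ∷ _) eq = ⊥-elim (All.head x∉ (eq (here refl) (there (here refl))))

module Removal {A : Set} (_≟_ : DecidableEquality A) where
  open DecMem _≟_ using () renaming (_∈?_ to _∈ₗ?_)

  unique-⊆-length : ∀ ys {xs} → Unique xs → (∀ {x} → x ∈ₗ xs → x ∈ₗ ys) → length xs ≤ length ys
  unique-⊆-length []       {[]}     _ _   = z≤n
  unique-⊆-length []       {x ∷ xs} _ sub = case sub (here refl) of λ ()
  unique-⊆-length (y ∷ ys) {xs}     u sub = begin
    length xs                                                     ≡⟨ length-split (_≟ y) xs ⟩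
    length (filter (_≟ y) xs) + length (filter (¬? ∘ (_≟ y)) xs)  ≤⟨ ℕₚ.+-mono-≤
      (all-equal⇒length≤1 (Uniqueₚ.filter⁺ (_≟ y) u) λ a∈ b∈ →
        trans (proj₂ (∈-filter⁻ (_≟ y) {xs = xs} a∈)) (sym (proj₂ (∈-filter⁻ (_≟ y) {xs = xs} b∈))))
      (unique-⊆-length ys (Uniqueₚ.filter⁺ (¬? ∘ (_≟ y)) u) λ a∈ → drop (∈-filter⁻ (¬? ∘ (_≟ y)) {xs = xs} a∈)) ⟩
    suc (length ys)                                               ∎
    where
    open ℕₚ.≤-Reasoning
    drop : ∀ {a} → a ∈ₗ xs × a ≢ y → a ∈ₗ ys
    drop (a∈ , a≢y) with sub a∈
    ... | here a≡y  = ⊥-elim (a≢y a≡y)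
    ... | there a∈′ = a∈′

  remove : List A → List A → List A
  remove ys = filter (λ x → ¬? (x ∈ₗ? ys))

  remove-unique : ∀ ys {xs} → Unique xs → Unique (remove ys xs)
  remove-unique ys = Uniqueₚ.filter⁺ (λ x → ¬? (x ∈ₗ? ys))

  ∈-remove⁻ : ∀ ys xs {x} → x ∈ₗ remove ys xs → x ∈ₗ xs × x ∉ₗ ys
  ∈-remove⁻ ys xs = ∈-filter⁻ (λ x → ¬? (x ∈ₗ? ys)) {xs = xs}

  length-remove : ∀ ys {xs} → Unique xs → length xs ≤ length ys + length (remove ys xs)
  length-remove ys {xs} u = ℕₚ.≤-trans (ℕₚ.≤-reflexive (length-split (_∈ₗ? ys) xs))
    (ℕₚ.+-monoˡ-≤ _ (unique-⊆-length ys (Uniqueₚ.filter⁺ (_∈ₗ? ys) u)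
      λ a∈ → proj₂ (∈-filter⁻ (_∈ₗ? ys) {xs = xs} a∈)))

length-concatMap : ∀ {A B : Set} (f : A → List B) g → (∀ x → length (f x) ≤ g) → ∀ xs →
                   length (concatMap f xs) ≤ length xs * g
length-concatMap f g f≤ []       = z≤n
length-concatMap f g f≤ (x ∷ xs) = ℕₚ.≤-trans (ℕₚ.≤-reflexive (Listₚ.length-++ (f x)))
  (ℕₚ.+-mono-≤ (f≤ x) (length-concatMap f g f≤ xs))

∈-concatMap : ∀ {A B : Set} (f : A → List B) {x y xs} → x ∈ₗ xs → y ∈ₗ f x → y ∈ₗ concatMap f xs
∈-concatMap f (here refl) y∈ = ∈-++⁺ˡ y∈
∈-concatMap f (there x∈)  y∈ = ∈-++⁺ʳ (f _) (∈-concatMap f x∈ y∈)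

-- The members of `Es` are told apart by their traces on `Z` alone; each step splits them by
-- membership of one element of `Z`.
agree⇒length≤2^ : ∀ {n} (Z : List (Fin n)) {Es : List (Subset n)} → Unique Es →
  (∀ {e e′} → e ∈ₗ Es → e′ ∈ₗ Es → ∀ v → v ∉ₗ Z → v ∈ e → v ∈ e′) → length Es ≤ 2 ^ length Z
agree⇒length≤2^ [] u agree = all-equal⇒length≤1 u λ e∈ e′∈ →
  ⊆-antisym (agree e∈ e′∈ _ λ ()) (agree e′∈ e∈ _ λ ())
agree⇒length≤2^ {n} (z ∷ Z) {Es} u agree = begin
  length Es                                                ≡⟨ length-split (z ∈?_) Es ⟩
  length (filter (z ∈?_) Es) + length (filter (¬? ∘ (z ∈?_)) Es)
    ≤⟨ ℕₚ.+-mono-≤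
         (agree⇒length≤2^ Z (Uniqueₚ.filter⁺ (z ∈?_) u) (in-agree))
         (agree⇒length≤2^ Z (Uniqueₚ.filter⁺ (¬? ∘ (z ∈?_)) u) (out-agree)) ⟩
  2 ^ length Z + 2 ^ length Z                              ≡⟨ cong (2 ^ length Z +_) (sym (ℕₚ.+-identityʳ _)) ⟩
  2 ^ suc (length Z)                                       ∎
  where
  open ℕₚ.≤-Reasoning
  in-agree : ∀ {e e′} → e ∈ₗ filter (z ∈?_) Es → e′ ∈ₗ filter (z ∈?_) Es → ∀ v → v ∉ₗ Z → v ∈ e → v ∈ e′
  in-agree e∈ e′∈ v v∉ v∈ with v Finₚ.≟ z
  ... | yes refl = proj₂ (∈-filter⁻ (z ∈?_) {xs = Es} e′∈)
  ... | no v≢z   = agree (proj₁ (∈-filter⁻ (z ∈?_) {xs = Es} e∈)) (proj₁ (∈-filter⁻ (z ∈?_) {xs = Es} e′∈)) v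
    (λ { (here v≡z) → v≢z v≡z ; (there v∈Z) → v∉ v∈Z }) v∈
  out-agree : ∀ {e e′} → e ∈ₗ filter (¬? ∘ (z ∈?_)) Es → e′ ∈ₗ filter (¬? ∘ (z ∈?_)) Es → ∀ v → v ∉ₗ Z → v ∈ e → v ∈ e′
  out-agree e∈ e′∈ v v∉ v∈ with v Finₚ.≟ z
  ... | yes refl = ⊥-elim (proj₂ (∈-filter⁻ (¬? ∘ (z ∈?_)) {xs = Es} e∈) v∈)
  ... | no v≢z   = agree (proj₁ (∈-filter⁻ (¬? ∘ (z ∈?_)) {xs = Es} e∈)) (proj₁ (∈-filter⁻ (¬? ∘ (z ∈?_)) {xs = Es} e′∈)) v
    (λ { (here v≡z) → v≢z v≡z ; (there v∈Z) → v∉ v∈Z }) v∈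

data Site (M L : ℕ) : Set where
  hub        : Site M L
  leaf       : Fin M → Site M L
  left right : Fin L → Site M L

-- `g` bounds the group size and `x` the number of blocked vertices. `c M x` bounds the hyperedges
-- through a vertex without a star of `M` leaves; `mb` and `sb` are to be multiplied by `n` and
-- bound the hyperedges of a hypergraph without `L` matching edges, respectively without star and
-- matching together.
module Bounds (g : ℕ) where

  c : ℕ → ℕ → ℕ
  c M x = M + 2 ^ (M * g + x)

  mb : ℕ → ℕ → ℕ
  mb zero    x = 0
  mb (suc L) x = c 1 (g + x) + 2 ^ x + suc (mb L (g + (g + x)))

  sb : ℕ → ℕ → ℕ → ℕ
  sb M L x = c M (g + x) + 2 ^ x + (M + mb L (M * g + (g + x)))

  c-mono : ∀ M {x y} → x ≤ y → c M x ≤ c M y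
  c-mono M x≤y = ℕₚ.+-monoʳ-≤ M (ℕₚ.^-monoʳ-≤ 2 (ℕₚ.+-monoʳ-≤ (M * g) x≤y))

  mb-mono : ∀ L {x y} → x ≤ y → mb L x ≤ mb L y
  mb-mono zero    x≤y = z≤n
  mb-mono (suc L) x≤y = ℕₚ.+-mono-≤ (ℕₚ.+-mono-≤ (c-mono 1 (ℕₚ.+-monoʳ-≤ g x≤y)) (ℕₚ.^-monoʳ-≤ 2 x≤y))
    (s≤s (mb-mono L (ℕₚ.+-monoʳ-≤ g (ℕₚ.+-monoʳ-≤ g x≤y))))

  sb-mono : ∀ M L {x y} → x ≤ y → sb M L x ≤ sb M L y
  sb-mono M L x≤y = ℕₚ.+-mono-≤ (ℕₚ.+-mono-≤ (c-mono M (ℕₚ.+-monoʳ-≤ g x≤y)) (ℕₚ.^-monoʳ-≤ 2 x≤y))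
    (ℕₚ.+-monoʳ-≤ M (mb-mono L (ℕₚ.+-monoʳ-≤ (M * g) (ℕₚ.+-monoʳ-≤ g x≤y))))

-- The partition is given by `lab`, together with a short list `cls v` containing the group of `v`:
-- blocking that list keeps later choices out of the group.
module Counting {n : ℕ} {A : Set} (lab : Fin n → A) (cls : Fin n → List (Fin n)) (g : ℕ)
                (cls-length : ∀ v → length (cls v) ≤ g)
                (cls-complete : ∀ {u v} → lab u ≡ lab v → u ∈ₗ cls v) where

  open DecMem (Finₚ._≟_ {n}) using () renaming (_∈?_ to _∈v?_)
  open Removal (_≟S_ {n})
  open Bounds g

  record Star (M : ℕ) (X : List (Fin n)) (Es : List (Subset n)) (v : Fin n) : Set where
    field
      b     : Fin M → Fin n
      e     : Fin M → Subset n
      e∈    : ∀ i → e i ∈ₗ Es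
      v∈    : ∀ i → v ∈ e i
      b∈    : ∀ i → b i ∈ e i
      b∉    : ∀ i → b i ∉ₗ X
      b-lab : ∀ {i j} → lab (b i) ≡ lab (b j) → i ≡ j
      e-inj : Injective _≡_ _≡_ e

  fresh? : ∀ X (e : Subset n) → Dec (∃ λ b → b ∈ e × b ∉ₗ X)
  fresh? X e = any? λ b → (b ∈? e) ×-dec ¬? (b ∈v? X)

  -- Greedy choice: a hyperedge with a vertex outside `X` yields a leaf, and the group of the leaf
  -- is then blocked. When no such hyperedge is left, all remaining ones lie inside `X`.
  star : ∀ M {x X Es v} → length X ≤ x → Unique Es → All (v ∈_) Es → Star M X Es v ⊎ length Es ≤ c M x
  star zero {x} _ u all = inj₁ record
    { b = λ () ; e = λ () ; e∈ = λ () ; v∈ = λ () ; b∈ = λ () ; b∉ = λ () ; b-lab = λ { {()} } ; e-inj = λ { {()} } }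
  star (suc M) {x} {X} {Es} {v} X≤ u all with Any.any? (fresh? X) Es
  ... | no none = inj₂ (begin
          length Es                    ≤⟨ agree⇒length≤2^ X u (λ {e} e∈ _ w w∉ w∈ → ⊥-elim (none
                                            (Any.map (λ { refl → w , w∈ , w∉ }) e∈))) ⟩
          2 ^ length X                 ≤⟨ ℕₚ.^-monoʳ-≤ 2 (ℕₚ.≤-trans X≤ (ℕₚ.m≤n+m x (suc M * g))) ⟩
          2 ^ (suc M * g + x)          ≤⟨ ℕₚ.m≤n+m _ (suc M) ⟩
          c (suc M) x                  ∎)
    where open ℕₚ.≤-Reasoning
  ... | yes found with e₀ , e₀∈ , b₀ , b₀∈ , b₀∉ ← find found
      with star M {g + x} {cls b₀ ++ X} {remove (e₀ ∷ []) Es} {v}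
             (ℕₚ.≤-trans (ℕₚ.≤-reflexive (Listₚ.length-++ (cls b₀))) (ℕₚ.+-mono-≤ (cls-length b₀) X≤))
             (remove-unique (e₀ ∷ []) u)
             (All.tabulate λ e∈ → All.lookup all (proj₁ (∈-remove⁻ (e₀ ∷ []) Es e∈)))
  ...   | inj₂ small = inj₂ (begin
          length Es                            ≤⟨ length-remove (e₀ ∷ []) u ⟩
          suc (length (remove (e₀ ∷ []) Es))   ≤⟨ s≤s small ⟩
          suc M + 2 ^ (M * g + (g + x))        ≡⟨ cong (λ y → suc M + 2 ^ y) (trans (sym (ℕₚ.+-assoc (M * g) g x)) (cong (_+ x) (ℕₚ.+-comm (M * g) g))) ⟩
          c (suc M) x                          ∎)
    where open ℕₚ.≤-Reasoning
  ...   | inj₁ S = inj₁ record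
          { b = λ { zero → b₀ ; (suc i) → S.b i }
          ; e = λ { zero → e₀ ; (suc i) → S.e i }
          ; e∈ = λ { zero → e₀∈ ; (suc i) → proj₁ (∈-remove⁻ (e₀ ∷ []) Es (S.e∈ i)) }
          ; v∈ = λ { zero → All.lookup all e₀∈ ; (suc i) → S.v∈ i }
          ; b∈ = λ { zero → b₀∈ ; (suc i) → S.b∈ i }
          ; b∉ = λ { zero → b₀∉ ; (suc i) → S.b∉ i ∘ ∈-++⁺ʳ (cls b₀) }
          ; b-lab = λ { {zero} {zero} _ → refl
                      ; {zero} {suc j} eq → ⊥-elim (S.b∉ j (∈-++⁺ˡ (cls-complete (sym eq))))
                      ; {suc i} {zero} eq → ⊥-elim (S.b∉ i (∈-++⁺ˡ (cls-complete eq)))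
                      ; {suc i} {suc j} eq → cong suc (S.b-lab eq) }
          ; e-inj = λ { {zero} {zero} _ → refl
                      ; {zero} {suc j} eq → ⊥-elim (proj₂ (∈-remove⁻ (e₀ ∷ []) Es (S.e∈ j)) (here (sym eq)))
                      ; {suc i} {zero} eq → ⊥-elim (proj₂ (∈-remove⁻ (e₀ ∷ []) Es (S.e∈ i)) (here eq))
                      ; {suc i} {suc j} eq → cong suc (S.e-inj eq) }
          }
    where module S = Star S

  record Hub (M : ℕ) (X : List (Fin n)) (Es : List (Subset n)) : Set where
    field
      v     : Fin n
      v∉    : v ∉ₗ X
      star′ : Star M (cls v ++ X) Es v

  -- The vertices outside `X` are treated one by one: the hyperedges through one of them contain a
  -- star, or they are few and are set aside. Whatever survives lies inside `X`, whence the summand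
  -- `2 ^ x`.
  hub? : ∀ M {x X Es} → length X ≤ x → Unique Es → Hub M X Es ⊎ length Es ≤ n * c M (g + x) + 2 ^ x
  hub? M {x} {X} {Es} X≤ u = subst (λ l → Hub M X Es ⊎ length Es ≤ l * c M (g + x) + 2 ^ x) (Listₚ.length-tabulate {n = n} id)
                               (go (allFin n) u λ _ _ → inj₁ (∈-allFin _))
    where
    open ℕₚ.≤-Reasoning
    go : ∀ vs {Es} → Unique Es → (∀ {e w} → e ∈ₗ Es → w ∈ e → w ∈ₗ vs ⊎ w ∈ₗ X) →
         Hub M X Es ⊎ length Es ≤ length vs * c M (g + x) + 2 ^ x
    go [] u cov = inj₂ (ℕₚ.≤-trans (agree⇒length≤2^ X u λ e∈ _ w w∉ w∈ →
      case cov e∈ w∈ of λ { (inj₂ w∈X) → ⊥-elim (w∉ w∈X) }) (ℕₚ.^-monoʳ-≤ 2 X≤))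
    go (v ∷ vs) {Es} u cov with v ∈v? X
    ... | yes v∈X with go vs u (λ e∈ w∈ → case cov e∈ w∈ of λ
                     { (inj₁ (here refl)) → inj₂ v∈X ; (inj₁ (there w∈vs)) → inj₁ w∈vs ; (inj₂ w∈X) → inj₂ w∈X })
    ...   | inj₁ H = inj₁ H
    ...   | inj₂ small = inj₂ (ℕₚ.≤-trans small (ℕₚ.+-monoˡ-≤ (2 ^ x) (ℕₚ.m≤n+m (length vs * c M (g + x)) (c M (g + x)))))
    go (v ∷ vs) {Es} u cov | no v∉X
      with star M {g + x} {cls v ++ X} {filter (v ∈?_) Es} {v}
             (ℕₚ.≤-trans (ℕₚ.≤-reflexive (Listₚ.length-++ (cls v))) (ℕₚ.+-mono-≤ (cls-length v) X≤))
             (Uniqueₚ.filter⁺ (v ∈?_) u) (All.tabulate λ e∈ → proj₂ (∈-filter⁻ (v ∈?_) {xs = Es} e∈))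
         | go vs {filter (¬? ∘ (v ∈?_)) Es} (Uniqueₚ.filter⁺ (¬? ∘ (v ∈?_)) u) (λ e∈ w∈ →
             case ∈-filter⁻ (¬? ∘ (v ∈?_)) {xs = Es} e∈ of λ { (e∈Es , v∉e) → case cov e∈Es w∈ of λ
               { (inj₁ (here refl)) → ⊥-elim (v∉e w∈) ; (inj₁ (there w∈vs)) → inj₁ w∈vs ; (inj₂ w∈X) → inj₂ w∈X } })
    ... | inj₁ S | _ = inj₁ record { v = v ; v∉ = v∉X ; star′ = record { Star S ; e∈ = λ i → proj₁ (∈-filter⁻ (v ∈?_) {xs = Es} (Star.e∈ S i)) } }
    ... | inj₂ _ | inj₁ H = inj₁ record { Hub H ; star′ = record { Star (Hub.star′ H) ; e∈ = λ i → proj₁ (∈-filter⁻ (¬? ∘ (v ∈?_)) {xs = Es} (Star.e∈ (Hub.star′ H) i)) } }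
    ... | inj₂ d | inj₂ r = inj₂ (begin
      length Es ≡⟨ length-split (v ∈?_) Es ⟩
      length (filter (v ∈?_) Es) + length (filter (¬? ∘ (v ∈?_)) Es) ≤⟨ ℕₚ.+-mono-≤ d r ⟩
      c M (g + x) + (length vs * c M (g + x) + 2 ^ x) ≡⟨ ℕₚ.+-assoc (c M (g + x)) (length vs * c M (g + x)) (2 ^ x) ⟨
      c M (g + x) + length vs * c M (g + x) + 2 ^ x ∎)

  hub-bound : ∀ M {x y} → n > 0 → y ≤ n * c M (g + x) + 2 ^ x → y ≤ n * (c M (g + x) + 2 ^ x)
  hub-bound M {x} n>0 y≤ = ℕₚ.≤-trans y≤ (ℕₚ.≤-trans
    (ℕₚ.+-monoʳ-≤ (n * c M (g + x)) (ℕₚ.m≤n*m (2 ^ x) n ⦃ ℕ.>-nonZero n>0 ⦄))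
    (ℕₚ.≤-reflexive (sym (ℕₚ.*-distribˡ-+ n (c M (g + x)) (2 ^ x)))))

  record Matching (L : ℕ) (X : List (Fin n)) (Es : List (Subset n)) : Set where
    field
      w     : Fin L ⊎ Fin L → Fin n
      e     : Fin L → Subset n
      w∉    : ∀ s → w s ∉ₗ X
      w-lab : ∀ {s t} → lab (w s) ≡ lab (w t) → s ≡ t
      e-inj : Injective _≡_ _≡_ e
      e∈    : ∀ i → e i ∈ₗ Es
      l∈    : ∀ i → w (inj₁ i) ∈ e i
      r∈    : ∀ i → w (inj₂ i) ∈ e i

  -- A hub with a single leaf is a matching edge. Blocking its two groups and removing its hyperedge
  -- accounts for `g + (g + x)` and `suc` in `mb`.
  matching : ∀ L {x X Es} → n > 0 → length X ≤ x → Unique Es → Matching L X Es ⊎ length Es ≤ n * mb L x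
  matching zero n>0 X≤ u = inj₁ record
    { w = λ { (inj₁ ()) ; (inj₂ ()) } ; e = λ () ; w∉ = λ { (inj₁ ()) ; (inj₂ ()) }
    ; w-lab = λ { {inj₁ ()} ; {inj₂ ()} } ; e-inj = λ { {()} } ; e∈ = λ () ; l∈ = λ () ; r∈ = λ () }
  matching (suc L) {x} {X} {Es} n>0 X≤ u with hub? 1 X≤ u
  ... | inj₂ small = inj₂ (ℕₚ.≤-trans (hub-bound 1 n>0 small) (ℕₚ.*-monoʳ-≤ n (ℕₚ.m≤m+n _ _)))
  ... | inj₁ H with matching L {g + (g + x)} {cls (Star.b (Hub.star′ H) zero) ++ cls (Hub.v H) ++ X}
                      {remove (Star.e (Hub.star′ H) zero ∷ []) Es} n>0
                      (ℕₚ.≤-trans (ℕₚ.≤-reflexive (trans (Listₚ.length-++ (cls (Star.b (Hub.star′ H) zero))) (cong (_ +_) (Listₚ.length-++ (cls (Hub.v H))))))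
                        (ℕₚ.+-mono-≤ (cls-length _) (ℕₚ.+-mono-≤ (cls-length _) X≤)))
                      (remove-unique _ u)
  ...   | inj₂ small = inj₂ (begin
          length Es   ≤⟨ length-remove (Star.e (Hub.star′ H) zero ∷ []) u ⟩
          suc (length (remove (Star.e (Hub.star′ H) zero ∷ []) Es)) ≤⟨ ℕₚ.+-mono-≤ n>0 small ⟩
          n + n * mb L (g + (g + x)) ≡⟨ ℕₚ.*-suc n _ ⟨
          n * suc (mb L (g + (g + x))) ≤⟨ ℕₚ.*-monoʳ-≤ n (ℕₚ.m≤n+m _ (c 1 (g + x) + 2 ^ x)) ⟩
          n * mb (suc L) x ∎)
    where open ℕₚ.≤-Reasoning
  ...   | inj₁ R = inj₁ record
          { w = w ; e = λ { zero → S.e zero ; (suc i) → R.e i }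
          ; w∉ = λ { (inj₁ zero) → H.v∉ ; (inj₁ (suc i)) → R.w∉ (inj₁ i) ∘ old
                   ; (inj₂ zero) → S.b∉ zero ∘ ∈-++⁺ʳ (cls H.v) ; (inj₂ (suc i)) → R.w∉ (inj₂ i) ∘ old }
          ; w-lab = w-lab _ _
          ; e-inj = λ { {zero} {zero} _ → refl
                      ; {zero} {suc j} eq → ⊥-elim (proj₂ (∈-remove⁻ (S.e zero ∷ []) Es (R.e∈ j)) (here (sym eq)))
                      ; {suc i} {zero} eq → ⊥-elim (proj₂ (∈-remove⁻ (S.e zero ∷ []) Es (R.e∈ i)) (here eq))
                      ; {suc i} {suc j} eq → cong suc (R.e-inj eq) }
          ; e∈ = λ { zero → S.e∈ zero ; (suc i) → proj₁ (∈-remove⁻ (S.e zero ∷ []) Es (R.e∈ i)) }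
          ; l∈ = λ { zero → S.v∈ zero ; (suc i) → R.l∈ i }
          ; r∈ = λ { zero → S.b∈ zero ; (suc i) → R.r∈ i } }
    where
    module H = Hub H
    module S = Star H.star′
    module R = Matching R
    w : Fin (suc L) ⊎ Fin (suc L) → Fin n
    w (inj₁ zero)    = H.v
    w (inj₁ (suc i)) = R.w (inj₁ i)
    w (inj₂ zero)    = S.b zero
    w (inj₂ (suc i)) = R.w (inj₂ i)
    old : ∀ {u} → u ∈ₗ X → u ∈ₗ cls (S.b zero) ++ cls H.v ++ X
    old = ∈-++⁺ʳ (cls (S.b zero)) ∘ ∈-++⁺ʳ (cls H.v)
    ≢b : ∀ {s} → lab (R.w s) ≢ lab (S.b zero)
    ≢b {s} eq = R.w∉ s (∈-++⁺ˡ (cls-complete eq))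
    ≢v : ∀ {s} → lab (R.w s) ≢ lab H.v
    ≢v {s} eq = R.w∉ s (∈-++⁺ʳ (cls (S.b zero)) (∈-++⁺ˡ (cls-complete eq)))
    b≢v : lab (S.b zero) ≢ lab H.v
    b≢v eq = S.b∉ zero (∈-++⁺ˡ (cls-complete eq))
    w-lab : ∀ s t → lab (w s) ≡ lab (w t) → s ≡ t
    w-lab (inj₁ zero)    (inj₁ zero)    eq = refl
    w-lab (inj₁ zero)    (inj₁ (suc j)) eq = ⊥-elim (≢v (sym eq))
    w-lab (inj₁ zero)    (inj₂ zero)    eq = ⊥-elim (b≢v (sym eq))
    w-lab (inj₁ zero)    (inj₂ (suc j)) eq = ⊥-elim (≢v (sym eq))
    w-lab (inj₁ (suc i)) (inj₁ zero)    eq = ⊥-elim (≢v eq)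
    w-lab (inj₁ (suc i)) (inj₁ (suc j)) eq with refl ← R.w-lab eq = refl
    w-lab (inj₁ (suc i)) (inj₂ zero)    eq = ⊥-elim (≢b eq)
    w-lab (inj₁ (suc i)) (inj₂ (suc j)) eq with () ← R.w-lab eq
    w-lab (inj₂ zero)    (inj₁ zero)    eq = ⊥-elim (b≢v eq)
    w-lab (inj₂ zero)    (inj₁ (suc j)) eq = ⊥-elim (≢b (sym eq))
    w-lab (inj₂ zero)    (inj₂ zero)    eq = refl
    w-lab (inj₂ zero)    (inj₂ (suc j)) eq = ⊥-elim (≢b (sym eq))
    w-lab (inj₂ (suc i)) (inj₁ zero)    eq = ⊥-elim (≢v eq)
    w-lab (inj₂ (suc i)) (inj₁ (suc j)) eq with () ← R.w-lab eq
    w-lab (inj₂ (suc i)) (inj₂ zero)    eq = ⊥-elim (≢b eq)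
    w-lab (inj₂ (suc i)) (inj₂ (suc j)) eq with refl ← R.w-lab eq = refl

  record System (M L : ℕ) (X : List (Fin n)) (Es : List (Subset n)) : Set where
    field
      w      : Site M L → Fin n
      w∉     : ∀ s → w s ∉ₗ X
      w-lab  : ∀ {s t} → lab (w s) ≡ lab (w t) → s ≡ t
      e      : Fin M ⊎ Fin L → Subset n
      e-inj  : Injective _≡_ _≡_ e
      e∈     : ∀ t → e t ∈ₗ Es
      hub∈   : ∀ i → w hub ∈ e (inj₁ i)
      leaf∈  : ∀ i → w (leaf i) ∈ e (inj₁ i)
      left∈  : ∀ i → w (left i) ∈ e (inj₂ i)
      right∈ : ∀ i → w (right i) ∈ e (inj₂ i)

  -- The star comes first; then its groups are blocked and its hyperedges removed, so that the
  -- matching found afterwards is disjoint from it in both respects.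
  system : ∀ M L {x X Es} → n > 0 → length X ≤ x → Unique Es → System M L X Es ⊎ length Es ≤ n * sb M L x
  system M L {x} {X} {Es} n>0 X≤ u with hub? M X≤ u
  ... | inj₂ small = inj₂ (ℕₚ.≤-trans (hub-bound M n>0 small) (ℕₚ.*-monoʳ-≤ n (ℕₚ.m≤m+n _ _)))
  ... | inj₁ H with matching L {M * g + (g + x)} {concatMap cls (tabulate (Star.b (Hub.star′ H))) ++ cls (Hub.v H) ++ X}
                      {remove (tabulate (Star.e (Hub.star′ H))) Es} n>0
                      (ℕₚ.≤-trans (ℕₚ.≤-reflexive (trans (Listₚ.length-++ (concatMap cls (tabulate (Star.b (Hub.star′ H))))) (cong (_ +_) (Listₚ.length-++ (cls (Hub.v H))))))
                        (ℕₚ.+-mono-≤ (subst (λ l → length (concatMap cls (tabulate (Star.b (Hub.star′ H)))) ≤ l * g) (Listₚ.length-tabulate (Star.b (Hub.star′ H)))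
                            (length-concatMap cls g cls-length (tabulate (Star.b (Hub.star′ H)))))
                          (ℕₚ.+-mono-≤ (cls-length _) X≤)))
                      (remove-unique _ u)
  ...   | inj₂ small = inj₂ (begin
          length Es   ≤⟨ length-remove (tabulate (Star.e (Hub.star′ H))) u ⟩
          length (tabulate (Star.e (Hub.star′ H))) + length (remove (tabulate (Star.e (Hub.star′ H))) Es)
            ≤⟨ ℕₚ.+-mono-≤ (ℕₚ.≤-trans (ℕₚ.≤-reflexive (Listₚ.length-tabulate (Star.e (Hub.star′ H)))) (ℕₚ.m≤n*m M n ⦃ ℕ.>-nonZero n>0 ⦄)) small ⟩
          n * M + n * mb L (M * g + (g + x)) ≡⟨ ℕₚ.*-distribˡ-+ n M _ ⟨
          n * (M + mb L (M * g + (g + x))) ≤⟨ ℕₚ.*-monoʳ-≤ n (ℕₚ.m≤n+m _ (c M (g + x) + 2 ^ x)) ⟩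
          n * sb M L x ∎)
    where open ℕₚ.≤-Reasoning
  ...   | inj₁ R = inj₁ record
          { w = w ; e = [ S.e , R.e ]′
          ; w∉ = λ { hub → H.v∉ ; (leaf i) → S.b∉ i ∘ ∈-++⁺ʳ (cls H.v) ; (left i) → R.w∉ (inj₁ i) ∘ old ; (right i) → R.w∉ (inj₂ i) ∘ old }
          ; w-lab = w-lab _ _
          ; e-inj = λ { {inj₁ i} {inj₁ j} eq → cong inj₁ (S.e-inj eq)
                      ; {inj₁ i} {inj₂ j} eq → ⊥-elim (new i j (sym eq))
                      ; {inj₂ i} {inj₁ j} eq → ⊥-elim (new j i eq)
                      ; {inj₂ i} {inj₂ j} eq → cong inj₂ (R.e-inj eq) }
          ; e∈ = λ { (inj₁ i) → S.e∈ i ; (inj₂ i) → proj₁ (∈-remove⁻ (tabulate S.e) Es (R.e∈ i)) }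
          ; hub∈ = S.v∈ ; leaf∈ = S.b∈ ; left∈ = R.l∈ ; right∈ = R.r∈ }
    where
    module H = Hub H
    module S = Star H.star′
    module R = Matching R
    bs : List (Fin n)
    bs = concatMap cls (tabulate S.b)
    w : Site M L → Fin n
    w hub       = H.v
    w (leaf i)  = S.b i
    w (left i)  = R.w (inj₁ i)
    w (right i) = R.w (inj₂ i)
    old : ∀ {u} → u ∈ₗ X → u ∈ₗ bs ++ cls H.v ++ X
    old = ∈-++⁺ʳ bs ∘ ∈-++⁺ʳ (cls H.v)
    new : ∀ i j → R.e j ≢ S.e i
    new i j eq = proj₂ (∈-remove⁻ (tabulate S.e) Es (R.e∈ j)) (subst (_∈ₗ tabulate S.e) (sym eq) (∈-tabulate⁺ i))
    ≢b : ∀ {s i} → lab (R.w s) ≢ lab (S.b i)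
    ≢b {s} {i} eq = R.w∉ s (∈-++⁺ˡ (∈-concatMap cls (∈-tabulate⁺ i) (cls-complete eq)))
    ≢v : ∀ {s} → lab (R.w s) ≢ lab H.v
    ≢v {s} eq = R.w∉ s (∈-++⁺ʳ bs (∈-++⁺ˡ (cls-complete eq)))
    b≢v : ∀ {i} → lab (S.b i) ≢ lab H.v
    b≢v {i} eq = S.b∉ i (∈-++⁺ˡ (cls-complete eq))
    w-lab : ∀ s t → lab (w s) ≡ lab (w t) → s ≡ t
    w-lab hub       hub       eq = refl
    w-lab hub       (leaf j)  eq = ⊥-elim (b≢v (sym eq))
    w-lab hub       (left j)  eq = ⊥-elim (≢v (sym eq))
    w-lab hub       (right j) eq = ⊥-elim (≢v (sym eq))
    w-lab (leaf i)  hub       eq = ⊥-elim (b≢v eq)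
    w-lab (leaf i)  (leaf j)  eq = cong leaf (S.b-lab eq)
    w-lab (leaf i)  (left j)  eq = ⊥-elim (≢b (sym eq))
    w-lab (leaf i)  (right j) eq = ⊥-elim (≢b (sym eq))
    w-lab (left i)  hub       eq = ⊥-elim (≢v eq)
    w-lab (left i)  (leaf j)  eq = ⊥-elim (≢b eq)
    w-lab (left i)  (left j)  eq with refl ← R.w-lab eq = refl
    w-lab (left i)  (right j) eq with () ← R.w-lab eq
    w-lab (right i) hub       eq = ⊥-elim (≢v eq)
    w-lab (right i) (leaf j)  eq = ⊥-elim (≢b eq)
    w-lab (right i) (left j)  eq with () ← R.w-lab eq
    w-lab (right i) (right j) eq with refl ← R.w-lab eq = refl

-- Abstract, because unfolding its powers of 2 at numeral arguments is prohibitively expensive.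
abstract
  bound : ℕ → ℕ → ℕ → ℕ
  bound g P x = Bounds.sb g P (suc P) x

  bound-mono : ∀ g P {x y} → x ≤ y → bound g P x ≤ bound g P y
  bound-mono g P = Bounds.sb-mono g P (suc P)

  sb≤bound : ∀ g P x → Bounds.sb g P (suc P) x ≤ bound g P x
  sb≤bound g P x = ℕₚ.≤-refl

-- Reduction to a good initial hypergraph

module _ (F : Graph) (k : ℕ) {n : ℕ} where
  open Graphs F
  open Berge F {n}
  open Completion k

  module _ {A : Set} (lab : Fin n → A) (cls : Fin n → List (Fin n)) (g : ℕ)
           (cls-length : ∀ v → length (cls v) ≤ g)
           (cls-complete : ∀ {u v} → lab u ≡ lab v → u ∈ₗ cls v) where
    open Counting lab cls g cls-length cls-complete

    -- `dense` concerns every hypergraph above `H₀`, as the completion cannot be controlled. A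
    -- completion that contained a system would contain a Berge-F, so the counting bound applies to
    -- it.
    sparse-saturation : ∀ {X x H₀} → n > 0 → length X ≤ x → Unique H₀ → All (λ e → ∣ e ∣ ≡ k) H₀ → ¬ ContainsBerge F H₀ →
      (∀ {Es} → Unique Es → (∀ {e} → e ∈ₗ H₀ → e ∈ₗ Es) → System P (suc P) X Es → ContainsBerge F Es) →
      SatAtMost k F n (bound g P x * n)
    sparse-saturation {X} {x} {H₀} n>0 X≤ u unif free dense with saturate H₀ u unif free
    ... | H , sat , H₀⊆H with system P (suc P) {X = X} n>0 X≤ (hnodup H)
    ...   | inj₁ S     = ⊥-elim (proj₁ (proj₂ sat) (dense (hnodup H) H₀⊆H S))
    ...   | inj₂ small = H , sat , ℕₚ.≤-trans small (ℕₚ.≤-trans (ℕₚ.≤-reflexive (ℕₚ.*-comm n _)) (ℕₚ.*-monoˡ-≤ n (sb≤bound g P x)))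

-- Symbolic hypergraphs with a star and a matching

-- A slot stands for a group of vertices; `tp` is the position in which a touched slot meets its star or matching edge.
data Slot (P : ℕ) : Set where
  plain   : Fin P → Slot P
  touched : Site P P → Slot P

-- Only incidences that are certain are listed: of a star or matching edge, just its two sites. The
-- hyperedges `κ i j` exist so that edges of F within the old core take no hyperedge from a group.
module Model (P q s : ℕ) (GV GE : Set) (gi : GE → Fin s ⊎ GV → Set) (tp : Site P P → Fin q) where

  data MV : Set where
    core : Fin s → MV
    pt   : Slot P → Fin q → MV
    gv   : GV → MV

  data ME : Set where
    h  : Fin s → Slot P → ME
    eh : Fin P ⊎ Fin P → ME
    κ  : Fin s → Fin s → ME
    ge : GE → ME

  data Inc : MV → ME → Set where
    ch     : ∀ {i σ} → Inc (core i) (h i σ)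
    ph     : ∀ {i σ x} → Inc (pt σ x) (h i σ)
    κˡ     : ∀ {i j} → Inc (core i) (κ i j)
    κʳ     : ∀ {i j} → Inc (core j) (κ i j)
    hubᵢ   : ∀ {i} → Inc (pt (touched hub) (tp hub)) (eh (inj₁ i))
    leafᵢ  : ∀ {i} → Inc (pt (touched (leaf i)) (tp (leaf i))) (eh (inj₁ i))
    leftᵢ  : ∀ {i} → Inc (pt (touched (left i)) (tp (left i))) (eh (inj₂ i))
    rightᵢ : ∀ {i} → Inc (pt (touched (right i)) (tp (right i))) (eh (inj₂ i))
    gcᵢ    : ∀ {t i} → gi t (inj₁ i) → Inc (core i) (ge t)
    ggᵢ    : ∀ {t g} → gi t (inj₂ g) → Inc (gv g) (ge t)

transpose-inj : ∀ {q} (a b : Fin q) {x y} → transpose a b x ≡ transpose a b y → x ≡ y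
transpose-inj a b = retract-inj (transpose b a) λ _ → transpose-inverse b a

transpose-left : ∀ {q} (a b : Fin q) → transpose a b a ≡ b
transpose-left a b with a Finₚ.≟ a
... | yes _  = refl
... | no a≢a = ⊥-elim (a≢a refl)

no-five : ∀ {q} {f : Fin 5 → Fin q} → q ≤ 4 → ¬ (∀ {i j} → f i ≡ f j → i ≡ j)
no-five {q} {f} q≤4 inj with i , j , i<j , eq ← Finₚ.pigeonhole (s≤s q≤4) f = Finₚ.<⇒≢ i<j (inj eq)

-- Replacing the last core vertex by the hub

-- A drawing of F in which the core has the s old vertices `just i` and one new vertex `nothing`; an edge of type
-- `grp l c` uses the hyperedge of colour c on group l, and GV, GE is a finite extra piece.
module Drawing (F : Graph) (q s : ℕ) (GV GE : Set) (gi : GE → Fin s ⊎ GV → Set) where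
  open Graphs F

  data Role : Set where
    cr : Maybe (Fin s) → Role
    gp : Fin P → Fin q → Role
    gd : GV → Role

  data EdgeType : Set where
    cc  : EdgeType
    grp : Fin P → Maybe (Fin s) → EdgeType
    gt  : GE → EdgeType

  data Ok : Role → EdgeType → Set where
    cc : ∀ {c} → Ok (cr c) cc
    gc : ∀ {l c} → Ok (cr c) (grp l c)
    gg : ∀ {l c x} → Ok (gp l x) (grp l c)
    tc : ∀ {t i} → gi t (inj₁ i) → Ok (cr (just i)) (gt t)
    tg : ∀ {t g} → gi t (inj₂ g) → Ok (gd g) (gt t)

  -- The type `cc` may be shared: an edge inside the core gets a hyperedge that determines its two
  -- ends, so distinct such edges cannot collide. Groups are named by vertices of F, which bounds
  -- their number independently of the host.
  record Drawn : Set where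
    field
      role     : Fin P → Role
      et       : Fin m → EdgeType
      role-inj : ∀ {u v} → role u ≡ role v → u ≡ v
      et-inj   : ∀ {i j} → et i ≡ et j → et i ≢ cc → i ≡ j
      okˡ      : ∀ i → Ok (role (src i)) (et i)
      okʳ      : ∀ i → Ok (role (tgt i)) (et i)

  module Embed (D : Drawn) where
    open Drawn D

    InGroup : Fin P → Fin P → Set
    InGroup l u = ∃ λ x → role u ≡ gp l x

    inGroup? : ∀ l u → Dec (InGroup l u)
    inGroup? l u with role u
    ... | cr _    = no λ ()
    ... | gd _    = no λ ()
    ... | gp l′ x = map′ (λ { refl → x , refl }) (λ { (_ , refl) → refl }) (l′ Finₚ.≟ l)

    last? : ∀ l t → Dec (t ≡ grp l nothing)
    last? l cc               = no λ ()
    last? l (gt _)           = no λ ()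
    last? l (grp _ (just _)) = no λ ()
    last? l (grp l′ nothing) = map′ (λ { refl → refl }) (λ { refl → refl }) (l′ Finₚ.≟ l)

    old? : ∀ l t → Dec (∃ λ c → t ≡ grp l (just c))
    old? l cc               = no λ ()
    old? l (gt _)           = no λ ()
    old? l (grp _ nothing)  = no λ ()
    old? l (grp l′ (just c)) = map′ (λ { refl → c , refl }) (λ { (_ , refl) → refl }) (l′ Finₚ.≟ l)

    Adj : Fin P → Fin P → Fin P → Set
    Adj l u v = ∃ λ j → (∃ λ c → et j ≡ grp l (just c)) × Ends j u v × InGroup l u × InGroup l v

    adj? : ∀ l u v → Dec (Adj l u v)
    adj? l u v = any? λ j → old? l (et j) ×-dec Ends? j u v ×-dec inGroup? l u ×-dec inGroup? l v

    Adj-≢ : ∀ {l u v} → Adj l u v → u ≢ v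
    Adj-≢ (_ , _ , e , _) = Ends-≢ e

    Path₂ Path₃ : Fin P → Fin P → Fin P → Set
    Path₂ l x y = ∃ λ z → Adj l x z × Adj l z y
    Path₃ l x y = ∃ λ z → ∃ λ w → Adj l x z × Adj l z w × Adj l w y

    record Obstruction (l : Fin P) : Set where
      field
        i    : Fin m
        last : et i ≡ grp l nothing
        x∈   : InGroup l (src i)
        y∈   : InGroup l (tgt i)
        path : Path₂ l (src i) (tgt i) ⊎ Path₃ l (src i) (tgt i)

    -- The ways to make up for the edge of last colour on a group: there is none, it ends in the new
    -- core vertex and becomes a star edge, or it is a bridge and `χ` cuts the group there, to be
    -- rejoined by a matching edge.
    data Kind (l : Fin P) : Set where
      none  : (∀ i → et i ≢ grp l nothing) → Kind l
      leafK : ∀ i x u v → et i ≡ grp l nothing → Ends i u v → role u ≡ cr nothing → role v ≡ gp l x → Kind l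
      split : ∀ i x y → et i ≡ grp l nothing → role (src i) ≡ gp l x → role (tgt i) ≡ gp l y →
              (χ : Fin P → Bool) → χ (src i) ≡ true → χ (tgt i) ≡ false →
              (∀ {u v} → Adj l u v → χ u ≡ χ v) → Kind l

    -- If no path of length 2 or 3 avoids the last edge, then the vertices within distance 2 of its source form
    -- a side of a cut crossed by no other edge, since a group has at most four vertices.
    module Cut (q≤4 : q ≤ 4) (l : Fin P) (i : Fin m) (last : et i ≡ grp l nothing)
               (x∈ : InGroup l (src i)) (y∈ : InGroup l (tgt i))
               (¬₂ : ¬ Path₂ l (src i) (tgt i)) (¬₃ : ¬ Path₃ l (src i) (tgt i)) where

      Near : Fin P → Set
      Near u = u ≡ src i ⊎ Adj l (src i) u ⊎ Path₂ l (src i) u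

      near? : ∀ u → Dec (Near u)
      near? u = (u Finₚ.≟ src i) ⊎-dec adj? l (src i) u ⊎-dec any? (λ z → adj? l (src i) z ×-dec adj? l z u)

      χ : Fin P → Bool
      χ u = Dec.does (near? u)

      far : ¬ Near (tgt i)
      far (inj₁ eq)                              = src≢tgt i (sym eq)
      far (inj₂ (inj₁ (j , (c , et≡) , ends , _))) with refl ← edge-unique {i} {j} (inj₁ (refl , refl)) ends
        with () ← trans (sym last) et≡
      far (inj₂ (inj₂ path))                     = ¬₂ path

      -- Only a vertex `u` reached by two edges could have a neighbour `v` that is not near; then
      -- `src i`, `z`, `u`, `v` and `tgt i` would be five vertices of a group with at most four.
      near-closed : ∀ {u v} → Near u → Adj l u v → Near v
      near-closed (inj₁ refl)             a = inj₂ (inj₁ a)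
      near-closed (inj₂ (inj₁ a₁))        a = inj₂ (inj₂ (_ , a₁ , a))
      near-closed {u} {v} (inj₂ (inj₂ (z , a₁ , a₂))) a with near? v
      ... | yes nv = nv
      ... | no ¬nv = ⊥-elim (no-five {f = pos} q≤4 pos-inj)
        where
        v≢y : v ≢ tgt i
        v≢y refl = ¬₃ (z , u , a₁ , a₂ , a)
        nz : Near z
        nz = inj₂ (inj₁ a₁)
        nu : Near u
        nu = inj₂ (inj₂ (z , a₁ , a₂))
        apart : ∀ {a b} → Near a → ¬ Near b → a ≢ b
        apart na ¬nb refl = ¬nb na
        x≢u : src i ≢ u
        x≢u refl = ¬nv (inj₂ (inj₁ a))
        five : List (Fin P)
        five = src i ∷ z ∷ u ∷ v ∷ tgt i ∷ []
        uniq : Unique five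
        uniq = (Adj-≢ a₁ ∷ x≢u ∷ apart (inj₁ refl) ¬nv ∷ apart (inj₁ refl) far ∷ [])
             ∷ (Adj-≢ a₂ ∷ apart nz ¬nv ∷ apart nz far ∷ [])
             ∷ (apart nu ¬nv ∷ apart nu far ∷ [])
             ∷ (v≢y ∷ []) ∷ [] ∷ []
        all∈ : All (InGroup l) five
        all∈ = x∈ ∷ proj₂ (proj₂ (proj₂ (proj₂ a₁))) ∷ proj₁ (proj₂ (proj₂ (proj₂ a)))
             ∷ proj₂ (proj₂ (proj₂ (proj₂ a))) ∷ y∈ ∷ []
        at : ∀ j → InGroup l (lookup five j)
        at j = All.lookup all∈ (∈-lookup {xs = five} j)
        pos : Fin 5 → Fin q
        pos j = proj₁ (at j)
        pos-inj : ∀ {j j′} → pos j ≡ pos j′ → j ≡ j′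
        pos-inj {j} {j′} eq = lookup-injective uniq {j} {j′}
          (role-inj (trans (proj₂ (at j)) (trans (cong (gp l) eq) (sym (proj₂ (at j′))))))

      χ-near : ∀ {u} → Near u → χ u ≡ true
      χ-near {u} = dec-true (near? u)

      χ-far : ∀ {u} → ¬ Near u → χ u ≡ false
      χ-far {u} = dec-false (near? u)

      Adj-sym : ∀ {u v} → Adj l u v → Adj l v u
      Adj-sym (j , c , e , u∈ , v∈) = j , c , Ends-swap e , v∈ , u∈

      χ-adj : ∀ {u v} → Adj l u v → χ u ≡ χ v
      χ-adj {u} {v} a = case near? u of λ
        { (yes nu) → trans (χ-near nu) (sym (χ-near (near-closed nu a)))
        ; (no ¬nu) → trans (χ-far ¬nu) (sym (χ-far λ nv → ¬nu (near-closed nv (Adj-sym a)))) }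

    kind : q ≤ 4 → ∀ l → Kind l ⊎ Obstruction l
    kind q≤4 l with any? (λ i → last? l (et i))
    ... | no ¬last = inj₁ (none λ i eq → ¬last (i , eq))
    ... | yes (i , last) = go (role (src i)) (role (tgt i)) refl refl
                              (subst (Ok _) last (okˡ i)) (subst (Ok _) last (okʳ i))
      where
      go : ∀ r r′ → role (src i) ≡ r → role (tgt i) ≡ r′ → Ok r (grp l nothing) → Ok r′ (grp l nothing) →
           Kind l ⊎ Obstruction l
      go _ _ rˡ rʳ gc gc = ⊥-elim (src≢tgt i (role-inj (trans rˡ (sym rʳ))))
      go _ _ rˡ rʳ gc gg = inj₁ (leafK i _ _ _ last (inj₁ (refl , refl)) rˡ rʳ)
      go _ _ rˡ rʳ gg gc = inj₁ (leafK i _ _ _ last (inj₂ (refl , refl)) rʳ rˡ)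
      go _ _ rˡ rʳ gg gg
        with any? (λ z → adj? l (src i) z ×-dec adj? l z (tgt i))
           | any? (λ z → any? λ w → adj? l (src i) z ×-dec adj? l z w ×-dec adj? l w (tgt i))
      ... | yes path | _        = inj₂ record { i = i ; last = last ; x∈ = _ , rˡ ; y∈ = _ , rʳ ; path = inj₁ path }
      ... | no _     | yes path = inj₂ record { i = i ; last = last ; x∈ = _ , rˡ ; y∈ = _ , rʳ ; path = inj₂ path }
      ... | no ¬₂    | no ¬₃    = inj₁ (split i _ _ last rˡ rʳ χ (χ-near (inj₁ refl)) (χ-far far) χ-adj)
        where open Cut q≤4 l i last (_ , rˡ) (_ , rʳ) ¬₂ ¬₃

    module _ (tp : Site P P → Fin q) (kinds : ∀ l → Kind l) where
      open Model P q s GV GE gi tp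

      sideSlot : Fin P → Bool → Slot P
      sideSlot l true  = touched (left l)
      sideSlot l false = touched (right l)

      -- The vertex that needs the matching edge must sit at the touched position of its slot;
      -- swapping two positions moves it there and keeps the half injective.
      sidePos : Fin P → Fin q → Fin q → Bool → Fin q → Fin q
      sidePos l x y true  = transpose x (tp (left l))
      sidePos l x y false = transpose y (tp (right l))

      slotOf : ∀ {l} → Kind l → Fin P → Slot P
      slotOf {l} (none _)                 u = plain l
      slotOf {l} (leafK _ _ _ _ _ _ _ _)  u = touched (leaf l)
      slotOf {l} (split _ _ _ _ _ _ χ _ _ _)  u = sideSlot l (χ u)

      posOf : ∀ {l} → Kind l → Fin P → Fin q → Fin q
      posOf {l} (none _)                    u = id
      posOf {l} (leafK _ x _ _ _ _ _ _)     u = transpose x (tp (leaf l))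
      posOf {l} (split _ x y _ _ _ χ _ _ _) u = sidePos l x y (χ u)

      slotLabel : Slot P → Maybe (Fin P)
      slotLabel (plain l)           = just l
      slotLabel (touched hub)       = nothing
      slotLabel (touched (leaf l))  = just l
      slotLabel (touched (left l))  = just l
      slotLabel (touched (right l)) = just l

      label-slotOf : ∀ {l} (κ : Kind l) u → slotLabel (slotOf κ u) ≡ just l
      label-slotOf (none _) u                     = refl
      label-slotOf (leafK _ _ _ _ _ _ _ _) u      = refl
      label-slotOf (split _ _ _ _ _ _ χ _ _ _) u with χ u
      ... | true  = refl
      ... | false = refl

      posOf-inj : ∀ {l} (κ : Kind l) u v {x y} → slotOf κ u ≡ slotOf κ v → posOf κ u x ≡ posOf κ v y → x ≡ y
      posOf-inj (none _) u v _ eq                    = eq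
      posOf-inj (leafK _ x _ _ _ _ _ _) u v _ eq     = transpose-inj _ _ eq
      posOf-inj (split _ _ _ _ _ _ χ _ _ _) u v s≡ eq with χ u | χ v
      ... | true  | true  = transpose-inj _ _ eq
      ... | false | false = transpose-inj _ _ eq
      ... | true  | false = case s≡ of λ ()
      ... | false | true  = case s≡ of λ ()

      ψr : Fin P → Role → MV
      ψr u (cr (just i)) = core i
      ψr u (cr nothing)  = pt (touched hub) (tp hub)
      ψr u (gp l x)      = pt (slotOf (kinds l) u) (posOf (kinds l) u x)
      ψr u (gd g)        = gv g

      pt-injˡ : ∀ {σ τ x y} → pt σ x ≡ pt τ y → σ ≡ τ
      pt-injˡ refl = refl

      pt-injʳ : ∀ {σ τ x y} → pt σ x ≡ pt τ y → x ≡ y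
      pt-injʳ refl = refl

      ψr-inj : ∀ u v r r′ → ψr u r ≡ ψr v r′ → r ≡ r′
      ψr-inj u v (cr (just _)) (cr (just _)) refl = refl
      ψr-inj u v (cr nothing)  (cr nothing)  _    = refl
      ψr-inj u v (gd _)        (gd _)        refl = refl
      ψr-inj u v (cr nothing)  (gp l x)      eq   =
        case trans (cong slotLabel (pt-injˡ eq)) (label-slotOf (kinds l) v) of λ ()
      ψr-inj u v (gp l x)      (cr nothing)  eq   =
        case trans (sym (label-slotOf (kinds l) u)) (cong slotLabel (pt-injˡ eq)) of λ ()
      ψr-inj u v (gp l x)      (gp l′ y)     eq
        with refl ← just-injective (trans (sym (label-slotOf (kinds l) u)) (trans (cong slotLabel (pt-injˡ eq)) (label-slotOf (kinds l′) v)))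
        = cong (gp l) (posOf-inj (kinds l) u v (pt-injˡ eq) (pt-injʳ eq))
      ψr-inj u v (cr (just _)) (cr nothing)  ()
      ψr-inj u v (cr (just _)) (gp _ _)      ()
      ψr-inj u v (cr (just _)) (gd _)        ()
      ψr-inj u v (cr nothing)  (cr (just _)) ()
      ψr-inj u v (cr nothing)  (gd _)        ()
      ψr-inj u v (gp _ _)      (cr (just _)) ()
      ψr-inj u v (gp _ _)      (gd _)        ()
      ψr-inj u v (gd _)        (cr (just _)) ()
      ψr-inj u v (gd _)        (cr nothing)  ()
      ψr-inj u v (gd _)        (gp _ _)      ()

      -- Recovers the type of an edge from its hyperedge. Both halves of a split group answer with
      -- the same name, so injectivity of `et` carries over; the hyperedges on the slot of the hub
      -- serve only edges between the hub and the old core, hence `cc`.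
      back : ME → EdgeType
      back (h c (plain l))           = grp l (just c)
      back (h c (touched hub))       = cc
      back (h c (touched (leaf l)))  = grp l (just c)
      back (h c (touched (left l)))  = grp l (just c)
      back (h c (touched (right l))) = grp l (just c)
      back (eh (inj₁ l))             = grp l nothing
      back (eh (inj₂ l))             = grp l nothing
      back (κ _ _)                   = cc
      back (ge t)                    = gt t

      back-slotOf : ∀ {l} (κ : Kind l) u c → back (h c (slotOf κ u)) ≡ grp l (just c)
      back-slotOf (none _) u c                     = refl
      back-slotOf (leafK _ _ _ _ _ _ _ _) u c      = refl
      back-slotOf (split _ _ _ _ _ _ χ _ _ _) u c with χ u
      ... | true  = refl
      ... | false = refl

      -- Edges of type `cc` cannot be told apart by type; their hyperedge determines the pair of
      -- ends instead.
      data CorePair : ME → MV → MV → Set where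
        κκ : ∀ {a b} → CorePair (κ a b) (core a) (core b)
        hh : ∀ {a} → CorePair (h a (touched hub)) (core a) (pt (touched hub) (tp hub))

      corePair-unique : ∀ {e e′ v w v′ w′} → e ≡ e′ → CorePair e v w → CorePair e′ v′ w′ → v ≡ v′ × w ≡ w′
      corePair-unique refl κκ κκ = refl , refl
      corePair-unique refl hh hh = refl , refl

      record EdgeAt (u v : Fin P) (r r′ : Role) (t : EdgeType) : Set where
        field
          e    : ME
          incˡ : Inc (ψr u r) e
          incʳ : Inc (ψr v r′) e
          bk   : back e ≡ t
          pair : t ≡ cc → CorePair e (ψr u r) (ψr v r′) ⊎ CorePair e (ψr v r′) (ψr u r)

      flip-edge : ∀ {u v r r′ t} → EdgeAt u v r r′ t → EdgeAt v u r′ r t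
      flip-edge E = record { e = e ; incˡ = incʳ ; incʳ = incˡ ; bk = bk ; pair = λ eq → [ inj₂ , inj₁ ]′ (pair eq) }
        where open EdgeAt E

      slotOf-adj : ∀ {l} (κ : Kind l) {u v} → Adj l u v → slotOf κ u ≡ slotOf κ v
      slotOf-adj (none _) a                = refl
      slotOf-adj (leafK _ _ _ _ _ _ _ _) a = refl
      slotOf-adj (split _ _ _ _ _ _ χ _ _ χ-adj) {u} {v} a with χ u | χ v | χ-adj a
      ... | true  | .true  | refl = refl
      ... | false | .false | refl = refl

      -- By `et-inj` the edge is the one recorded in `κ`, and the transposition in `posOf` puts its
      -- end at the touched position.
      last-to-core : ∀ {l} (κ : Kind l) {i u v x} → et i ≡ grp l nothing → Ends i u v → role u ≡ cr nothing → role v ≡ gp l x →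
                     Inc (pt (slotOf κ v) (posOf κ v x)) (eh (inj₁ l))
      last-to-core (none no-last) last ends ru rv = ⊥-elim (no-last _ last)
      last-to-core {l} (leafK j x′ u′ v′ last′ ends′ ru′ rv′) {i} {u} {v} {x} last ends ru rv
        with refl ← et-inj {i} {j} (trans last (sym last′)) (λ eq → case trans (sym last) eq of λ ())
        with refl ← role-inj {u} {u′} (trans ru (sym ru′))
        = subst (λ y → Inc (pt (touched (leaf l)) y) (eh (inj₁ l)))
            (sym (trans (cong (transpose x′ (tp (leaf l))) (gp-injʳ (trans (sym rv) (trans (cong role (Ends-cancel {i} ends ends′)) rv′)))) (transpose-left x′ (tp (leaf l)))))
            leafᵢ
        where
        gp-injʳ : ∀ {l l′ x y} → gp l x ≡ gp l′ y → x ≡ y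
        gp-injʳ refl = refl
      last-to-core (split j x′ y′ last′ rs rt _ _ _ _) {i} {u} last ends ru rv
        with refl ← et-inj {i} {j} (trans last (sym last′)) (λ eq → case trans (sym last) eq of λ ()) | ends
      ... | inj₁ (refl , _) = case trans (sym ru) rs of λ ()
      ... | inj₂ (_ , refl) = case trans (sym ru) rt of λ ()

      last-inside : ∀ {l} (κ : Kind l) {i x y} → et i ≡ grp l nothing → role (src i) ≡ gp l x → role (tgt i) ≡ gp l y →
                    Inc (pt (slotOf κ (src i)) (posOf κ (src i) x)) (eh (inj₂ l)) ×
                    Inc (pt (slotOf κ (tgt i)) (posOf κ (tgt i) y)) (eh (inj₂ l))
      last-inside (none no-last) last rs rt = ⊥-elim (no-last _ last)
      last-inside (leafK j _ _ _ last′ ends′ ru′ _) {i} last rs rt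
        with refl ← et-inj {i} {j} (trans last (sym last′)) (λ eq → case trans (sym last) eq of λ ()) | ends′
      ... | inj₁ (refl , _) = case trans (sym ru′) rs of λ ()
      ... | inj₂ (_ , refl) = case trans (sym ru′) rt of λ ()
      last-inside {l} (split j x′ y′ last′ rs′ rt′ χ χs χt _) {i} last rs rt
        with refl ← et-inj {i} {j} (trans last (sym last′)) (λ eq → case trans (sym last) eq of λ ())
        with refl ← trans (sym rs) rs′ | refl ← trans (sym rt) rt′
        = onLeft χs , onRight χt
        where
        onLeft : ∀ {b} → b ≡ true → Inc (pt (sideSlot l b) (sidePos l x′ y′ b x′)) (eh (inj₂ l))
        onLeft refl rewrite transpose-left x′ (tp (left l)) = leftᵢ
        onRight : ∀ {b} → b ≡ false → Inc (pt (sideSlot l b) (sidePos l x′ y′ b y′)) (eh (inj₂ l))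
        onRight refl rewrite transpose-left y′ (tp (right l)) = rightᵢ

      coreGroup : ∀ {i u v l c y} → et i ≡ grp l c → Ends i u v → role u ≡ cr c → role v ≡ gp l y →
                  EdgeAt u v (cr c) (gp l y) (grp l c)
      coreGroup {v = v} {l} {just c} et≡ ends ru rv = record
        { e = h c (slotOf (kinds l) v) ; incˡ = ch ; incʳ = ph ; bk = back-slotOf (kinds l) v c ; pair = λ () }
      coreGroup {l = l} {nothing} et≡ ends ru rv = record
        { e = eh (inj₁ l) ; incˡ = hubᵢ ; incʳ = last-to-core (kinds l) et≡ ends ru rv ; bk = refl ; pair = λ () }

      edgeAt : ∀ {i u v r r′ t} → et i ≡ t → Ends i u v → role u ≡ r → role v ≡ r′ → Ok r t → Ok r′ t → EdgeAt u v r r′ t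
      edgeAt et≡ ends ru rv (tc p) (tc q) = record { e = ge _ ; incˡ = gcᵢ p ; incʳ = gcᵢ q ; bk = refl ; pair = λ () }
      edgeAt et≡ ends ru rv (tc p) (tg q) = record { e = ge _ ; incˡ = gcᵢ p ; incʳ = ggᵢ q ; bk = refl ; pair = λ () }
      edgeAt et≡ ends ru rv (tg p) (tc q) = record { e = ge _ ; incˡ = ggᵢ p ; incʳ = gcᵢ q ; bk = refl ; pair = λ () }
      edgeAt et≡ ends ru rv (tg p) (tg q) = record { e = ge _ ; incˡ = ggᵢ p ; incʳ = ggᵢ q ; bk = refl ; pair = λ () }
      edgeAt et≡ ends ru rv (cc {just a})  (cc {just b})  =
        record { e = κ a b ; incˡ = κˡ ; incʳ = κʳ ; bk = refl ; pair = λ _ → inj₁ κκ }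
      edgeAt et≡ ends ru rv (cc {just a})  (cc {nothing}) =
        record { e = h a (touched hub) ; incˡ = ch ; incʳ = ph ; bk = refl ; pair = λ _ → inj₁ hh }
      edgeAt et≡ ends ru rv (cc {nothing}) (cc {just a})  =
        record { e = h a (touched hub) ; incˡ = ph ; incʳ = ch ; bk = refl ; pair = λ _ → inj₂ hh }
      edgeAt et≡ ends ru rv (cc {nothing}) (cc {nothing}) = ⊥-elim (Ends-≢ ends (role-inj (trans ru (sym rv))))
      edgeAt et≡ ends ru rv gc gc = ⊥-elim (Ends-≢ ends (role-inj (trans ru (sym rv))))
      edgeAt et≡ ends ru rv gc gg = coreGroup et≡ ends ru rv
      edgeAt et≡ ends ru rv gg gc = flip-edge (coreGroup et≡ (Ends-swap ends) rv ru)
      edgeAt {i} {u} {v} et≡ ends ru rv (gg {l} {just c}) (gg {x = y}) = record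
        { e = h c (slotOf (kinds l) u) ; incˡ = ph
        -- An edge of old colour never crosses the cut, so both ends lie in the same slot.
        ; incʳ = subst (λ σ → Inc (pt σ (posOf (kinds l) v y)) (h c (slotOf (kinds l) u)))
                   (slotOf-adj (kinds l) (i , (c , et≡) , ends , (_ , ru) , (_ , rv))) ph
        ; bk = back-slotOf (kinds l) u c ; pair = λ () }
      edgeAt {i} et≡ (inj₁ (refl , refl)) ru rv (gg {l} {nothing}) gg = record
        { e = eh (inj₂ l) ; incˡ = proj₁ (last-inside (kinds l) {i} et≡ ru rv) ; incʳ = proj₂ (last-inside (kinds l) {i} et≡ ru rv)
        ; bk = refl ; pair = λ () }
      edgeAt {i} et≡ (inj₂ (refl , refl)) ru rv (gg {l} {nothing}) gg = record
        { e = eh (inj₂ l) ; incˡ = proj₂ (last-inside (kinds l) {i} et≡ rv ru) ; incʳ = proj₁ (last-inside (kinds l) {i} et≡ rv ru)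
        ; bk = refl ; pair = λ () }

      ψ : Fin P → MV
      ψ u = ψr u (role u)

      ψ-inj : ∀ {u v} → ψ u ≡ ψ v → u ≡ v
      ψ-inj {u} {v} eq = role-inj (ψr-inj u v (role u) (role v) eq)

      edge : ∀ i → EdgeAt (src i) (tgt i) (role (src i)) (role (tgt i)) (et i)
      edge i = edgeAt refl (inj₁ (refl , refl)) refl refl (okˡ i) (okʳ i)

      φ : Fin m → ME
      φ i = EdgeAt.e (edge i)

      cc? : (t : EdgeType) → Dec (t ≡ cc)
      cc? cc        = yes refl
      cc? (grp _ _) = no λ ()
      cc? (gt _)    = no λ ()

      φ-inj : ∀ {i j} → φ i ≡ φ j → i ≡ j
      φ-inj {i} {j} eq = by (cc? (et i))
        where
        et≡ : et i ≡ et j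
        et≡ = trans (sym (EdgeAt.bk (edge i))) (trans (cong back eq) (EdgeAt.bk (edge j)))
        by : Dec (et i ≡ cc) → i ≡ j
        by (no ¬cc) = et-inj et≡ ¬cc
        by (yes cc≡) with EdgeAt.pair (edge i) cc≡ | EdgeAt.pair (edge j) (trans (sym et≡) cc≡)
        ... | inj₁ a | inj₁ b with x , y ← corePair-unique eq a b =
          edge-unique {i} {j} (inj₁ (refl , refl)) (inj₁ (sym (ψ-inj x) , sym (ψ-inj y)))
        ... | inj₁ a | inj₂ b with x , y ← corePair-unique eq a b =
          edge-unique {i} {j} (inj₁ (refl , refl)) (inj₂ (sym (ψ-inj y) , sym (ψ-inj x)))
        ... | inj₂ a | inj₁ b with x , y ← corePair-unique eq a b =
          edge-unique {i} {j} (inj₁ (refl , refl)) (inj₂ (sym (ψ-inj x) , sym (ψ-inj y)))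
        ... | inj₂ a | inj₂ b with x , y ← corePair-unique eq a b =
          edge-unique {i} {j} (inj₁ (refl , refl)) (inj₁ (sym (ψ-inj y) , sym (ψ-inj x)))

      embedding : EmbedsIn F Inc
      embedding = record { ψ = ψ ; φ = φ ; ψ-inj = ψ-inj ; φ-inj = φ-inj
                         ; incˡ = λ i → EdgeAt.incˡ (edge i) ; incʳ = λ i → EdgeAt.incʳ (edge i) }

    kinds-or-obstruction : q ≤ 4 → (∀ l → Kind l) ⊎ ∃ Obstruction
    kinds-or-obstruction q≤4 = choose⊎ (kind q≤4)

-- Subsets given by lists of their elements

∣insert∣ : ∀ {n} (S : Subset n) v → v ∉ S → ∣ S Vec.[ v ]≔ inside ∣ ≡ suc ∣ S ∣
∣insert∣ (inside ∷ S)  zero    v∉ = ⊥-elim (v∉ here)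
∣insert∣ (outside ∷ S) zero    v∉ = refl
∣insert∣ (inside ∷ S)  (suc v) v∉ = cong suc (∣insert∣ S v (v∉ ∘ there))
∣insert∣ (outside ∷ S) (suc v) v∉ = ∣insert∣ S v (v∉ ∘ there)

⟪_⟫ : ∀ {n} → List (Fin n) → Subset n
⟪ [] ⟫     = Vec.replicate _ outside
⟪ v ∷ vs ⟫ = ⟪ vs ⟫ Vec.[ v ]≔ inside

∈-⟪⟫⁺ : ∀ {n} {v : Fin n} {vs} → v ∈ₗ vs → v ∈ ⟪ vs ⟫
∈-⟪⟫⁺ {vs = u ∷ vs} (here refl) = Vecₚ.[]≔-updates ⟪ vs ⟫ u
∈-⟪⟫⁺ {v = v} {u ∷ vs} (there v∈) with v Finₚ.≟ u
... | yes refl = Vecₚ.[]≔-updates ⟪ vs ⟫ u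
... | no v≢u   = Vecₚ.[]≔-minimal ⟪ vs ⟫ v u v≢u (∈-⟪⟫⁺ v∈)

∈-⟪⟫⁻ : ∀ {n} {v : Fin n} vs → v ∈ ⟪ vs ⟫ → v ∈ₗ vs
∈-⟪⟫⁻ {v = v} [] v∈ with () ← trans (sym (Vecₚ.[]=⇒lookup v∈)) (Vecₚ.lookup-replicate v outside)
∈-⟪⟫⁻ {v = v} (u ∷ vs) v∈ with v Finₚ.≟ u
... | yes refl = here refl
... | no v≢u   = there (∈-⟪⟫⁻ vs (Vecₚ.lookup⇒[]= v ⟪ vs ⟫
                   (trans (sym (Vecₚ.lookup∘update′ v≢u ⟪ vs ⟫ inside)) (Vecₚ.[]=⇒lookup v∈))))

∣⟪⟫∣ : ∀ {n} {vs : List (Fin n)} → Unique vs → ∣ ⟪ vs ⟫ ∣ ≡ length vs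
∣⟪⟫∣ {n} {[]}     _        = ∣⊥∣≡0 n
∣⟪⟫∣ {n} {v ∷ vs} (v∉ ∷ u) =
  trans (∣insert∣ ⟪ vs ⟫ v λ v∈ → All.lookup v∉ (∈-⟪⟫⁻ vs v∈) refl) (cong suc (∣⟪⟫∣ u))

-- The initial hypergraphs with a core and groups

-- The hypergraph with hyperedges {aᵢ} ∪ D ∪ P_l, where the s vertices aᵢ and the δ vertices of D form the core and
-- the P_l are disjoint groups of q vertices; for every pair i, j a further private group completes {aᵢ, aⱼ} ∪ D to a hyperedge.
-- Finally ρ groups are reserved and r vertices lie in no hyperedge.
module Concrete (s δ q″ ρ r G : ℕ) where

  q′ q k b₀ n : ℕ
  q′ = suc q″
  q  = suc q′
  k  = suc (δ + q)
  b₀ = ((s + δ) + (s * s + ρ) * q) + r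
  n  = b₀ + G * q

  Special Lab Ord V : Set
  Special = (Fin s × Fin s) ⊎ Fin ρ
  Lab     = Special ⊎ Fin G
  Ord     = Fin ρ ⊎ Fin G
  V       = (((Fin s ⊎ Fin δ) ⊎ (Special × Fin q)) ⊎ Fin r) ⊎ (Fin G × Fin q)

  pattern vcore i  = inj₁ (inj₁ (inj₁ (inj₁ i)))
  pattern vdk d    = inj₁ (inj₁ (inj₁ (inj₂ d)))
  pattern vsp l x  = inj₁ (inj₁ (inj₂ (l , x)))
  pattern vlo t    = inj₁ (inj₂ t)
  pattern vgr g x  = inj₂ (g , x)

  vpt : Lab → Fin q → V
  vpt (inj₁ l) x = vsp l x
  vpt (inj₂ g) x = vgr g x

  ord : Ord → Lab
  ord (inj₁ t) = inj₁ (inj₂ t)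
  ord (inj₂ g) = inj₂ g

  pair : Fin s → Fin s → Lab
  pair i j = inj₁ (inj₁ (i , j))

  infixr 3 _⨾_
  _⨾_ : ∀ {A B C : Set} → A ↔ B → B ↔ C → A ↔ C
  f ⨾ g = g Comp.↔-∘ f

  special : Fin (s * s + ρ) ↔ Special
  special = +↔⊎ ⨾ (*↔× ⊎-↔ Ident.↔-id _)

  inner : Fin b₀ ↔ (((Fin s ⊎ Fin δ) ⊎ (Special × Fin q)) ⊎ Fin r)
  inner = +↔⊎ ⨾ ((+↔⊎ ⨾ (+↔⊎ ⊎-↔ (*↔× ⨾ (special ×-↔ Ident.↔-id _)))) ⊎-↔ Ident.↔-id _)

  bij : Fin n ↔ V
  bij = +↔⊎ ⨾ (inner ⊎-↔ *↔×)

  dec : Fin n → V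
  dec = Inverse.to bij

  enc : V → Fin n
  enc = Inverse.from bij

  dec-enc : ∀ v → dec (enc v) ≡ v
  dec-enc = Inverse.strictlyInverseˡ bij

  enc-dec : ∀ x → enc (dec x) ≡ x
  enc-dec = Inverse.strictlyInverseʳ bij

  enc-inj : ∀ {v w} → enc v ≡ enc w → v ≡ w
  enc-inj = retract-inj dec dec-enc

  dec-inj : ∀ {v w} → dec v ≡ dec w → v ≡ w
  dec-inj = retract-inj enc enc-dec

  X₀ : List (Fin n)
  X₀ = map (_↑ˡ (G * q)) (allFin b₀)

  length-X₀ : length X₀ ≡ b₀
  length-X₀ = trans (Listₚ.length-map _ (allFin b₀)) (Listₚ.length-tabulate id)

  outside-X₀ : ∀ w → w ∉ₗ X₀ → ∃ λ g → ∃ λ x → dec w ≡ vgr g x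
  outside-X₀ w w∉ with Data.Fin.splitAt b₀ w in eq
  ... | inj₁ y = ⊥-elim (w∉ (subst (_∈ₗ X₀) (Finₚ.splitAt⁻¹-↑ˡ eq) (∈-map⁺ _ (∈-allFin y))))
  ... | inj₂ z = _ , _ , refl

  key : V → Fin G ⊎ V
  key (vgr g x) = inj₁ g
  key (inj₁ y)  = inj₂ (inj₁ y)

  mates : V → List V
  mates (vgr g x) = map (vgr g) (allFin q)
  mates (inj₁ y)  = inj₁ y ∷ []

  lab : Fin n → Fin G ⊎ V
  lab = key ∘ dec

  cls : Fin n → List (Fin n)
  cls = map enc ∘ mates ∘ dec

  cls-length : ∀ w → length (cls w) ≤ q
  cls-length w = ℕₚ.≤-trans (ℕₚ.≤-reflexive (Listₚ.length-map enc (mates (dec w)))) (go (dec w))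
    where
    go : ∀ v → length (mates v) ≤ q
    go (vgr g x) = ℕₚ.≤-reflexive (trans (Listₚ.length-map (vgr g) (allFin q)) (Listₚ.length-tabulate {n = q} id))
    go (inj₁ y)  = s≤s z≤n

  cls-complete : ∀ {u w} → lab u ≡ lab w → u ∈ₗ cls w
  cls-complete {u} {w} eq = subst (_∈ₗ cls w) (enc-dec u) (∈-map⁺ enc (go (dec u) (dec w) eq))
    where
    go : ∀ v v′ → key v ≡ key v′ → v ∈ₗ mates v′
    go (vgr g x) (vgr .g y) refl = ∈-map⁺ (vgr g) (∈-allFin x)
    go (inj₁ y)  (inj₁ .y)  refl = here refl

  data Tag : Set where
    hT : Fin s → Ord → Tag
    κT : Fin s → Fin s → Tag

  -- For `i = j` a vertex of the private group fills the second place, so that the hyperedge still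
  -- has `k` elements.
  second : Fin s → Fin s → V
  second i j with i Finₚ.≟ j
  ... | yes _ = vpt (pair i j) zero
  ... | no _  = vcore j

  members : Tag → List V
  members (hT i l) = vcore i ∷ map (λ d → vdk d) (allFin δ) ++ map (vpt (ord l)) (allFin q)
  members (κT i j) = vcore i ∷ second i j ∷ map (λ d → vdk d) (allFin δ) ++ map (λ x → vpt (pair i j) (suc x)) (allFin q′)

  -- Coarser than `members`, as `κp` admits every position of the private group. It is only ever
  -- derived from membership, and it suffices for reading off colour and group.
  data In : V → Tag → Set where
    hc  : ∀ {i l} → In (vcore i) (hT i l)
    hd  : ∀ {d i l} → In (vdk d) (hT i l)
    hp  : ∀ {i l x} → In (vpt (ord l) x) (hT i l)
    κc  : ∀ {i j} → In (vcore i) (κT i j)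
    κc′ : ∀ {i j} → In (vcore j) (κT i j)
    κd  : ∀ {d i j} → In (vdk d) (κT i j)
    κp  : ∀ {i j x} → In (vpt (pair i j) x) (κT i j)

  members⇒In : ∀ t {v} → v ∈ₗ members t → In v t
  members⇒In (hT i l) (here refl) = hc
  members⇒In (hT i l) (there v∈) with ∈-++⁻ (map (λ d → vdk d) (allFin δ)) v∈
  ... | inj₁ v∈′ with _ , _ , refl ← ∈-map⁻ _ v∈′ = hd
  ... | inj₂ v∈′ with _ , _ , refl ← ∈-map⁻ _ v∈′ = hp
  members⇒In (κT i j) (here refl) = κc
  members⇒In (κT i j) (there (here refl)) with i Finₚ.≟ j
  ... | yes _ = κp
  ... | no _  = κc′
  members⇒In (κT i j) (there (there v∈)) with ∈-++⁻ (map (λ d → vdk d) (allFin δ)) v∈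
  ... | inj₁ v∈′ with _ , _ , refl ← ∈-map⁻ _ v∈′ = κd
  ... | inj₂ v∈′ with _ , _ , refl ← ∈-map⁻ _ v∈′ = κp

  ∈-dk : ∀ {d t} → vdk d ∈ₗ members t
  ∈-dk {d} {hT i l} = there (∈-++⁺ˡ (∈-map⁺ _ (∈-allFin d)))
  ∈-dk {d} {κT i j} = there (there (∈-++⁺ˡ (∈-map⁺ _ (∈-allFin d))))

  ∈-pt : ∀ {i l x} → vpt (ord l) x ∈ₗ members (hT i l)
  ∈-pt {x = x} = there (∈-++⁺ʳ (map (λ d → vdk d) (allFin δ)) (∈-map⁺ _ (∈-allFin x)))

  ∈-pair : ∀ {i j x} → vpt (pair i j) (suc x) ∈ₗ members (κT i j)
  ∈-pair {i} {j} {x} = there (there (∈-++⁺ʳ (map (λ d → vdk d) (allFin δ)) (∈-map⁺ (λ x → vpt (pair i j) (suc x)) (∈-allFin x))))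

  ∈-second : ∀ {i j} → vcore j ∈ₗ members (κT i j)
  ∈-second {i} {j} with i Finₚ.≟ j
  ... | yes refl = here refl
  ... | no _     = there (here refl)

  vpt-inj : ∀ l {x y} → vpt l x ≡ vpt l y → x ≡ y
  vpt-inj (inj₁ l) refl = refl
  vpt-inj (inj₂ g) refl = refl

  vpt-injˡ : ∀ l l′ {x y} → vpt l x ≡ vpt l′ y → l ≡ l′
  vpt-injˡ (inj₁ l) (inj₁ l′) refl = refl
  vpt-injˡ (inj₂ g) (inj₂ g′) refl = refl

  ord-inj : ∀ {l l′} → ord l ≡ ord l′ → l ≡ l′
  ord-inj {inj₁ _} {inj₁ _} refl = refl
  ord-inj {inj₂ _} {inj₂ _} refl = refl

  ord≢pair : ∀ l {i j} → ord l ≢ pair i j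
  ord≢pair (inj₁ _) ()
  ord≢pair (inj₂ _) ()

  vcore≢vpt : ∀ {i} l {x} → vcore i ≢ vpt l x
  vcore≢vpt (inj₁ _) ()
  vcore≢vpt (inj₂ _) ()

  vdk≢vpt : ∀ {d} l {x} → vdk d ≢ vpt l x
  vdk≢vpt (inj₁ _) ()
  vdk≢vpt (inj₂ _) ()

  In-core⁻ : ∀ {i i′ l v} → v ≡ vcore i → In v (hT i′ l) → i ≡ i′
  In-core⁻ eq hc with refl ← eq = refl
  In-core⁻ eq hd with () ← eq
  In-core⁻ {l = l} eq hp = ⊥-elim (vcore≢vpt (ord l) (sym eq))

  In-pt⁻ : ∀ {L x i l v} → v ≡ vpt L x → In v (hT i l) → L ≡ ord l
  In-pt⁻ {L} eq hc           = ⊥-elim (vcore≢vpt L eq)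
  In-pt⁻ {L} eq hd           = ⊥-elim (vdk≢vpt L eq)
  In-pt⁻ {L} {l = l} eq hp   = sym (vpt-injˡ (ord l) L eq)

  In-pt⁻κ : ∀ {L x i j v} → v ≡ vpt L x → In v (κT i j) → L ≡ pair i j
  In-pt⁻κ {L} eq κc  = ⊥-elim (vcore≢vpt L eq)
  In-pt⁻κ {L} eq κc′ = ⊥-elim (vcore≢vpt L eq)
  In-pt⁻κ {L} eq κd  = ⊥-elim (vdk≢vpt L eq)
  In-pt⁻κ {L} {i = i} {j} eq κp  = sym (vpt-injˡ (pair i j) L eq)

  -- Colour and group are visible in the hyperedge: a `κT` keeps at least one vertex of its private
  -- group, because `q` is at least 2.
  Tag-⊆⇒≡ : ∀ t t′ → (∀ {v} → v ∈ₗ members t → v ∈ₗ members t′) → t ≡ t′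
  Tag-⊆⇒≡ (hT i l) (hT i′ l′) sub = cong₂ hT
    (In-core⁻ refl (members⇒In (hT i′ l′) (sub (here refl))))
    (ord-inj (In-pt⁻ refl (members⇒In (hT i′ l′) (sub (∈-pt {i} {l} {zero})))))
  Tag-⊆⇒≡ (hT i l) (κT i′ j′) sub =
    ⊥-elim (ord≢pair l (In-pt⁻κ refl (members⇒In (κT i′ j′) (sub (∈-pt {i} {l} {zero})))))
  Tag-⊆⇒≡ (κT i j) (hT i′ l′) sub =
    ⊥-elim (ord≢pair l′ (sym (In-pt⁻ refl (members⇒In (hT i′ l′) (sub (∈-pair {i} {j} {zero}))))))
  Tag-⊆⇒≡ (κT i j) (κT i′ j′) sub with refl ← In-pt⁻κ refl (members⇒In (κT i′ j′) (sub (∈-pair {i} {j} {zero}))) = refl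

  Key : Set
  Key = Maybe (Lab ⊎ Fin r)

  keyV : V → Key
  keyV (vcore _) = nothing
  keyV (vdk _)   = nothing
  keyV (vsp l _) = just (inj₁ (inj₁ l))
  keyV (vlo t)   = just (inj₂ t)
  keyV (vgr g _) = just (inj₁ (inj₂ g))

  keyV-pt : ∀ l x → keyV (vpt l x) ≡ just (inj₁ l)
  keyV-pt (inj₁ l) x = refl
  keyV-pt (inj₂ g) x = refl

  tagLab : Tag → Lab
  tagLab (hT _ l) = ord l
  tagLab (κT i j) = pair i j

  tagColour : Tag → Fin s
  tagColour (hT i _) = i
  tagColour (κT i _) = i

  tag-determined : ∀ τ τ′ → tagLab τ ≡ tagLab τ′ → tagColour τ ≡ tagColour τ′ → τ ≡ τ′
  tag-determined (hT i l) (hT j l′) eq c   = cong₂ hT c (ord-inj eq)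
  tag-determined (hT i l) (κT _ _)  eq _   = ⊥-elim (ord≢pair l eq)
  tag-determined (κT _ _) (hT i l)  eq _   = ⊥-elim (ord≢pair l (sym eq))
  tag-determined (κT _ _) (κT _ _)  refl _ = refl

  ∉-tail : ∀ {m v} (f : Fin m → V) → (∀ d → v ≢ vdk d) → (∀ x → v ≢ f x) →
           All (v ≢_) (map (λ d → vdk d) (allFin δ) ++ map f (allFin m))
  ∉-tail {m} f v≢d v≢f = Allₚ.++⁺ {xs = map (λ d → vdk d) (allFin δ)}
    (Allₚ.map⁺ (All.universal v≢d (allFin δ))) (Allₚ.map⁺ (All.universal v≢f (allFin m)))

  tail-unique : ∀ {m} L (f : Fin m → Fin q) → (∀ {x y} → f x ≡ f y → x ≡ y) →
                Unique (map (λ d → vdk d) (allFin δ) ++ map (λ x → vpt L (f x)) (allFin m))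
  tail-unique {m} L f f-inj = Uniqueₚ.++⁺ (Uniqueₚ.map⁺ (λ { refl → refl }) (Uniqueₚ.allFin⁺ δ))
    (Uniqueₚ.map⁺ (f-inj ∘ vpt-inj L) (Uniqueₚ.allFin⁺ m))
    λ (v∈ , v∈′) → case ∈-map⁻ _ v∈ of λ { (_ , _ , eq) → case ∈-map⁻ _ v∈′ of λ { (_ , _ , eq′) →
      vdk≢vpt L (trans (sym eq) eq′) } }

  members-unique : ∀ t → Unique (members t)
  members-unique (hT i l) = ∉-tail _ (λ _ ()) (λ _ → vcore≢vpt (ord l)) ∷ tail-unique (ord l) id id
  members-unique (κT i j) with i Finₚ.≟ j
  ... | yes refl = ((λ ()) ∷ ∉-tail (λ x → vpt (pair i j) (suc x)) (λ _ ()) (λ _ ()))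
                 ∷ ∉-tail (λ x → vpt (pair i j) (suc x)) (λ _ ()) (λ _ ())
                 ∷ tail-unique (pair i j) suc Finₚ.suc-injective
  ... | no i≢j   = ((λ { refl → i≢j refl }) ∷ ∉-tail (λ x → vpt (pair i j) (suc x)) (λ _ ()) (λ _ ()))
                 ∷ ∉-tail (λ x → vpt (pair i j) (suc x)) (λ _ ()) (λ _ ())
                 ∷ tail-unique (pair i j) suc Finₚ.suc-injective

  length-tail : ∀ {m} (f : Fin m → V) → length (map (λ d → vdk d) (allFin δ) ++ map f (allFin m)) ≡ δ + m
  length-tail {m} f = trans (Listₚ.length-++ (map (λ d → vdk d) (allFin δ)))
    (cong₂ _+_ (trans (Listₚ.length-map (λ d → vdk d) (allFin δ)) (Listₚ.length-tabulate {n = δ} id))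
               (trans (Listₚ.length-map f (allFin m)) (Listₚ.length-tabulate {n = m} id)))

  length-members : ∀ t → length (members t) ≡ k
  length-members (hT i l) = cong suc (length-tail (vpt (ord l)))
  length-members (κT i j) = cong suc (trans (cong suc (length-tail (λ x → vpt (pair i j) (suc x)))) (sym (ℕₚ.+-suc δ q′)))

  ⟦_⟧ : Tag → Subset n
  ⟦ t ⟧ = ⟪ map enc (members t) ⟫

  ∈-⟦⟧⁺ : ∀ t {v} → v ∈ₗ members t → enc v ∈ ⟦ t ⟧
  ∈-⟦⟧⁺ t v∈ = ∈-⟪⟫⁺ (∈-map⁺ enc v∈)

  ∈-⟦⟧⁻ : ∀ t {v} → enc v ∈ ⟦ t ⟧ → v ∈ₗ members t
  ∈-⟦⟧⁻ t v∈ with w , w∈ , eq ← ∈-map⁻ enc (∈-⟪⟫⁻ (map enc (members t)) v∈) = subst (_∈ₗ members t) (sym (enc-inj eq)) w∈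

  ⟦⟧-inj : ∀ {t t′} → ⟦ t ⟧ ≡ ⟦ t′ ⟧ → t ≡ t′
  ⟦⟧-inj {t} {t′} eq = Tag-⊆⇒≡ t t′ λ v∈ → ∈-⟦⟧⁻ t′ (subst (_ ∈_) eq (∈-⟦⟧⁺ t v∈))

  ∣⟦⟧∣ : ∀ t → ∣ ⟦ t ⟧ ∣ ≡ k
  ∣⟦⟧∣ t = trans (∣⟪⟫∣ (Uniqueₚ.map⁺ enc-inj (members-unique t)))
                 (trans (Listₚ.length-map enc (members t)) (length-members t))

  IsEdge : Subset n → Set
  IsEdge e = ∃ λ t → e ≡ ⟦ t ⟧

  isEdge? : ∀ e → Dec (IsEdge e)
  isEdge? e = map′
    (λ { (i , inj₁ (t , eq)) → hT i (inj₁ t) , eq ; (i , inj₂ (inj₁ (g , eq))) → hT i (inj₂ g) , eq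
       ; (i , inj₂ (inj₂ (j , eq))) → κT i j , eq })
    (λ { (hT i (inj₁ t) , eq) → i , inj₁ (t , eq) ; (hT i (inj₂ g) , eq) → i , inj₂ (inj₁ (g , eq))
       ; (κT i j , eq) → i , inj₂ (inj₂ (j , eq)) })
    (any? λ i → any? (λ t → e ≟S ⟦ hT i (inj₁ t) ⟧) ⊎-dec any? (λ g → e ≟S ⟦ hT i (inj₂ g) ⟧) ⊎-dec any? (λ j → e ≟S ⟦ κT i j ⟧))

  -- Filtering the list of all subsets makes the hyperedges distinct from the outset.
  H₀ : List (Subset n)
  H₀ = filter isEdge? (subsets n)

  H₀-unique : Unique H₀
  H₀-unique = Uniqueₚ.filter⁺ isEdge? (subsets-unique n)

  ∈-H₀ : ∀ t → ⟦ t ⟧ ∈ₗ H₀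
  ∈-H₀ t = ∈-filter⁺ isEdge? (∈-subsets ⟦ t ⟧) (t , refl)

  ∈-H₀⁻ : ∀ {e} → e ∈ₗ H₀ → IsEdge e
  ∈-H₀⁻ e∈ = proj₂ (∈-filter⁻ isEdge? {xs = subsets n} e∈)

  H₀-uniform : All (λ e → ∣ e ∣ ≡ k) H₀
  H₀-uniform = All.tabulate λ e∈ → case ∈-H₀⁻ e∈ of λ { (t , refl) → ∣⟦⟧∣ t }

  contains⇒embeds : ∀ {F} → ContainsBerge F H₀ → EmbedsIn F In
  contains⇒embeds {F} c with E , φ∈ ← Berge.contains⇒copy F H₀-unique c = record
    { ψ = dec ∘ ψ ; φ = tag ; ψ-inj = ψ-inj ∘ dec-inj
    ; φ-inj = λ {i} {j} eq → φ-inj (trans (proj₂ (edge i)) (trans (cong ⟦_⟧ eq) (sym (proj₂ (edge j)))))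
    ; incˡ = λ i → inc i (incˡ i) ; incʳ = λ i → inc i (incʳ i) }
    where
    open EmbedsIn E
    edge : ∀ i → IsEdge (φ i)
    edge i = ∈-H₀⁻ (φ∈ i)
    tag : _ → Tag
    tag i = proj₁ (edge i)
    inc : ∀ i {w} → w ∈ φ i → In (dec w) (tag i)
    inc i {w} w∈ = members⇒In (tag i) (∈-⟦⟧⁻ (tag i) (subst (_∈ ⟦ tag i ⟧) (sym (enc-dec w)) (subst (w ∈_) (proj₂ (edge i)) w∈)))

  -- With `RawV`, `RawE` and `RawInc`: what a hypergraph above `H₀` with a system is sure to
  -- provide. Reserved groups lie within `X₀`, so no site of the system falls into them.
  data RawSlot (P : ℕ) : Set where
    reserved : Fin ρ → RawSlot P
    touched  : Site P (suc P) → RawSlot P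

  data RawV (P : ℕ) : Set where
    core : Fin s → RawV P
    dk   : Fin δ → RawV P
    pt   : RawSlot P → Fin q → RawV P

  data RawE (P : ℕ) : Set where
    h  : Fin s → RawSlot P → RawE P
    κ  : Fin s → Fin s → RawE P
    eh : Fin P ⊎ Fin (suc P) → RawE P

  data RawInc {P : ℕ} (tp : Site P (suc P) → Fin q) : RawV P → RawE P → Set where
    ch     : ∀ {i σ} → RawInc tp (core i) (h i σ)
    dh     : ∀ {d i σ} → RawInc tp (dk d) (h i σ)
    ph     : ∀ {i σ x} → RawInc tp (pt σ x) (h i σ)
    κˡ     : ∀ {i j} → RawInc tp (core i) (κ i j)
    κʳ     : ∀ {i j} → RawInc tp (core j) (κ i j)
    hubᵢ   : ∀ {i} → RawInc tp (pt (touched hub) (tp hub)) (eh (inj₁ i))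
    leafᵢ  : ∀ {i} → RawInc tp (pt (touched (leaf i)) (tp (leaf i))) (eh (inj₁ i))
    leftᵢ  : ∀ {i} → RawInc tp (pt (touched (left i)) (tp (left i))) (eh (inj₂ i))
    rightᵢ : ∀ {i} → RawInc tp (pt (touched (right i)) (tp (right i))) (eh (inj₂ i))

  module Realize (F : Graph) {Es : List (Subset n)} (H₀⊆ : ∀ {e} → e ∈ₗ H₀ → e ∈ₗ Es)
                 (S : Counting.System lab cls q cls-length cls-complete (p F) (suc (p F)) X₀ Es) where
    open Counting.System S
    P : ℕ
    P = p F

    grp : Site P (suc P) → Fin G
    grp σ = proj₁ (outside-X₀ (w σ) (w∉ σ))

    tp : Site P (suc P) → Fin q
    tp σ = proj₁ (proj₂ (outside-X₀ (w σ) (w∉ σ)))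

    dec-w : ∀ σ → dec (w σ) ≡ vgr (grp σ) (tp σ)
    dec-w σ = proj₂ (proj₂ (outside-X₀ (w σ) (w∉ σ)))

    w≡ : ∀ σ → w σ ≡ enc (vgr (grp σ) (tp σ))
    w≡ σ = trans (sym (enc-dec (w σ))) (cong enc (dec-w σ))

    grp-inj : ∀ {σ τ} → grp σ ≡ grp τ → σ ≡ τ
    grp-inj {σ} {τ} eq = w-lab (trans (cong key (dec-w σ)) (trans (cong inj₁ eq) (sym (cong key (dec-w τ)))))

    slotOrd : RawSlot P → Ord
    slotOrd (reserved t) = inj₁ t
    slotOrd (touched σ)  = inj₂ (grp σ)

    slotOrd-inj : ∀ {σ τ} → slotOrd σ ≡ slotOrd τ → σ ≡ τ
    slotOrd-inj {reserved _} {reserved _} refl = refl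
    slotOrd-inj {touched _}  {touched _}  eq   = cong touched (grp-inj (Sumₚ.inj₂-injective eq))
    slotOrd-inj {reserved _} {touched _}  ()
    slotOrd-inj {touched _}  {reserved _} ()

    vertV : RawV P → V
    vertV (core i) = vcore i
    vertV (dk d)   = vdk d
    vertV (pt σ x) = vpt (ord (slotOrd σ)) x

    vertV-inj : ∀ {v v′} → vertV v ≡ vertV v′ → v ≡ v′
    vertV-inj {core _} {core _} refl = refl
    vertV-inj {dk _}   {dk _}   refl = refl
    vertV-inj {pt σ x} {pt τ y} eq with refl ← slotOrd-inj {σ} {τ} (ord-inj (vpt-injˡ (ord (slotOrd σ)) (ord (slotOrd τ)) eq)) =
      cong (pt σ) (vpt-inj (ord (slotOrd σ)) eq)
    vertV-inj {core _} {dk _}   ()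
    vertV-inj {dk _}   {core _} ()
    vertV-inj {core _} {pt σ _} eq = ⊥-elim (vcore≢vpt (ord (slotOrd σ)) eq)
    vertV-inj {pt σ _} {core _} eq = ⊥-elim (vcore≢vpt (ord (slotOrd σ)) (sym eq))
    vertV-inj {dk _}   {pt σ _} eq = ⊥-elim (vdk≢vpt (ord (slotOrd σ)) eq)
    vertV-inj {pt σ _} {dk _}   eq = ⊥-elim (vdk≢vpt (ord (slotOrd σ)) (sym eq))

    edge : RawE P → Subset n
    edge (h i σ) = ⟦ hT i (slotOrd σ) ⟧
    edge (κ i j) = ⟦ κT i j ⟧
    edge (eh t)  = e t

    edge∈ : ∀ d → edge d ∈ₗ Es
    edge∈ (h i σ) = H₀⊆ (∈-H₀ (hT i (slotOrd σ)))
    edge∈ (κ i j) = H₀⊆ (∈-H₀ (κT i j))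
    edge∈ (eh t)  = e∈ t

    -- A star or matching edge meets two groups, a hyperedge of H₀ only one.
    two-groups : ∀ t → ∃ λ σ → ∃ λ τ → σ ≢ τ × w σ ∈ e t × w τ ∈ e t
    two-groups (inj₁ i) = hub , leaf i , (λ ()) , hub∈ i , leaf∈ i
    two-groups (inj₂ i) = left i , right i , (λ ()) , left∈ i , right∈ i

    one-group : ∀ t {σ τ} → w σ ∈ ⟦ t ⟧ → w τ ∈ ⟦ t ⟧ → σ ≡ τ
    one-group t {σ} {τ} σ∈ τ∈ = grp-inj (inGroup t (at σ σ∈) (at τ τ∈))
      where
      at : ∀ σ → w σ ∈ ⟦ t ⟧ → In (vgr (grp σ) (tp σ)) t
      at σ σ∈ = members⇒In t (∈-⟦⟧⁻ t (subst (_∈ ⟦ t ⟧) (w≡ σ) σ∈))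
      inGroup : ∀ t {g g′ x y} → In (vgr g x) t → In (vgr g′ y) t → g ≡ g′
      inGroup (hT i l) {g} {g′} a b = Sumₚ.inj₂-injective (trans (In-pt⁻ {inj₂ g} refl a) (sym (In-pt⁻ {inj₂ g′} refl b)))
      inGroup (κT i j) {g} {g′} a b = Sumₚ.inj₂-injective (trans (In-pt⁻κ {inj₂ g} refl a) (sym (In-pt⁻κ {inj₂ g′} refl b)))

    new : ∀ t t′ → e t ≢ ⟦ t′ ⟧
    new t t′ eq with σ , τ , σ≢τ , σ∈ , τ∈ ← two-groups t =
      σ≢τ (one-group t′ (subst (w σ ∈_) eq σ∈) (subst (w τ ∈_) eq τ∈))

    edge-inj : ∀ {d d′} → edge d ≡ edge d′ → d ≡ d′
    edge-inj {h i σ} {h j τ} eq = go (⟦⟧-inj {hT i (slotOrd σ)} {hT j (slotOrd τ)} eq)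
      where
      go : hT i (slotOrd σ) ≡ hT j (slotOrd τ) → h i σ ≡ h j τ
      go eq = cong₂ h (hT-injˡ eq) (slotOrd-inj (hT-injʳ eq))
        where
        hT-injˡ : ∀ {i j l l′} → hT i l ≡ hT j l′ → i ≡ j
        hT-injˡ refl = refl
        hT-injʳ : ∀ {i j l l′} → hT i l ≡ hT j l′ → l ≡ l′
        hT-injʳ refl = refl
    edge-inj {h i σ} {κ a b} eq = case ⟦⟧-inj {hT i (slotOrd σ)} {κT a b} eq of λ ()
    edge-inj {κ a b} {h i σ} eq = case ⟦⟧-inj {κT a b} {hT i (slotOrd σ)} eq of λ ()
    edge-inj {κ i j} {κ i′ j′} eq with refl ← ⟦⟧-inj {κT i j} {κT i′ j′} eq = refl
    edge-inj {eh t} {eh t′} eq = cong eh (e-inj eq)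
    edge-inj {eh t} {h i σ} eq = ⊥-elim (new t (hT i (slotOrd σ)) eq)
    edge-inj {eh t} {κ i j} eq = ⊥-elim (new t (κT i j) eq)
    edge-inj {h i σ} {eh t} eq = ⊥-elim (new t (hT i (slotOrd σ)) (sym eq))
    edge-inj {κ i j} {eh t} eq = ⊥-elim (new t (κT i j) (sym eq))

    realize-inc : ∀ {v d} → RawInc tp v d → enc (vertV v) ∈ edge d
    realize-inc (ch {i} {σ}) = ∈-⟦⟧⁺ (hT i (slotOrd σ)) (here refl)
    realize-inc (dh {d} {i} {σ}) = ∈-⟦⟧⁺ (hT i (slotOrd σ)) (∈-dk {d} {hT i (slotOrd σ)})
    realize-inc (ph {i} {σ}) = ∈-⟦⟧⁺ (hT i (slotOrd σ)) ∈-pt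
    realize-inc (κˡ {i} {j}) = ∈-⟦⟧⁺ (κT i j) (here refl)
    realize-inc (κʳ {i} {j}) = ∈-⟦⟧⁺ (κT i j) ∈-second
    realize-inc (hubᵢ {i}) = subst (_∈ e (inj₁ i)) (w≡ hub) (hub∈ i)
    realize-inc (leafᵢ {i}) = subst (_∈ e (inj₁ i)) (w≡ (leaf i)) (leaf∈ i)
    realize-inc (leftᵢ {i}) = subst (_∈ e (inj₂ i)) (w≡ (left i)) (left∈ i)
    realize-inc (rightᵢ {i}) = subst (_∈ e (inj₂ i)) (w≡ (right i)) (right∈ i)

    realize : EmbedsIn F (RawInc tp) → ContainsBerge F Es
    realize E = Berge.copy⇒contains F
      (embed-map (enc ∘ vertV) edge (vertV-inj ∘ enc-inj) edge-inj realize-inc E , λ i → edge∈ (EmbedsIn.φ E i))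

  -- Containment is decidable. If `H₀` is free of Berge-F, its completion is sparse; otherwise the
  -- copy itself is returned, to be redrawn for another choice of `H₀`.
  saturated-or-embeds : ∀ F → n > 0 → ((tp : Site (p F) (suc (p F)) → Fin q) → EmbedsIn F (RawInc tp)) →
    SatAtMost k F n (bound q (p F) b₀ * n) ⊎ EmbedsIn F In
  saturated-or-embeds F n>0 embed = decide (Berge.contains? F H₀)
    where
    decide : Dec (ContainsBerge F H₀) → SatAtMost k F n (bound q (p F) b₀ * n) ⊎ EmbedsIn F In
    decide (yes con) = inj₂ (contains⇒embeds con)
    decide (no free) = inj₁ (sparse-saturation F k lab cls q cls-length cls-complete {X = X₀} n>0
      (ℕₚ.≤-reflexive length-X₀) H₀-unique H₀-uniform free
      λ _ H₀⊆ S → Realize.realize F H₀⊆ S (embed (Realize.tp F H₀⊆ S)))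

-- Realising the symbolic hypergraphs, with the extra piece

-- The extra piece realised in S_s: one matching edge `gm` joins two touched groups (`true` is its left end, `false`
-- its right end), and `ga a b` is the hyperedge of colour a on group b.
module Gadget (s q : ℕ) (t₁ t₂ : Fin q) where

  GV : Set
  GV = Bool × Fin q

  data GE : Set where
    ga : Fin s → Bool → GE
    gm : GE

  data GI : GE → Fin s ⊎ GV → Set where
    ac : ∀ {a b} → GI (ga a b) (inj₁ a)
    ag : ∀ {a b x} → GI (ga a b) (inj₂ (b , x))
    ml : GI gm (inj₂ (true , t₁))
    mr : GI gm (inj₂ (false , t₂))

-- The first of the `P + 1` matching edges is set aside for the extra piece; `P` are enough for the
-- groups of a drawing, which are named by vertices of F.
shiftSite : ∀ {P} → Site P P → Site P (suc P)
shiftSite hub       = hub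
shiftSite (leaf i)  = leaf i
shiftSite (left i)  = left (suc i)
shiftSite (right i) = right (suc i)

unshift : ∀ {P} → Site P (suc P) → Maybe (Site P P)
unshift hub             = just hub
unshift (leaf i)        = just (leaf i)
unshift (left zero)     = nothing
unshift (left (suc i))  = just (left i)
unshift (right zero)    = nothing
unshift (right (suc i)) = just (right i)

unshift-shift : ∀ {P} (σ : Site P P) → unshift (shiftSite σ) ≡ just σ
unshift-shift hub       = refl
unshift-shift (leaf i)  = refl
unshift-shift (left i)  = refl
unshift-shift (right i) = refl

shiftSite-inj : ∀ {P} {σ τ : Site P P} → shiftSite σ ≡ shiftSite τ → σ ≡ τ
shiftSite-inj = retract-injᵐ unshift unshift-shift

module ConcreteS (P s q″ ρ′ r G : ℕ) where
  open Concrete s 0 q″ (P + ρ′) r G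

  module _ (tp : Site P (suc P) → Fin q) where
    open Gadget s q (tp (left zero)) (tp (right zero))
    open Model P q s GV GE GI (tp ∘ shiftSite) using (MV; ME; Inc)
    private module M = Model P q s GV GE GI (tp ∘ shiftSite)

    gslot : Bool → RawSlot P
    gslot true  = touched (left zero)
    gslot false = touched (right zero)

    slot : Slot P → RawSlot P
    slot (plain u)   = reserved (u ↑ˡ ρ′)
    slot (touched σ) = touched (shiftSite σ)

    slot⁻ : RawSlot P → Slot P ⊎ Bool
    -- Beyond the first `P` reserved groups the value is a dummy: a retraction matters on images
    -- only.
    slot⁻ (reserved t)            = Data.Sum.map plain (λ _ → true) (Data.Fin.splitAt P t)
    slot⁻ (touched hub)           = inj₁ (touched hub)
    slot⁻ (touched (leaf i))      = inj₁ (touched (leaf i))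
    slot⁻ (touched (left zero))   = inj₂ true
    slot⁻ (touched (left (suc i))) = inj₁ (touched (left i))
    slot⁻ (touched (right zero))  = inj₂ false
    slot⁻ (touched (right (suc i))) = inj₁ (touched (right i))

    slot⁻-slot : ∀ σ → slot⁻ (slot σ) ≡ inj₁ σ
    slot⁻-slot (plain u) rewrite Finₚ.splitAt-↑ˡ P u ρ′ = refl
    slot⁻-slot (touched hub)       = refl
    slot⁻-slot (touched (leaf i))  = refl
    slot⁻-slot (touched (left i))  = refl
    slot⁻-slot (touched (right i)) = refl

    slot⁻-gslot : ∀ b → slot⁻ (gslot b) ≡ inj₂ b
    slot⁻-gslot true  = refl
    slot⁻-gslot false = refl

    vmap : MV → RawV P
    vmap (M.core i)     = core i
    vmap (M.pt σ x)     = pt (slot σ) x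
    vmap (M.gv (b , x)) = pt (gslot b) x

    vmap⁻ : RawV P → MV
    vmap⁻ (core i) = M.core i
    vmap⁻ (pt σ x) = [ (λ τ → M.pt τ x) , (λ b → M.gv (b , x)) ]′ (slot⁻ σ)

    vmap⁻-vmap : ∀ v → vmap⁻ (vmap v) ≡ v
    vmap⁻-vmap (M.core i)                              = refl
    vmap⁻-vmap (M.pt σ x) rewrite slot⁻-slot σ         = refl
    vmap⁻-vmap (M.gv (b , x)) rewrite slot⁻-gslot b    = refl

    emap : ME → RawE P
    emap (M.h i σ)         = h i (slot σ)
    emap (M.κ i j)         = κ i j
    emap (M.eh (inj₁ i))   = eh (inj₁ i)
    emap (M.eh (inj₂ i))   = eh (inj₂ (suc i))
    emap (M.ge (ga a b))   = h a (gslot b)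
    emap (M.ge gm)         = eh (inj₂ zero)

    emap⁻ : RawE P → ME
    emap⁻ (h i σ)             = [ M.h i , (λ b → M.ge (ga i b)) ]′ (slot⁻ σ)
    emap⁻ (κ i j)             = M.κ i j
    emap⁻ (eh (inj₁ i))       = M.eh (inj₁ i)
    emap⁻ (eh (inj₂ zero))    = M.ge gm
    emap⁻ (eh (inj₂ (suc i))) = M.eh (inj₂ i)

    emap⁻-emap : ∀ e → emap⁻ (emap e) ≡ e
    emap⁻-emap (M.h i σ) rewrite slot⁻-slot σ          = refl
    emap⁻-emap (M.κ i j)                               = refl
    emap⁻-emap (M.eh (inj₁ i))                         = refl
    emap⁻-emap (M.eh (inj₂ i))                         = refl
    emap⁻-emap (M.ge (ga a b)) rewrite slot⁻-gslot b   = refl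
    emap⁻-emap (M.ge gm)                               = refl

    inc-map : ∀ {v e} → Inc v e → RawInc tp (vmap v) (emap e)
    inc-map M.ch       = ch
    inc-map M.ph       = ph
    inc-map M.κˡ       = κˡ
    inc-map M.κʳ       = κʳ
    inc-map M.hubᵢ     = hubᵢ
    inc-map M.leafᵢ    = leafᵢ
    inc-map M.leftᵢ    = leftᵢ
    inc-map M.rightᵢ   = rightᵢ
    inc-map (M.gcᵢ ac) = ch
    inc-map (M.ggᵢ ag) = ph
    inc-map (M.ggᵢ ml) = leftᵢ
    inc-map (M.ggᵢ mr) = rightᵢ

    embed-raw : ∀ {F} → EmbedsIn F Inc → EmbedsIn F (RawInc tp)
    embed-raw = embed-map vmap emap (retract-inj vmap⁻ vmap⁻-vmap) (retract-inj emap⁻ emap⁻-emap) inc-map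

-- From an embedding to a drawing

module Canonical {P : ℕ} {A : Set} (_≟_ : DecidableEquality A) (f : Fin P → A) where

  search : (a : A) → Dec (∃ λ u → f u ≡ a)
  search a = any? λ u → f u ≟ a

  pick : (a : A) → Dec (∃ λ u → f u ≡ a) → Fin P → Fin P
  pick a (yes (u , _)) _ = u
  pick a (no _)        d = d

  -- The representative depends on the value `f u` alone. It names a group by a vertex of F,
  -- whatever the number of groups in the host.
  canon : Fin P → Fin P
  canon u = pick (f u) (search (f u)) u

  f-canon : ∀ u → f (canon u) ≡ f u
  f-canon u with search (f u)
  ... | yes (_ , eq) = eq
  ... | no _         = refl

  canon-cong : ∀ {u v} → f u ≡ f v → canon u ≡ canon v
  canon-cong {u} {v} eq = go (f u) (f v) eq refl
    where
    go : ∀ a b → a ≡ b → f u ≡ a → pick a (search a) u ≡ pick b (search b) v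
    go a .a refl fu with search a
    ... | yes _ = refl
    ... | no ¬u = ⊥-elim (¬u (u , fu))

  canon-inj : ∀ {u v} → canon u ≡ canon v → f u ≡ f v
  canon-inj {u} {v} eq = trans (sym (f-canon u)) (trans (cong f eq) (f-canon v))

noGI : ∀ {s : ℕ} → ⊥ → Fin s ⊎ ⊥ → Set
noGI ()

module FromConcrete (F : Graph) (s q″ ρ r G : ℕ) (E : EmbedsIn F (Concrete.In (suc s) 0 q″ ρ r G)) where
  open Graphs F
  open Concrete (suc s) 0 q″ ρ r G
  open EmbedsIn E
  open Drawing F q s ⊥ ⊥ noGI

  _≟K_ : DecidableEquality Key
  _≟K_ = Maybeₚ.≡-dec (Sumₚ.≡-dec (Sumₚ.≡-dec (Sumₚ.≡-dec (Productₚ.≡-dec Finₚ._≟_ Finₚ._≟_) Finₚ._≟_) Finₚ._≟_) Finₚ._≟_)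

  open Canonical _≟K_ (keyV ∘ ψ)

  -- Core vertex `zero` becomes the new one, whose hyperedges the star and the matching have to make
  -- up for.
  colour : Fin (suc s) → Maybe (Fin s)
  colour zero    = nothing
  colour (suc i) = just i

  colour-inj : ∀ {i j} → colour i ≡ colour j → i ≡ j
  colour-inj {zero}  {zero}  _    = refl
  colour-inj {suc i} {suc j} refl = refl

  -- A vertex in no hyperedge counts as a group with a single member, at position `zero`.
  roleV : Fin P → V → Role
  roleV u (vcore i) = cr (colour i)
  roleV u (vsp _ x) = gp (canon u) x
  roleV u (vlo _)   = gp (canon u) zero
  roleV u (vgr _ x) = gp (canon u) x

  role : Fin P → Role
  role u = roleV u (ψ u)

  gp-inj : ∀ {l l′ x y} → gp l x ≡ gp l′ y → l ≡ l′ × x ≡ y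
  gp-inj refl = refl , refl

  cr-inj : ∀ {c d} → cr c ≡ cr d → c ≡ d
  cr-inj refl = refl

  roleV-inj : ∀ u v a b → ψ u ≡ a → ψ v ≡ b → roleV u a ≡ roleV v b → a ≡ b
  roleV-inj u v (vcore i) (vcore j) _  _  eq = cong (λ i → vcore i) (colour-inj (cr-inj eq))
  roleV-inj u v a b ea eb eq with a | b
  ... | vsp l x | vsp l′ y with c , refl ← gp-inj eq
                           with refl ← trans (sym (cong keyV ea)) (trans (canon-inj c) (cong keyV eb)) = refl
  ... | vgr l x | vgr l′ y with c , refl ← gp-inj eq
                           with refl ← trans (sym (cong keyV ea)) (trans (canon-inj c) (cong keyV eb)) = refl
  ... | vlo t   | vlo t′   with c , _ ← gp-inj eq
                           with refl ← trans (sym (cong keyV ea)) (trans (canon-inj c) (cong keyV eb)) = refl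
  ... | vsp _ _ | vgr _ _ with () ← trans (sym (cong keyV ea)) (trans (canon-inj (proj₁ (gp-inj eq))) (cong keyV eb))
  ... | vsp _ _ | vlo _   with () ← trans (sym (cong keyV ea)) (trans (canon-inj (proj₁ (gp-inj eq))) (cong keyV eb))
  ... | vgr _ _ | vsp _ _ with () ← trans (sym (cong keyV ea)) (trans (canon-inj (proj₁ (gp-inj eq))) (cong keyV eb))
  ... | vgr _ _ | vlo _   with () ← trans (sym (cong keyV ea)) (trans (canon-inj (proj₁ (gp-inj eq))) (cong keyV eb))
  ... | vlo _   | vsp _ _ with () ← trans (sym (cong keyV ea)) (trans (canon-inj (proj₁ (gp-inj eq))) (cong keyV eb))
  ... | vlo _   | vgr _ _ with () ← trans (sym (cong keyV ea)) (trans (canon-inj (proj₁ (gp-inj eq))) (cong keyV eb))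
  ... | vcore i | vcore j = cong (λ i → vcore i) (colour-inj (cr-inj eq))
  ... | vcore _ | vsp _ _ with () ← eq
  ... | vcore _ | vgr _ _ with () ← eq
  ... | vcore _ | vlo _   with () ← eq
  ... | vsp _ _ | vcore _ with () ← eq
  ... | vgr _ _ | vcore _ with () ← eq
  ... | vlo _   | vcore _ with () ← eq

  roleV-pt : ∀ u l x → roleV u (vpt l x) ≡ gp (canon u) x
  roleV-pt u (inj₁ l) x = refl
  roleV-pt u (inj₂ g) x = refl

  -- The private group of a pair lies in one hyperedge only, so an edge of F that uses it may take
  -- whatever colour suits its ends.
  HasColour : Tag → Maybe (Fin s) → Set
  HasColour (hT i _) c = c ≡ colour i
  HasColour (κT _ _) _ = ⊤

  tag-unique : ∀ τ τ′ {c} → tagLab τ ≡ tagLab τ′ → HasColour τ c → HasColour τ′ c → τ ≡ τ′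
  tag-unique (hT i l) (hT j l′) eq c c′ = cong₂ hT (colour-inj (trans (sym c) c′)) (ord-inj eq)
  tag-unique (hT i l) (κT _ _)  eq _ _  = ⊥-elim (ord≢pair l eq)
  tag-unique (κT _ _) (hT i l)  eq _ _  = ⊥-elim (ord≢pair l (sym eq))
  tag-unique (κT _ _) (κT _ _)  refl _ _ = refl

  record EdgeInfo (u v : Fin P) (τ : Tag) : Set where
    field
      t    : EdgeType
      okᵤ  : Ok (role u) t
      okᵥ  : Ok (role v) t
      back : ∀ {l c} → t ≡ grp l c → (∃ λ w → canon w ≡ l × keyV (ψ w) ≡ just (inj₁ (tagLab τ))) × HasColour τ c

  swap-info : ∀ {u v τ} → EdgeInfo u v τ → EdgeInfo v u τ
  swap-info I = record { t = t ; okᵤ = okᵥ ; okᵥ = okᵤ ; back = back }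
    where open EdgeInfo I

  ok-core : ∀ {u i l} → ψ u ≡ vcore i → Ok (role u) (grp l (colour i))
  ok-core {u} {i} {l} eq = subst (λ v → Ok (roleV u v) (grp l (colour i))) (sym eq) gc

  ok-cc : ∀ {u i} → ψ u ≡ vcore i → Ok (role u) cc
  ok-cc {u} eq = subst (λ v → Ok (roleV u v) cc) (sym eq) cc

  ok-pt : ∀ {u L x c} → ψ u ≡ vpt L x → Ok (role u) (grp (canon u) c)
  ok-pt {u} {L} {x} {c} eq = subst (λ v → Ok (roleV u v) (grp (canon u) c)) (sym eq)
    (subst (λ r → Ok r (grp (canon u) c)) (sym (roleV-pt u L x)) gg)

  key-pt : ∀ {u L x} → ψ u ≡ vpt L x → keyV (ψ u) ≡ just (inj₁ L)
  key-pt {L = L} {x} eq = trans (cong keyV eq) (keyV-pt L x)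

  spoke : ∀ {u v i x τ} → ψ u ≡ vcore i → ψ v ≡ vpt (tagLab τ) x → HasColour τ (colour i) → EdgeInfo u v τ
  spoke {v = v} {i} eu ev c = record
    { t = grp (canon v) (colour i) ; okᵤ = ok-core eu ; okᵥ = ok-pt ev
    ; back = λ { refl → (v , refl , key-pt ev) , c } }

  chord : ∀ {u v x y c τ} → ψ u ≡ vpt (tagLab τ) x → ψ v ≡ vpt (tagLab τ) y → HasColour τ c → EdgeInfo u v τ
  chord {u} {v} {c = c} eu ev col = record
    { t = grp (canon u) c ; okᵤ = ok-pt eu
    ; okᵥ = subst (λ l → Ok (role v) (grp l c)) (canon-cong (trans (key-pt ev) (sym (key-pt eu)))) (ok-pt ev)
    ; back = λ { refl → (u , refl , key-pt eu) , col } }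

  info : ∀ {u v a b} τ → u ≢ v → ψ u ≡ a → ψ v ≡ b → In a τ → In b τ → EdgeInfo u v τ
  info (hT i l) u≢v eu ev hc hc = ⊥-elim (u≢v (ψ-inj (trans eu (sym ev))))
  info (hT i l) u≢v eu ev hc hp = spoke {τ = hT i l} eu ev refl
  info (hT i l) u≢v eu ev hp hc = swap-info (spoke {τ = hT i l} ev eu refl)
  info (hT i l) u≢v eu ev hp hp = chord {τ = hT i l} eu ev refl
  info (κT i j) u≢v eu ev κc  κp  = spoke {τ = κT i j} eu ev tt
  info (κT i j) u≢v eu ev κc′ κp  = spoke {τ = κT i j} eu ev tt
  info (κT i j) u≢v eu ev κp  κc  = swap-info (spoke {τ = κT i j} ev eu tt)
  info (κT i j) u≢v eu ev κp  κc′ = swap-info (spoke {τ = κT i j} ev eu tt)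
  -- The colour `nothing` is an arbitrary choice: this is the only edge on its private group.
  info (κT i j) u≢v eu ev κp  κp  = chord {c = nothing} {τ = κT i j} eu ev tt
  info (κT i j) u≢v eu ev κc  κc  = record { t = cc ; okᵤ = ok-cc eu ; okᵥ = ok-cc ev ; back = λ () }
  info (κT i j) u≢v eu ev κc  κc′ = record { t = cc ; okᵤ = ok-cc eu ; okᵥ = ok-cc ev ; back = λ () }
  info (κT i j) u≢v eu ev κc′ κc  = record { t = cc ; okᵤ = ok-cc eu ; okᵥ = ok-cc ev ; back = λ () }
  info (κT i j) u≢v eu ev κc′ κc′ = record { t = cc ; okᵤ = ok-cc eu ; okᵥ = ok-cc ev ; back = λ () }

  infoAt : ∀ i → EdgeInfo (src i) (tgt i) (φ i)
  infoAt i = info (φ i) (src≢tgt i) refl refl (incˡ i) (incʳ i)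

  drawn : Drawn
  drawn = record
    { role = role ; et = λ i → EdgeInfo.t (infoAt i)
    ; role-inj = λ {u} {v} eq → ψ-inj (roleV-inj u v (ψ u) (ψ v) refl refl eq)
    ; et-inj = λ {i} {j} → et-inj i j
    ; okˡ = λ i → EdgeInfo.okᵤ (infoAt i) ; okʳ = λ i → EdgeInfo.okᵥ (infoAt i) }
    where
    et-inj : ∀ i j → EdgeInfo.t (infoAt i) ≡ EdgeInfo.t (infoAt j) → EdgeInfo.t (infoAt i) ≢ cc → i ≡ j
    et-inj i j eq ≢cc with EdgeInfo.t (infoAt i) in ti
    ... | cc = ⊥-elim (≢cc refl)
    ... | gt ()
    ... | grp l c with (w , cw , kw) , hi ← EdgeInfo.back (infoAt i) ti | (w′ , cw′ , kw′) , hj ← EdgeInfo.back (infoAt j) (sym eq) =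
      φ-inj (tag-unique (φ i) (φ j) (Sumₚ.inj₁-injective (just-injective
        (trans (sym kw) (trans (canon-inj (trans cw (sym cw′))) kw′)))) hi hj)

-- Obstructing triangles and 4-cycles

unique-length : ∀ {n} {xs : List (Fin n)} → Unique xs → length xs ≤ n
unique-length {n} {xs} u = subst (length xs ≤_) (Listₚ.length-tabulate {n = n} id)
  (Removal.unique-⊆-length Finₚ._≟_ (allFin n) u λ _ → ∈-allFin _)

module Cycles (F : Graph) where
  open Graphs F

  touches⇒ends : ∀ {i u v} → u ≢ v → Touches i u → Touches i v → Ends i u v
  touches⇒ends u≢v (inj₁ a) (inj₁ b) = ⊥-elim (u≢v (trans (sym a) b))
  touches⇒ends u≢v (inj₁ a) (inj₂ b) = inj₁ (a , b)
  touches⇒ends u≢v (inj₂ a) (inj₁ b) = inj₂ (b , a)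
  touches⇒ends u≢v (inj₂ a) (inj₂ b) = ⊥-elim (u≢v (trans (sym a) b))

  ends⇒touchesˡ : ∀ {i u v} → Ends i u v → Touches i u
  ends⇒touchesˡ (inj₁ (a , b)) = inj₁ a
  ends⇒touchesˡ (inj₂ (a , b)) = inj₂ b

  touches? : ∀ i u → Dec (Touches i u)
  touches? i u = (src i Finₚ.≟ u) ⊎-dec (tgt i Finₚ.≟ u)

  record Triangle : Set where
    field
      x y z       : Fin P
      exy exz eyz : Fin m
      endsxy      : Ends exy x y
      endsxz      : Ends exz x z
      endsyz      : Ends eyz y z

    Among : Fin m → Set
    Among j = j ≡ exy ⊎ j ≡ exz ⊎ j ≡ eyz

    among? : ∀ j → Dec (Among j)
    among? j = (j Finₚ.≟ exy) ⊎-dec (j Finₚ.≟ exz) ⊎-dec (j Finₚ.≟ eyz)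

    Outer : Fin m → Set
    Outer j = (Touches j x ⊎ Touches j y ⊎ Touches j z) × ¬ Among j

    -- A pendant triangle may have further edges at `x`, which will be placed on a core vertex, but
    -- not at `y` and `z`, which will lie in the extra piece.
    Pendant Isolated : Set
    Pendant  = ∀ j → Touches j y ⊎ Touches j z → Among j
    Isolated = Pendant × (∀ j → Touches j x → Among j)

  module _ (T : Triangle) where
    open Triangle T

    rotate-y rotate-z : Triangle
    rotate-y = record { x = y ; y = x ; z = z ; exy = exy ; exz = eyz ; eyz = exz
                      ; endsxy = Ends-swap endsxy ; endsxz = endsyz ; endsyz = endsxz }
    rotate-z = record { x = z ; y = x ; z = y ; exy = exz ; exz = eyz ; eyz = exy
                      ; endsxy = Ends-swap endsxz ; endsxz = Ends-swap endsyz ; endsyz = endsxy }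

    not-two : ∀ {j u v e} → ¬ Among j → Among e → Ends e u v → ¬ (Touches j u × Touches j v)
    not-two {j} {u} {v} {e} ¬am am ends (ju , jv) =
      ¬am (subst Among (edge-unique {e} {j} ends (touches⇒ends (Ends-≢ ends) ju jv)) am)

    -- The apex is chosen to be the vertex carrying the outer edge, if there is one.
    apex : (∀ {i j} → Outer i → Outer j → i ≡ j) → Σ Triangle Triangle.Pendant
    apex unique with any? (λ j → touches? j y ×-dec ¬? (among? j)) | any? (λ j → touches? j z ×-dec ¬? (among? j))
    ... | yes (j₀ , t₀ , ¬am₀) | _ = rotate-y , λ j touch → by j touch (among? j)
      where
      by : ∀ j → Touches j x ⊎ Touches j z → Dec (Among j) → Triangle.Among rotate-y j
      by j _ (yes (inj₁ a))        = inj₁ a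
      by j _ (yes (inj₂ (inj₁ a))) = inj₂ (inj₂ a)
      by j _ (yes (inj₂ (inj₂ a))) = inj₂ (inj₁ a)
      by j (inj₁ tx) (no ¬am) with refl ← unique (inj₁ tx , ¬am) (inj₂ (inj₁ t₀) , ¬am₀) =
        ⊥-elim (not-two ¬am (inj₁ refl) endsxy (tx , t₀))
      by j (inj₂ tz) (no ¬am) with refl ← unique (inj₂ (inj₂ tz) , ¬am) (inj₂ (inj₁ t₀) , ¬am₀) =
        ⊥-elim (not-two ¬am (inj₂ (inj₂ refl)) endsyz (t₀ , tz))
    ... | no _ | yes (j₀ , t₀ , ¬am₀) = rotate-z , λ j touch → by j touch (among? j)
      where
      by : ∀ j → Touches j x ⊎ Touches j y → Dec (Among j) → Triangle.Among rotate-z j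
      by j _ (yes (inj₁ a))        = inj₂ (inj₂ a)
      by j _ (yes (inj₂ (inj₁ a))) = inj₁ a
      by j _ (yes (inj₂ (inj₂ a))) = inj₂ (inj₁ a)
      by j (inj₁ tx) (no ¬am) with refl ← unique (inj₁ tx , ¬am) (inj₂ (inj₂ t₀) , ¬am₀) =
        ⊥-elim (not-two ¬am (inj₂ (inj₁ refl)) endsxz (tx , t₀))
      by j (inj₂ ty) (no ¬am) with refl ← unique (inj₂ (inj₁ ty) , ¬am) (inj₂ (inj₂ t₀) , ¬am₀) =
        ⊥-elim (not-two ¬am (inj₂ (inj₂ refl)) endsyz (ty , t₀))
    ... | no ¬y | no ¬z = T , λ j touch → by j touch (among? j)
      where
      by : ∀ j → Touches j y ⊎ Touches j z → Dec (Among j) → Among j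
      by j _         (yes am) = am
      by j (inj₁ ty) (no ¬am) = ⊥-elim (¬y (j , ty , ¬am))
      by j (inj₂ tz) (no ¬am) = ⊥-elim (¬z (j , tz , ¬am))

  record Square : Set where
    field
      x y w z         : Fin P
      exy eyw ewz exz : Fin m
      endsxy          : Ends exy x y
      endsyw          : Ends eyw y w
      endswz          : Ends ewz w z
      endsxz          : Ends exz x z
      x≢w             : x ≢ w
      y≢z             : y ≢ z
      isolated        : ∀ j → Touches j y ⊎ Touches j w ⊎ Touches j z →
                        j ≡ exy ⊎ j ≡ eyw ⊎ j ≡ ewz ⊎ j ≡ exz

  module Obstructed (q s : ℕ) (GV GE : Set) (gi : GE → Fin s ⊎ GV → Set) (D : Drawing.Drawn F q s GV GE gi) where
    open Drawing F q s GV GE gi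
    open Drawn D
    open Embed D

    coloured : ∀ {l u j} → InGroup l u → Touches j u → ∃ λ c → et j ≡ grp l c
    coloured {l} {u} {j} (x , r) touch = go touch
      where
      by : ∀ {r t} → r ≡ gp l x → Ok r t → ∃ λ c → t ≡ grp l c
      by refl gg = _ , refl
      go : Touches j u → ∃ λ c → et j ≡ grp l c
      go (inj₁ refl) = by r (okˡ j)
      go (inj₂ refl) = by r (okʳ j)

    same-colour : ∀ {l i j c} → et i ≡ grp l c → et j ≡ grp l c → i ≡ j
    same-colour ei ej = et-inj (trans ei (sym ej)) λ eq → case trans (sym ei) eq of λ ()

    -- Besides the colours in use on the obstructing cycle, an outer edge needs a further colour of its own.
    outer-colour : ∀ {l u i j} → et i ≡ grp l nothing → InGroup l u → Touches j u → j ≢ i → ∃ λ c → et j ≡ grp l (just c)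
    outer-colour last u∈ touch j≢i with coloured u∈ touch
    ... | nothing , eq = ⊥-elim (j≢i (same-colour eq last))
    ... | just c  , eq = c , eq

    colour≢ : ∀ {l i j c d} → et i ≡ grp l (just c) → et j ≡ grp l (just d) → i ≢ j → c ≢ d
    colour≢ ei ej i≢j refl = i≢j (same-colour ei ej)

    Result : Set
    Result = (2 ≤ s × Σ Triangle Triangle.Pendant × (s ≡ 2 → Σ Triangle Triangle.Isolated)) ⊎ (3 ≤ s × Square)

    -- Edges at one group have distinct colours among the `s` old ones and the last. A triangle
    -- takes two old colours, which for `s ≤ 3` leaves room for one outer edge and for `s = 2` for
    -- none; a 4-cycle takes three and leaves none.
    obstructed : s ≤ 3 → ∀ {l} → Obstruction l → Result
    obstructed s≤3 {l} record { i = i ; last = last ; x∈ = x∈ ; y∈ = y∈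
      ; path = inj₁ (z , (j₁ , (c₁ , e₁) , ends₁ , _ , z∈) , (j₂ , (c₂ , e₂) , ends₂ , _ , _)) } =
      inj₁ (unique-length ((c₁≢c₂ ∷ []) ∷ [] ∷ []) , apex T unique , λ { refl → T , (λ j t → iso refl j (inj₂ t)) , λ j t → iso refl j (inj₁ t) })
      where
      T : Triangle
      T = record { x = src i ; y = tgt i ; z = z ; exy = i ; exz = j₁ ; eyz = j₂
                 ; endsxy = inj₁ (refl , refl) ; endsxz = ends₁ ; endsyz = Ends-swap ends₂ }
      open Triangle T using (Outer; Among; among?)
      c₁≢c₂ : c₁ ≢ c₂
      c₁≢c₂ = colour≢ e₁ e₂ λ { refl → src≢tgt i (Ends-cancel (Ends-swap ends₁) ends₂) }
      further : ∀ {j} → Outer j → ∃ λ c → et j ≡ grp l (just c) × c₁ ≢ c × c₂ ≢ c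
      further {j} (touch , ¬am) = extend (at touch)
        where
        at : Touches j (src i) ⊎ Touches j (tgt i) ⊎ Touches j z → ∃ λ c → et j ≡ grp l (just c)
        at (inj₁ t)        = outer-colour last x∈ t λ eq → ¬am (inj₁ eq)
        at (inj₂ (inj₁ t)) = outer-colour last y∈ t λ eq → ¬am (inj₁ eq)
        at (inj₂ (inj₂ t)) = outer-colour last z∈ t λ eq → ¬am (inj₁ eq)
        extend : (∃ λ c → et j ≡ grp l (just c)) → ∃ λ c → et j ≡ grp l (just c) × c₁ ≢ c × c₂ ≢ c
        extend (c , eq) = c , eq , colour≢ e₁ eq (λ eq → ¬am (inj₂ (inj₁ (sym eq)))) , colour≢ e₂ eq (λ eq → ¬am (inj₂ (inj₂ (sym eq))))
      unique : ∀ {a b} → Outer a → Outer b → a ≡ b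
      unique {a} {b} oa ob with further oa | further ob | a Finₚ.≟ b
      ... | _ | _ | yes eq = eq
      -- Two outer edges would bring the number of old colours on the group to four.
      ... | c , ea , n₁ , n₂ | d , eb , n₃ , n₄ | no a≢b = ⊥-elim (ℕₚ.<⇒≱ (s≤s s≤3)
        (unique-length ((c₁≢c₂ ∷ n₁ ∷ n₃ ∷ []) ∷ (n₂ ∷ n₄ ∷ []) ∷ (colour≢ ea eb a≢b ∷ []) ∷ [] ∷ [])))
      iso : s ≡ 2 → ∀ j → Touches j (src i) ⊎ Touches j (tgt i) ⊎ Touches j z → Among j
      iso refl j touch with among? j
      ... | yes am = am
      ... | no ¬am with c , _ , n₁ , n₂ ← further (touch , ¬am) =
        ⊥-elim (ℕₚ.<⇒≱ ℕₚ.≤-refl (unique-length ((c₁≢c₂ ∷ n₁ ∷ []) ∷ (n₂ ∷ []) ∷ [] ∷ [])))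
    obstructed s≤3 {l} record { i = i ; last = last ; x∈ = x∈ ; y∈ = y∈
      ; path = inj₂ (z , w , (j₁ , (c₁ , e₁) , ends₁ , _ , z∈) , (j₂ , (c₂ , e₂) , ends₂ , _ , w∈) , (j₃ , (c₃ , e₃) , ends₃ , _ , _)) } =
      inj₂ (unique-length colours , record
        { x = src i ; y = tgt i ; w = w ; z = z ; exy = i ; eyw = j₃ ; ewz = j₂ ; exz = j₁
        ; endsxy = inj₁ (refl , refl) ; endsyw = Ends-swap ends₃ ; endswz = Ends-swap ends₂ ; endsxz = ends₁
        ; x≢w = x≢w ; y≢z = y≢z ; isolated = isolated })
      where
      not-last : ∀ {j c} → et j ≡ grp l (just c) → ¬ Ends j (src i) (tgt i)
      not-last {j} ej ends with refl ← edge-unique {i} {j} (inj₁ (refl , refl)) ends with () ← trans (sym last) ej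
      x≢w : src i ≢ w
      x≢w refl = not-last e₃ ends₃
      y≢z : tgt i ≢ z
      y≢z refl = not-last e₁ ends₁
      colours : Unique (c₁ ∷ c₂ ∷ c₃ ∷ [])
      colours = (colour≢ e₁ e₂ (λ { refl → x≢w (Ends-cancel (Ends-swap ends₁) ends₂) })
                 ∷ colour≢ e₁ e₃ (λ { refl → case touches (ends⇒touchesˡ (Ends-swap ends₃)) ends₁ of λ
                     { (inj₁ eq) → src≢tgt i (sym eq) ; (inj₂ eq) → y≢z eq } }) ∷ [])
              ∷ (colour≢ e₂ e₃ (λ { refl → y≢z (sym (Ends-cancel (Ends-swap ends₂) ends₃)) }) ∷ []) ∷ [] ∷ []
        where
        touches : ∀ {j u v w} → Touches j w → Ends j u v → w ≡ u ⊎ w ≡ v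
        touches (inj₁ a) (inj₁ (b , c)) = inj₁ (trans (sym a) b)
        touches (inj₁ a) (inj₂ (b , c)) = inj₂ (trans (sym a) b)
        touches (inj₂ a) (inj₁ (b , c)) = inj₂ (trans (sym a) c)
        touches (inj₂ a) (inj₂ (b , c)) = inj₁ (trans (sym a) c)
      isolated : ∀ j → Touches j (tgt i) ⊎ Touches j w ⊎ Touches j z → j ≡ i ⊎ j ≡ j₃ ⊎ j ≡ j₂ ⊎ j ≡ j₁
      isolated j touch with j Finₚ.≟ i | j Finₚ.≟ j₃ | j Finₚ.≟ j₂ | j Finₚ.≟ j₁
      ... | yes eq | _ | _ | _ = inj₁ eq
      ... | _ | yes eq | _ | _ = inj₂ (inj₁ eq)
      ... | _ | _ | yes eq | _ = inj₂ (inj₂ (inj₁ eq))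
      ... | _ | _ | _ | yes eq = inj₂ (inj₂ (inj₂ eq))
      ... | no n | no n₃ | no n₂ | no n₁ = ⊥-elim (impossible (at touch))
        where
        at : Touches j (tgt i) ⊎ Touches j w ⊎ Touches j z → ∃ λ c → et j ≡ grp l (just c)
        at (inj₁ t)        = outer-colour last y∈ t n
        at (inj₂ (inj₁ t)) = outer-colour last w∈ t n
        at (inj₂ (inj₂ t)) = outer-colour last z∈ t n
        impossible : ¬ (∃ λ c → et j ≡ grp l (just c))
        impossible (c , eq) = ℕₚ.<⇒≱ (s≤s s≤3) (unique-length
          ((colour≢ eq e₁ n₁ ∷ colour≢ eq e₂ n₂ ∷ colour≢ eq e₃ n₃ ∷ []) ∷ colours))

-- Drawings from prescribed positions

IsJust : ∀ {A : Set} → Maybe A → Set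
IsJust m = ∃ λ a → m ≡ just a

isJust⊎nothing : ∀ {A : Set} (m : Maybe A) → IsJust m ⊎ m ≡ nothing
isJust⊎nothing (just a) = inj₁ (a , refl)
isJust⊎nothing nothing  = inj₂ refl

just≢nothing : ∀ {A : Set} {m : Maybe A} {a} → m ≡ just a → m ≢ nothing
just≢nothing refl ()

Fits : ∀ {s} {GV GE : Set} → (GE → Fin s ⊎ GV → Set) → Maybe (Fin s) ⊎ GV → GE → Set
Fits gi (inj₁ (just a)) t = gi t (inj₁ a)
Fits gi (inj₁ nothing)  t = ⊥
Fits gi (inj₂ g)        t = gi t (inj₂ g)

-- Prescribed spots `sr a` (a core vertex, or a vertex of the extra piece) for finitely many special vertices `sp a`.
record Spots (F : Graph) (s : ℕ) (GV GE : Set) (gi : GE → Fin s ⊎ GV → Set) : Set where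
  open Graphs F
  field
    #sp #ge   : ℕ
    sp        : Fin #sp → Fin P
    sp-inj    : ∀ {a b} → sp a ≡ sp b → a ≡ b
    sr        : Fin #sp → Maybe (Fin s) ⊎ GV
    sr-inj    : ∀ {a b} → sr a ≡ sr b → a ≡ b
    gedge     : Fin #ge → Fin m
    tag       : Fin #ge → GE
    tag-inj   : ∀ {a b} → tag a ≡ tag b → a ≡ b
    endˡ endʳ : Fin #ge → Fin #sp
    gends     : ∀ a → Ends (gedge a) (sp (endˡ a)) (sp (endʳ a))
    fitˡ      : ∀ a → Fits gi (sr (endˡ a)) (tag a)
    fitʳ      : ∀ a → Fits gi (sr (endʳ a)) (tag a)
    closed    : ∀ j {a g} → sr a ≡ inj₂ g → Touches j (sp a) → ∃ λ b → gedge b ≡ j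

-- The non-special vertices in the domain of `base` go to the core, the free ones to the groups `rlab`.
record Layout (F : Graph) (q s : ℕ) (GV GE : Set) (gi : GE → Fin s ⊎ GV → Set) : Set where
  open Graphs F
  field
    spots : Spots F s GV GE gi
  open Spots spots public
  field
    base     : Fin P → Maybe (Maybe (Fin s))
    base-inj : ∀ {u v c} → base u ≡ just c → base v ≡ just c → u ≡ v
    avoid    : ∀ {u c} a → base u ≡ just c → sr a ≢ inj₁ c
    rlab     : Fin P → Fin P
    rpos     : Fin P → Fin q
    ic       : Maybe (Fin s)

  Free : Fin P → Set
  Free u = (∀ a → sp a ≢ u) × base u ≡ nothing

  Inside : Fin m → Set
  Inside j = Free (src j) × Free (tgt j) × rlab (src j) ≡ rlab (tgt j)

  field
    cover      : ∀ j → (∃ λ w → Touches j w × ((∃ λ a → sp a ≡ w) ⊎ IsJust (base w))) ⊎ Inside j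
    r-inj      : ∀ {u v} → Free u → Free v → rlab u ≡ rlab v → rpos u ≡ rpos v → u ≡ v
    -- Only one vertex of a group may have edges to the core, so two edges to the same core vertex
    -- never claim the same hyperedge.
    spoke-inj  : ∀ {i j u v u′ v′} → Ends i u v → ¬ Free u → Free v → Ends j u′ v′ → ¬ Free u′ → Free v′ → rlab v ≡ rlab v′ → v ≡ v′
    inside-inj : ∀ {i j} → Inside i → Inside j → rlab (src i) ≡ rlab (src j) → i ≡ j
    mixed      : ∀ {i j u v} → Inside i → Ends j u v → Free v → rlab (src i) ≡ rlab v →
                 base u ≢ just ic × (∀ a → sp a ≢ u)
    ic-old     : ∀ {i} → Inside i → ic ≢ nothing

module FromLayout {F : Graph} {q s : ℕ} {GV GE : Set} {gi : GE → Fin s ⊎ GV → Set} (L : Layout F q s GV GE gi) where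
  open Graphs F
  open Cycles F using (touches⇒ends)
  open Drawing F q s GV GE gi
  open Layout L

  special? : ∀ u → Dec (∃ λ a → sp a ≡ u)
  special? u = any? λ a → sp a Finₚ.≟ u

  place : Maybe (Fin s) ⊎ GV → Role
  place (inj₁ c) = cr c
  place (inj₂ g) = gd g

  ordinary : Fin P → Maybe (Maybe (Fin s)) → Role
  ordinary u (just c) = cr c
  ordinary u nothing  = gp (rlab u) (rpos u)

  roleD : ∀ u → Dec (∃ λ a → sp a ≡ u) → Role
  roleD u (yes (a , _)) = place (sr a)
  roleD u (no _)        = ordinary u (base u)

  role : Fin P → Role
  role u = roleD u (special? u)

  data View (u : Fin P) : Role → Set where
    special : ∀ a → sp a ≡ u → View u (place (sr a))
    based   : ∀ c → (∀ a → sp a ≢ u) → base u ≡ just c → View u (cr c)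
    free    : Free u → View u (gp (rlab u) (rpos u))

  view : ∀ u → View u (role u)
  view u with special? u
  ... | yes (a , eq) = special a eq
  ... | no ¬sp with base u in b
  ...   | just c  = based c (λ a eq → ¬sp (a , eq)) b
  ...   | nothing = free ((λ a eq → ¬sp (a , eq)) , b)

  role-special : ∀ a → role (sp a) ≡ place (sr a)
  role-special a with special? (sp a)
  ... | yes (b , eq) = cong (place ∘ sr) (sp-inj eq)
  ... | no ¬sp       = ⊥-elim (¬sp (a , refl))

  role-free : ∀ {u} → Free u → role u ≡ gp (rlab u) (rpos u)
  role-free {u} (¬sp , b) with special? u
  ... | yes (a , eq) = ⊥-elim (¬sp a eq)
  ... | no _ rewrite b = refl

  place-inj : ∀ {x y} → place x ≡ place y → x ≡ y
  place-inj {inj₁ _} {inj₁ _} refl = refl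
  place-inj {inj₂ _} {inj₂ _} refl = refl

  place-cr : ∀ {x c} → place x ≡ cr c → x ≡ inj₁ c
  place-cr {inj₁ _} refl = refl

  place≢gp : ∀ {x l y} → place x ≢ gp l y
  place≢gp {inj₁ _} ()
  place≢gp {inj₂ _} ()

  gp-inj : ∀ {l l′ x y} → gp l x ≡ gp l′ y → l ≡ l′ × x ≡ y
  gp-inj refl = refl , refl

  view-inj : ∀ {u v r r′} → View u r → View v r′ → r ≡ r′ → u ≡ v
  view-inj (special a refl) (special b refl) eq = cong sp (sr-inj (place-inj eq))
  view-inj (special a refl) (based c _ b)    eq = ⊥-elim (avoid a b (place-cr eq))
  view-inj (special a refl) (free _)         eq = ⊥-elim (place≢gp eq)
  view-inj (based c _ b) (special a refl)    eq = ⊥-elim (avoid a b (place-cr (sym eq)))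
  view-inj (based c _ b) (based .c _ b′)     refl = base-inj b b′
  view-inj (free _) (special a refl)         eq = ⊥-elim (place≢gp (sym eq))
  view-inj (free f) (free f′)                eq = r-inj f f′ (proj₁ (gp-inj eq)) (proj₂ (gp-inj eq))

  role-inj : ∀ {u v} → role u ≡ role v → u ≡ v
  role-inj {u} {v} = view-inj (view u) (view v)

  -- The tag of an edge together with the evidence from which the edge can be recovered.
  data Back (i : Fin m) : EdgeType → Set where
    cc     : Back i cc
    gt     : ∀ a → gedge a ≡ i → Back i (gt (tag a))
    spoke  : ∀ {u v c} → Ends i u v → role u ≡ cr c → Free v → Back i (grp (rlab v) c)
    inside : Inside i → Back i (grp (rlab (src i)) ic)

  record Info (i : Fin m) : Set where
    field
      t    : EdgeType
      okˡ  : Ok (role (src i)) t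
      okʳ  : Ok (role (tgt i)) t
      back : Back i t

  ok-fit : ∀ {x t} → Fits gi x t → Ok (place x) (gt t)
  ok-fit {inj₁ (just _)} p = tc p
  ok-fit {inj₂ _}        p = tg p

  ok-special : ∀ {u t} a → sp a ≡ u → Fits gi (sr a) t → Ok (role u) (gt t)
  ok-special a refl fit = subst (λ r → Ok r _) (sym (role-special a)) (ok-fit fit)

  infoD : ∀ i → Dec (∃ λ a → gedge a ≡ i) → Info i
  infoD i (yes (a , refl)) with gends a
  ... | inj₁ (l , r) = record { t = gt (tag a) ; okˡ = ok-special _ (sym l) (fitˡ a) ; okʳ = ok-special _ (sym r) (fitʳ a) ; back = gt a refl }
  ... | inj₂ (l , r) = record { t = gt (tag a) ; okˡ = ok-special _ (sym l) (fitʳ a) ; okʳ = ok-special _ (sym r) (fitˡ a) ; back = gt a refl }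
  infoD i (no ¬ge) with cover i
  ... | inj₂ ins@(fs , ft , eq) = record
    { t = grp (rlab (src i)) ic
    ; okˡ = subst (λ r → Ok r (grp (rlab (src i)) ic)) (sym (role-free fs)) gg
    ; okʳ = subst (λ r → Ok r (grp (rlab (src i)) ic)) (sym (role-free ft)) (subst (λ l → Ok (gp (rlab (tgt i)) (rpos (tgt i))) (grp l ic)) (sym eq) gg)
    ; back = inside ins }
  ... | inj₁ (w , touch , cov) = by (src i) (tgt i) (view (src i)) (view (tgt i)) refl refl refl refl
    where
    no-gadget : ∀ {u} a {g} → sr a ≡ inj₂ g → sp a ≡ u → ¬ Touches i u
    no-gadget a eq refl t = ¬ge (closed i eq t)
    core-at : ∀ {u} a → sp a ≡ u → Touches i u → ∃ λ c → place (sr a) ≡ cr c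
    core-at a eq t with sr a in s≡
    ... | inj₁ c = c , refl
    ... | inj₂ g = ⊥-elim (no-gadget a s≡ eq t)
    core-view : ∀ {u r} → View u r → Touches i u → (∃ λ c → r ≡ cr c) ⊎ Free u
    core-view (special a eq) t = inj₁ (core-at a eq t)
    core-view (based c _ _)  t = inj₁ (c , refl)
    core-view (free f)       t = inj₂ f
    not-free : Touches i w → ¬ Free w
    not-free _ (¬sp , b) = [ (λ (a , eq) → ¬sp a eq) , (λ (_ , eq) → just≢nothing eq b) ]′ cov
    by : ∀ u v {r r′} → View u r → View v r′ → src i ≡ u → tgt i ≡ v → role u ≡ r → role v ≡ r′ → Info i
    by u v vu vv refl refl ru rv with core-view vu (inj₁ refl) | core-view vv (inj₂ refl)
    ... | inj₁ (c , refl) | inj₁ (d , refl) = record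
      { t = cc ; okˡ = subst (λ r → Ok r cc) (sym ru) cc ; okʳ = subst (λ r → Ok r cc) (sym rv) cc ; back = cc }
    ... | inj₁ (c , refl) | inj₂ f = record
      { t = grp (rlab v) c ; okˡ = subst (λ r → Ok r (grp (rlab v) c)) (sym ru) gc
      ; okʳ = subst (λ r → Ok r (grp (rlab v) c)) (sym (role-free f)) gg ; back = spoke (inj₁ (refl , refl)) ru f }
    ... | inj₂ f | inj₁ (c , refl) = record
      { t = grp (rlab u) c ; okˡ = subst (λ r → Ok r (grp (rlab u) c)) (sym (role-free f)) gg
      ; okʳ = subst (λ r → Ok r (grp (rlab u) c)) (sym rv) gc ; back = spoke (inj₂ (refl , refl)) rv f }
    ... | inj₂ f | inj₂ f′ = ⊥-elim (none touch)
      where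
      none : ¬ Touches i w
      none (inj₁ refl) = not-free (inj₁ refl) f
      none (inj₂ refl) = not-free (inj₂ refl) f′

  info : ∀ i → Info i
  info i = infoD i (any? λ a → gedge a Finₚ.≟ i)

  grp-inj : ∀ {l l′ c c′} → grp l c ≡ grp l′ c′ → l ≡ l′ × c ≡ c′
  grp-inj refl = refl , refl

  gt-inj : ∀ {t t′} → EdgeType.gt t ≡ gt t′ → t ≡ t′
  gt-inj refl = refl

  cr⇒¬free : ∀ {u c} → role u ≡ cr c → ¬ Free u
  cr⇒¬free eq f = case trans (sym eq) (role-free f) of λ ()

  mixed′ : ∀ {i j u v} → Inside i → Ends j u v → role u ≡ cr ic → Free v → rlab (src i) ≢ rlab v
  mixed′ {u = u} ins ends ru f eq = go (view u) ru
    where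
    go : ∀ {r} → View u r → r ≡ cr ic → ⊥
    go (special a s≡) _  = proj₂ (mixed ins ends f eq) a s≡
    go (based c _ b) refl = proj₁ (mixed ins ends f eq) b

  back-inj : ∀ {i j t t′} → Back i t → Back j t′ → t ≡ t′ → t ≢ cc → i ≡ j
  back-inj cc             _              _  ≢cc = ⊥-elim (≢cc refl)
  back-inj (gt a refl)    (gt b refl)    eq _   = cong gedge (tag-inj (gt-inj eq))
  back-inj (spoke e ru f) (spoke e′ ru′ f′) eq _ with l , refl ← grp-inj eq
    with refl ← spoke-inj e (cr⇒¬free ru) f e′ (cr⇒¬free ru′) f′ l
    with refl ← role-inj (trans ru (sym ru′)) = edge-unique e e′
  back-inj (inside a)     (inside b)     eq _   = inside-inj a b (proj₁ (grp-inj eq))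
  back-inj (inside a)     (spoke e ru f) eq _   with l , refl ← grp-inj eq = ⊥-elim (mixed′ a e ru f l)
  back-inj (spoke e ru f) (inside b)     eq _   with l , refl ← grp-inj eq = ⊥-elim (mixed′ b e ru f (sym l))

  drawn : Drawn
  drawn = record
    { role = role ; et = λ i → Info.t (info i) ; role-inj = role-inj
    ; et-inj = λ {i} {j} → back-inj (Info.back (info i)) (Info.back (info j))
    ; okˡ = λ i → Info.okˡ (info i) ; okʳ = λ i → Info.okʳ (info i) }

  -- An obstruction needs an edge of last colour with both ends in a group, but edges inside groups
  -- carry the old colour `ic`, and all others at a group end in the core.
  unobstructed : ¬ ∃ (Embed.Obstruction drawn)
  unobstructed (l , record { i = i ; last = last ; x∈ = _ , rx ; y∈ = _ , ry }) = go (Info.back (info i)) last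
    where
    go : ∀ {t} → Back i t → t ≡ grp l nothing → ⊥
    go (inside ins) eq = ic-old ins (proj₂ (grp-inj eq))
    go (spoke (inj₁ (refl , refl)) ru _) _ = case trans (sym ru) rx of λ ()
    go (spoke (inj₂ (refl , refl)) ru _) _ = case trans (sym ru) ry of λ ()

-- Partial numberings and vertex covers

record Partial (A : Set) (N : ℕ) : Set where
  field
    at     : A → Maybe (Fin N)
    at-inj : ∀ {u v i} → at u ≡ just i → at v ≡ just i → u ≡ v

module _ {A : Set} where
  open Partial

  -- Taking `h` out of the domain frees its number; `punchOut` closes the gap, so one number fewer
  -- suffices for the rest.
  drop : ∀ {N} (f : Partial A (suc N)) {h i} → at f h ≡ just i →
         Σ (Partial A N) λ g → (∀ {u} → u ≢ h → IsJust (at f u) → IsJust (at g u)) × (∀ {u} → IsJust (at g u) → IsJust (at f u))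
  drop {N} f {h} {i} hi = record { at = remove ∘ at f ; at-inj = λ {u} {v} → inj (at f u) (at f v) refl refl }
    , (λ {u} u≢h (j , eq) → subst (IsJust ∘ remove) (sym eq) (kept λ { refl → u≢h (at-inj f eq hi) }))
    , (λ {u} → was (at f u))
    where
    remove : Maybe (Fin (suc N)) → Maybe (Fin N)
    remove nothing  = nothing
    remove (just j) with i Finₚ.≟ j
    ... | yes _  = nothing
    ... | no i≢j = just (punchOut i≢j)
    kept : ∀ {j} → i ≢ j → IsJust (remove (just j))
    kept {j} i≢j with i Finₚ.≟ j
    ... | yes eq = ⊥-elim (i≢j eq)
    ... | no _   = _ , refl
    was : ∀ m → IsJust (remove m) → IsJust m
    was (just j) _ = j , refl
    inj : ∀ {u v c} a b → at f u ≡ a → at f v ≡ b → remove a ≡ just c → remove b ≡ just c → u ≡ v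
    inj (just a) (just b) fu fv ra rb with i Finₚ.≟ a | i Finₚ.≟ b
    inj (just a) (just b) fu fv refl rb | no i≢a | no i≢b =
      at-inj f fu (trans fv (cong just (Finₚ.punchOut-injective i≢b i≢a (just-injective rb))))

  drop₂ : ∀ {N} (f : Partial A (suc (suc N))) {h h′} → h ≢ h′ → IsJust (at f h) → IsJust (at f h′) →
          Σ (Partial A N) λ g → (∀ {u} → u ≢ h → u ≢ h′ → IsJust (at f u) → IsJust (at g u)) × (∀ {u} → IsJust (at g u) → IsJust (at f u))
  drop₂ f h≢h′ (i , hi) hj with g , keep , was ← drop f hi
    with j , hj′ ← keep (h≢h′ ∘ sym) hj with g′ , keep′ , was′ ← drop g hj′ =
    g′ , (λ u≢h u≢h′ fu → keep′ u≢h′ (keep u≢h fu)) , (λ gu → was (was′ gu))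

  widen : ∀ {N M} → N ≤ M → Partial A N → Partial A M
  widen N≤M f = record
    { at = Data.Maybe.map (λ i → Data.Fin.inject≤ i N≤M) ∘ at f
    ; at-inj = λ {u} {v} → inj (at f u) (at f v) refl refl }
    where
    inj : ∀ {u v c} a b → at f u ≡ a → at f v ≡ b → Data.Maybe.map (λ i → Data.Fin.inject≤ i N≤M) a ≡ just c →
          Data.Maybe.map (λ i → Data.Fin.inject≤ i N≤M) b ≡ just c → u ≡ v
    inj (just a) (just b) fu fv refl eb =
      at-inj f fu (trans fv (cong just (Finₚ.inject≤-injective N≤M N≤M b a (just-injective eb))))

-- A cover by at most `N` vertices. It is numbered rather than listed because the numbers later
-- become places in the core.
record Cover (F : Graph) (N : ℕ) : Set where
  open Graphs F
  field
    part   : Partial (Fin P) N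
  open Partial part public
  field
    covers : ∀ i → ∃ λ w → Touches i w × IsJust (at w)

widen-cover : ∀ {F N M} → N ≤ M → Cover F N → Cover F M
widen-cover N≤M C = record
  { part = widen N≤M part
  ; covers = λ i → case covers i of λ { (w , t , j , eq) → w , t , _ , cong (Data.Maybe.map _) eq } }
  where open Cover C

newest : ∀ {s} → Fin (suc s) → Maybe (Fin s)
newest zero    = nothing
newest (suc i) = just i

newest-inj : ∀ {s} {i j : Fin (suc s)} → newest i ≡ newest j → i ≡ j
newest-inj {i = zero}  {zero}  _    = refl
newest-inj {i = suc _} {suc _} refl = refl

-- Fills the core except for old vertex `zero`, which is kept for a corner of the exceptional cycle.
sparing : ∀ {s} → Fin (suc s) → Maybe (Fin (suc s))
sparing zero    = nothing
sparing (suc i) = just (suc i)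

sparing-inj : ∀ {s} {i j : Fin (suc s)} → sparing i ≡ sparing j → i ≡ j
sparing-inj {i = zero}  {zero}  _    = refl
sparing-inj {i = suc _} {suc _} refl = refl

sparing≢ : ∀ {s} (i : Fin (suc s)) → sparing i ≢ just zero
sparing≢ zero    ()
sparing≢ (suc i) ()

module Instances (F : Graph) {q s : ℕ} {GV GE : Set} {gi : GE → Fin s ⊎ GV → Set} where
  open Graphs F
  open Drawing F q s GV GE gi using (Drawn; module Embed)

  Good : Set
  Good = Σ Drawn λ D → ¬ ∃ (Embed.Obstruction D)

  good : Layout F q s GV GE gi → Good
  good L = FromLayout.drawn L , FromLayout.unobstructed L

  module _ (S : Spots F s GV GE gi) {N : ℕ} (colour : Fin N → Maybe (Fin s)) (colour-inj : ∀ {i j} → colour i ≡ colour j → i ≡ j)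
           (avoids : ∀ a {j} → Spots.sr S a ≢ inj₁ (colour j)) (f : Partial (Fin P) N) where
    open Spots S
    open Partial f

    baseOf : Fin P → Maybe (Maybe (Fin s))
    baseOf = Data.Maybe.map colour ∘ at

    baseOf-just : ∀ {u c} → baseOf u ≡ just c → ∃ λ j → at u ≡ just j × c ≡ colour j
    baseOf-just {u} eq with at u
    baseOf-just refl | just j = j , refl , refl

    baseOf-inj : ∀ {u v c} → baseOf u ≡ just c → baseOf v ≡ just c → u ≡ v
    baseOf-inj {u} {v} eu ev with i , fu , refl ← baseOf-just {u} eu | j , fv , cj ← baseOf-just {v} ev
      with refl ← colour-inj cj = at-inj fu fv

    baseOf-avoid : ∀ {u c} a → baseOf u ≡ just c → sr a ≢ inj₁ c
    baseOf-avoid {u} a eu sa with j , _ , refl ← baseOf-just {u} eu = avoids a sa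

    isJust-base : ∀ {u} → IsJust (at u) → IsJust (baseOf u)
    isJust-base (j , eq) = colour j , cong (Data.Maybe.map colour) eq

    -- Every vertex that is neither special nor numbered is a group of its own, so no edge lies
    -- inside a group.
    singletons : Fin q → (∀ j → ∃ λ w → Touches j w × ((∃ λ a → sp a ≡ w) ⊎ IsJust (at w))) → Layout F q s GV GE gi
    singletons x₀ covers = record
      { spots = S ; base = baseOf ; base-inj = baseOf-inj ; avoid = λ {u} → baseOf-avoid {u} ; rlab = id ; rpos = λ _ → x₀ ; ic = nothing
      ; cover = inj₁ ∘ covered
      ; r-inj = λ _ _ eq _ → eq
      ; spoke-inj = λ _ _ _ _ _ _ eq → eq
      ; inside-inj = λ {i} ins _ → ⊥-elim (none i ins)
      ; mixed = λ {i} ins → ⊥-elim (none i ins)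
      ; ic-old = λ {i} ins → ⊥-elim (none i ins) }
      where
      covered : ∀ j → ∃ λ w → Touches j w × ((∃ λ a → sp a ≡ w) ⊎ IsJust (baseOf w))
      covered j with w , t , c ← covers j = w , t , Data.Sum.map₂ isJust-base c
      none : ∀ i → ((∀ a → sp a ≢ src i) × baseOf (src i) ≡ nothing) × ((∀ a → sp a ≢ tgt i) × baseOf (tgt i) ≡ nothing) × src i ≡ tgt i → ⊥
      none i (_ , _ , eq) = src≢tgt i eq

  -- Two vertices of the cover are special and already have their spots, so `N` places are enough
  -- for the others.
  cover-two-spots : (S : Spots F s GV GE gi) → ∀ {N} (colour : Fin N → Maybe (Fin s)) → (∀ {i j} → colour i ≡ colour j → i ≡ j) →
    (∀ a {j} → Spots.sr S a ≢ inj₁ (colour j)) → (C : Cover F (suc (suc N))) →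
    ∀ {a b} → a ≢ b → IsJust (Cover.at C (Spots.sp S a)) → IsJust (Cover.at C (Spots.sp S b)) → Fin q → Layout F q s GV GE gi
  cover-two-spots S colour colour-inj avoids C {a} {b} a≢b ja jb x₀
    with g , keep , _ ← drop₂ (Cover.part C) (a≢b ∘ Spots.sp-inj S) ja jb =
    singletons S colour colour-inj avoids g x₀ covers
    where
    covers : ∀ j → ∃ λ w → Touches j w × ((∃ λ a → Spots.sp S a ≡ w) ⊎ IsJust (Partial.at g w))
    covers j with w , t , cw ← Cover.covers C j with any? (λ c → Spots.sp S c Finₚ.≟ w)
    ... | yes sp = w , t , inj₁ sp
    ... | no ¬sp = w , t , inj₂ (keep (λ eq → ¬sp (a , sym eq)) (λ eq → ¬sp (b , sym eq)) cw)

-- Layouts for covers, triangles and 4-cycles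

module _ (F : Graph) where
  open Graphs F
  open Cycles F

  no-spots : ∀ {s} → Spots F s ⊥ ⊥ noGI
  no-spots = record
    { #sp = 0 ; #ge = 0 ; sp = λ () ; sp-inj = λ { {()} } ; sr = λ () ; sr-inj = λ { {()} } ; gedge = λ () ; tag = λ ()
    ; tag-inj = λ { {()} } ; endˡ = λ () ; endʳ = λ () ; gends = λ () ; fitˡ = λ () ; fitʳ = λ () ; closed = λ { _ {()} } }

  cover-layout : ∀ {q s} → Fin q → Cover F (suc s) → Layout F q s ⊥ ⊥ noGI
  cover-layout x₀ C = Instances.singletons F no-spots newest newest-inj (λ ()) (Cover.part C) x₀
    λ j → case Cover.covers C j of λ { (w , t , c) → w , t , inj₂ c }

  corners : Triangle → Fin 3 → Fin P
  corners T = lookup (Triangle.x T ∷ Triangle.y T ∷ Triangle.z T ∷ [])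

  corners-inj : ∀ T {a b} → corners T a ≡ corners T b → a ≡ b
  corners-inj T = lookup-injective ((Ends-≢ endsxy ∷ Ends-≢ endsxz ∷ []) ∷ (Ends-≢ endsyz ∷ []) ∷ [] ∷ [])
    where open Triangle T

  edgesOf : Triangle → Fin 3 → Fin m
  edgesOf T zero             = Triangle.eyz T
  edgesOf T (suc zero)       = Triangle.exz T
  edgesOf T (suc (suc zero)) = Triangle.exy T

  -- Edge number a of a triangle is the one opposite to corner a.
  fst₃ snd₃ : Fin 3 → Fin 3
  fst₃ zero             = suc zero
  fst₃ (suc _)          = zero
  snd₃ zero             = suc (suc zero)
  snd₃ (suc zero)       = suc (suc zero)
  snd₃ (suc (suc zero)) = suc zero

  edgesOf-ends : ∀ T a → Ends (edgesOf T a) (corners T (fst₃ a)) (corners T (snd₃ a))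
  edgesOf-ends T zero             = Triangle.endsyz T
  edgesOf-ends T (suc zero)       = Triangle.endsxz T
  edgesOf-ends T (suc (suc zero)) = Triangle.endsxy T

  among⇒edgesOf : ∀ T {j} → Triangle.Among T j → ∃ λ b → edgesOf T b ≡ j
  among⇒edgesOf T (inj₁ eq)        = suc (suc zero) , sym eq
  among⇒edgesOf T (inj₂ (inj₁ eq)) = suc zero , sym eq
  among⇒edgesOf T (inj₂ (inj₂ eq)) = zero , sym eq

  two-of-three : {Q : Fin 3 → Set} → (∀ a → Q (fst₃ a) ⊎ Q (snd₃ a)) → ∃ λ a → ∃ λ b → a ≢ b × Q a × Q b
  two-of-three {Q} e with e (suc (suc zero)) | e (suc zero) | e zero
  ... | inj₁ x | _      | inj₁ y = zero , suc zero , (λ ()) , x , y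
  ... | inj₁ x | _      | inj₂ z = zero , suc (suc zero) , (λ ()) , x , z
  ... | inj₂ y | inj₁ x | _      = zero , suc zero , (λ ()) , x , y
  ... | inj₂ y | inj₂ z | _      = suc zero , suc (suc zero) , (λ ()) , y , z

  touch-end : ∀ {j u v w} {Q : Fin P → Set} → Ends j u v → Touches j w → Q w → Q u ⊎ Q v
  touch-end {Q = Q} (inj₁ (a , b)) (inj₁ c) q = inj₁ (subst Q (trans (sym c) a) q)
  touch-end {Q = Q} (inj₁ (a , b)) (inj₂ c) q = inj₂ (subst Q (trans (sym c) b) q)
  touch-end {Q = Q} (inj₂ (a , b)) (inj₁ c) q = inj₂ (subst Q (trans (sym c) a) q)
  touch-end {Q = Q} (inj₂ (a , b)) (inj₂ c) q = inj₁ (subst Q (trans (sym c) b) q)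

  cover-edge : ∀ {N j u v} (C : Cover F N) → Ends j u v → IsJust (Cover.at C u) ⊎ IsJust (Cover.at C v)
  cover-edge {j = j} C ends with w , t , c ← Cover.covers C j = touch-end {Q = IsJust ∘ Cover.at C} ends t c

  module _ {s′ q : ℕ} (t₁ t₂ : Fin q) where
    open Gadget (suc s′) q t₁ t₂

    triangle-spots : (T : Triangle) → Triangle.Pendant T → Spots F (suc s′) GV GE GI
    triangle-spots T pendant = record
      { #sp = 3 ; #ge = 3 ; sp = corners T ; sp-inj = corners-inj T
      ; sr = sr ; sr-inj = retract-inj sr⁻ (λ { zero → refl ; (suc zero) → refl ; (suc (suc zero)) → refl })
      ; gedge = edgesOf T ; tag = tag ; tag-inj = retract-inj tag⁻ (λ { zero → refl ; (suc zero) → refl ; (suc (suc zero)) → refl })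
      ; endˡ = fst₃ ; endʳ = snd₃ ; gends = edgesOf-ends T
      ; fitˡ = λ { zero → ml ; (suc zero) → ac ; (suc (suc zero)) → ac }
      ; fitʳ = λ { zero → mr ; (suc zero) → ag ; (suc (suc zero)) → ag }
      ; closed = λ { j {suc zero} _ t → among⇒edgesOf T (pendant j (inj₁ t))
                   ; j {suc (suc zero)} _ t → among⇒edgesOf T (pendant j (inj₂ t)) } }
      where
      sr : Fin 3 → Maybe (Fin (suc s′)) ⊎ GV
      sr zero             = inj₁ (just zero)
      sr (suc zero)       = inj₂ (true , t₁)
      sr (suc (suc zero)) = inj₂ (false , t₂)
      sr⁻ : Maybe (Fin (suc s′)) ⊎ GV → Fin 3
      sr⁻ (inj₁ _)           = zero
      sr⁻ (inj₂ (true , _))  = suc zero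
      sr⁻ (inj₂ (false , _)) = suc (suc zero)
      tag : Fin 3 → GE
      tag zero             = gm
      tag (suc zero)       = ga zero false
      tag (suc (suc zero)) = ga zero true
      tag⁻ : GE → Fin 3
      tag⁻ gm           = zero
      tag⁻ (ga _ false) = suc zero
      tag⁻ (ga _ true)  = suc (suc zero)

    triangle-avoids : ∀ T pen a {j} → Spots.sr (triangle-spots T pen) a ≢ inj₁ (sparing j)
    triangle-avoids T pen zero {j} eq = sparing≢ j (sym (Sumₚ.inj₁-injective eq))
    triangle-avoids T pen (suc zero) ()
    triangle-avoids T pen (suc (suc zero)) ()

    -- A cover contains two corners of the triangle. Its other `s′ + 1` vertices fit on the core
    -- without vertex `zero`, that is, on `s′` old core vertices and the new one.
    triangle-layout : (T : Triangle) → Triangle.Pendant T → Cover F (3 + s′) → Layout F q (suc s′) GV GE GI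
    triangle-layout T pen C with two-of-three {λ a → IsJust (Cover.at C (corners T a))} (λ a → cover-edge C (edgesOf-ends T a))
    ... | a , b , a≢b , ja , jb =
      Instances.cover-two-spots F (triangle-spots T pen) sparing sparing-inj (triangle-avoids T pen) C a≢b ja jb t₁

  module _ {s″ q : ℕ} (t₁ t₂ o : Fin q) (o≢t₂ : o ≢ t₂) (Sq : Square) where
    open Gadget (2 + s″) q t₁ t₂
    open Square Sq

    vs : Fin 4 → Fin P
    vs = lookup (x ∷ y ∷ w ∷ z ∷ [])

    vs-inj : ∀ {a b} → vs a ≡ vs b → a ≡ b
    vs-inj = lookup-injective
      ((Ends-≢ endsxy ∷ x≢w ∷ Ends-≢ endsxz ∷ []) ∷ (Ends-≢ endsyw ∷ y≢z ∷ []) ∷ (Ends-≢ endswz ∷ []) ∷ [] ∷ [])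

    sides : Fin 4 → Fin m
    sides zero                   = exy
    sides (suc zero)             = eyw
    sides (suc (suc zero))       = ewz
    sides (suc (suc (suc zero))) = exz

    -- `w` and `z` share the right group, where colour `zero` carries the side from `z` to `x` and a
    -- second colour the side between `w` and `z`; hence the core size `2 + s″`.
    square-spots : Spots F (2 + s″) GV GE GI
    square-spots = record
      { #sp = 4 ; #ge = 4 ; sp = vs ; sp-inj = vs-inj ; sr = sr ; sr-inj = retract-inj sr⁻ sr⁻-sr ; gedge = sides
      ; tag = tag ; tag-inj = retract-inj tag⁻ (λ { zero → refl ; (suc zero) → refl ; (suc (suc zero)) → refl ; (suc (suc (suc zero))) → refl })
      ; endˡ = λ { zero → zero ; (suc zero) → suc zero ; (suc (suc zero)) → suc (suc zero) ; (suc (suc (suc zero))) → zero }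
      ; endʳ = λ { zero → suc zero ; (suc zero) → suc (suc zero) ; (suc (suc zero)) → suc (suc (suc zero)) ; (suc (suc (suc zero))) → suc (suc (suc zero)) }
      ; gends = λ { zero → endsxy ; (suc zero) → endsyw ; (suc (suc zero)) → endswz ; (suc (suc (suc zero))) → endsxz }
      ; fitˡ = λ { zero → ac ; (suc zero) → ml ; (suc (suc zero)) → ag ; (suc (suc (suc zero))) → ac }
      ; fitʳ = λ { zero → ag ; (suc zero) → mr ; (suc (suc zero)) → ag ; (suc (suc (suc zero))) → ag }
      ; closed = λ { j {suc zero} _ t → side (isolated j (inj₁ t))
                   ; j {suc (suc zero)} _ t → side (isolated j (inj₂ (inj₁ t)))
                   ; j {suc (suc (suc zero))} _ t → side (isolated j (inj₂ (inj₂ t))) } }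
      where
      side : ∀ {j} → j ≡ exy ⊎ j ≡ eyw ⊎ j ≡ ewz ⊎ j ≡ exz → ∃ λ b → sides b ≡ j
      side (inj₁ eq)               = zero , sym eq
      side (inj₂ (inj₁ eq))        = suc zero , sym eq
      side (inj₂ (inj₂ (inj₁ eq))) = suc (suc zero) , sym eq
      side (inj₂ (inj₂ (inj₂ eq))) = suc (suc (suc zero)) , sym eq
      sr : Fin 4 → Maybe (Fin (2 + s″)) ⊎ GV
      sr zero                   = inj₁ (just zero)
      sr (suc zero)             = inj₂ (true , t₁)
      sr (suc (suc zero))       = inj₂ (false , t₂)
      sr (suc (suc (suc zero))) = inj₂ (false , o)
      sr⁻ : Maybe (Fin (2 + s″)) ⊎ GV → Fin 4
      sr⁻ (inj₁ _)           = zero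
      sr⁻ (inj₂ (true , _))  = suc zero
      sr⁻ (inj₂ (false , x)) with x Finₚ.≟ t₂
      ... | yes _ = suc (suc zero)
      ... | no _  = suc (suc (suc zero))
      sr⁻-sr : ∀ a → sr⁻ (sr a) ≡ a
      sr⁻-sr zero       = refl
      sr⁻-sr (suc zero) = refl
      sr⁻-sr (suc (suc zero)) with t₂ Finₚ.≟ t₂
      ... | yes _ = refl
      ... | no ≢  = ⊥-elim (≢ refl)
      sr⁻-sr (suc (suc (suc zero))) with o Finₚ.≟ t₂
      ... | yes eq = ⊥-elim (o≢t₂ eq)
      ... | no _   = refl
      tag : Fin 4 → GE
      tag zero                   = ga zero true
      tag (suc zero)             = gm
      tag (suc (suc zero))       = ga (suc zero) false
      tag (suc (suc (suc zero))) = ga zero false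
      tag⁻ : GE → Fin 4
      tag⁻ (ga _ true)        = zero
      tag⁻ gm                 = suc zero
      tag⁻ (ga (suc _) false) = suc (suc zero)
      tag⁻ (ga zero false)    = suc (suc (suc zero))

    square-avoids : ∀ a {j} → Spots.sr square-spots a ≢ inj₁ (sparing j)
    square-avoids zero {j} eq = sparing≢ j (sym (Sumₚ.inj₁-injective eq))
    square-avoids (suc zero) ()
    square-avoids (suc (suc zero)) ()
    square-avoids (suc (suc (suc zero))) ()

    -- The disjoint sides `exy` and `ewz` contain two different cover vertices, and both of these
    -- have their spots already.
    square-layout : Cover F (4 + s″) → Layout F q (2 + s″) GV GE GI
    square-layout C = go (cover-edge C endsxy) (cover-edge C endswz)
      where
      host : ∀ {a b} → a ≢ b → IsJust (Cover.at C (vs a)) → IsJust (Cover.at C (vs b)) → Layout F q (2 + s″) GV GE GI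
      host a≢b ja jb = Instances.cover-two-spots F square-spots sparing sparing-inj square-avoids C a≢b ja jb t₁
      go : IsJust (Cover.at C x) ⊎ IsJust (Cover.at C y) → IsJust (Cover.at C w) ⊎ IsJust (Cover.at C z) → Layout F q (2 + s″) GV GE GI
      go (inj₁ jx) (inj₁ jw) = host {zero} {suc (suc zero)} (λ ()) jx jw
      go (inj₁ jx) (inj₂ jz) = host {zero} {suc (suc (suc zero))} (λ ()) jx jz
      go (inj₂ jy) (inj₁ jw) = host {suc zero} {suc (suc zero)} (λ ()) jy jw
      go (inj₂ jy) (inj₂ jz) = host {suc zero} {suc (suc (suc zero))} (λ ()) jy jz

  -- The extra piece for the hypergraphs with kernel D: a triangle whose hyperedge t misses corner t.
  module Trigon (s : ℕ) where
    data TI : Fin 3 → Fin s ⊎ Fin 3 → Set where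
      ti : ∀ {t g} → g ≢ t → TI t (inj₂ g)

    trigon-spots : (T : Triangle) → Triangle.Isolated T → Spots F s (Fin 3) (Fin 3) TI
    trigon-spots T (pendant , iso) = record
      { #sp = 3 ; #ge = 3 ; sp = corners T ; sp-inj = corners-inj T ; sr = inj₂ ; sr-inj = Sumₚ.inj₂-injective
      ; gedge = edgesOf T ; tag = id ; tag-inj = id ; endˡ = fst₃ ; endʳ = snd₃ ; gends = edgesOf-ends T
      ; fitˡ = λ { zero → ti λ () ; (suc zero) → ti λ () ; (suc (suc zero)) → ti λ () }
      ; fitʳ = λ { zero → ti λ () ; (suc zero) → ti λ () ; (suc (suc zero)) → ti λ () }
      ; closed = λ { j {zero} _ t → among⇒edgesOf T (iso j t)
                   ; j {suc zero} _ t → among⇒edgesOf T (pendant j (inj₁ t))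
                   ; j {suc (suc zero)} _ t → among⇒edgesOf T (pendant j (inj₂ t)) } }

    -- This triangle occupies no place of the core, so the cover may be one larger than in
    -- `triangle-layout`: two corners, the `s` old core vertices and the new one.
    trigon-layout : ∀ {q} → Fin q → (T : Triangle) → Triangle.Isolated T → Cover F (3 + s) → Layout F q s (Fin 3) (Fin 3) TI
    trigon-layout x₀ T iso C with two-of-three {λ a → IsJust (Cover.at C (corners T a))} (λ a → cover-edge C (edgesOf-ends T a))
    ... | a , b , a≢b , ja , jb =
      Instances.cover-two-spots F (trigon-spots T iso) newest newest-inj (λ _ ()) C a≢b ja jb x₀

-- Redrawing a copy from the hypergraph with kernel

two-of-Fin2 : (a b c : Fin 2) → a ≡ b ⊎ a ≡ c ⊎ b ≡ c
two-of-Fin2 zero       zero       c          = inj₁ refl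
two-of-Fin2 zero       (suc zero) zero       = inj₂ (inj₁ refl)
two-of-Fin2 zero       (suc zero) (suc zero) = inj₂ (inj₂ refl)
two-of-Fin2 (suc zero) zero       zero       = inj₂ (inj₂ refl)
two-of-Fin2 (suc zero) zero       (suc zero) = inj₂ (inj₁ refl)
two-of-Fin2 (suc zero) (suc zero) c          = inj₁ refl

-- If F has an isolated triangle and embeds in the hypergraph with s = δ = q = 2, then at most two of the four core
-- vertices are left for the rest of F, and the groups hold pairs of vertices meeting at most two edges.
module FromKernel (F : Graph) (ρ r G : ℕ) (E : EmbedsIn F (Concrete.In 2 2 0 ρ r G))
                  (T : Cycles.Triangle F) (isolated : Cycles.Triangle.Isolated T) where
  open Graphs F
  open Cycles F
  open Concrete 2 2 0 ρ r G hiding (q; key)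
  open EmbedsIn E

  key⇒pt : ∀ {L} v → keyV v ≡ just (inj₁ L) → ∃ λ x → v ≡ vpt L x
  key⇒pt (vsp l x) refl = x , refl
  key⇒pt (vgr g x) refl = x , refl
  key⇒pt (vcore _) ()
  key⇒pt (vdk _) ()
  key⇒pt (vlo _) ()

  coreV : V → Maybe (Fin 4)
  coreV (vcore zero)       = just zero
  coreV (vcore (suc zero)) = just (suc zero)
  coreV (vdk zero)         = just (suc (suc zero))
  coreV (vdk (suc zero))   = just (suc (suc (suc zero)))
  coreV (vsp _ _)          = nothing
  coreV (vlo _)            = nothing
  coreV (vgr _ _)          = nothing

  coreV⁻ : Fin 4 → V
  coreV⁻ zero                   = vcore zero
  coreV⁻ (suc zero)             = vcore (suc zero)
  coreV⁻ (suc (suc zero))       = vdk zero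
  coreV⁻ (suc (suc (suc zero))) = vdk (suc zero)

  coreV⁻-coreV : ∀ v {i} → coreV v ≡ just i → v ≡ coreV⁻ i
  coreV⁻-coreV (vcore zero)       refl = refl
  coreV⁻-coreV (vcore (suc zero)) refl = refl
  coreV⁻-coreV (vdk zero)         refl = refl
  coreV⁻-coreV (vdk (suc zero))   refl = refl

  cores : Partial (Fin P) 4
  cores = record { at = coreV ∘ ψ ; at-inj = λ {u} {v} eu ev → ψ-inj (trans (coreV⁻-coreV (ψ u) eu) (sym (coreV⁻-coreV (ψ v) ev))) }

  open Partial cores

  key-in : ∀ {v τ} → In v τ → coreV v ≡ nothing → keyV v ≡ just (inj₁ (tagLab τ))
  key-in {τ = hT i l} (hp {x = x}) _ = keyV-pt (ord l) x
  key-in {τ = κT i j} (κp {x = x}) _ = keyV-pt (pair i j) x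
  key-in (hc {zero}) ()
  key-in (hc {suc zero}) ()
  key-in (κc {zero}) ()
  key-in (κc {suc zero}) ()
  key-in (κc′ {j = zero}) ()
  key-in (κc′ {j = suc zero}) ()
  key-in (hd {zero}) ()
  key-in (hd {suc zero}) ()
  key-in (κd {zero}) ()
  key-in (κd {suc zero}) ()

  key : Fin P → Key
  key = keyV ∘ ψ

  lab′ : Fin m → Lab
  lab′ = tagLab ∘ φ

  key-at : ∀ {j u} → at u ≡ nothing → Touches j u → key u ≡ just (inj₁ (lab′ j))
  key-at {j} n₀ (inj₁ refl) = key-in (incˡ j) n₀
  key-at {j} n₀ (inj₂ refl) = key-in (incʳ j) n₀

  lab-meet : ∀ {i j u} → at u ≡ nothing → Touches i u → Touches j u → lab′ i ≡ lab′ j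
  lab-meet n₀ ti tj = Sumₚ.inj₁-injective (just-injective (trans (sym (key-at n₀ ti)) (key-at n₀ tj)))

  -- A group of this hypergraph lies in at most two hyperedges, one per colour.
  three-edges : ∀ i j k → lab′ i ≡ lab′ j → lab′ i ≡ lab′ k → i ≡ j ⊎ i ≡ k ⊎ j ≡ k
  three-edges i j k ij ik = go (two-of-Fin2 (tagColour (φ i)) (tagColour (φ j)) (tagColour (φ k)))
    where
    same : ∀ {i j} → lab′ i ≡ lab′ j → tagColour (φ i) ≡ tagColour (φ j) → i ≡ j
    same {i} {j} l c = φ-inj (tag-determined (φ i) (φ j) l c)
    go : tagColour (φ i) ≡ tagColour (φ j) ⊎ tagColour (φ i) ≡ tagColour (φ k) ⊎ tagColour (φ j) ≡ tagColour (φ k) → i ≡ j ⊎ i ≡ k ⊎ j ≡ k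
    go (inj₁ eq)        = inj₁ (same ij eq)
    go (inj₂ (inj₁ eq)) = inj₂ (inj₁ (same ik eq))
    go (inj₂ (inj₂ eq)) = inj₂ (inj₂ (same (trans (sym ij) ik) eq))

  three-vertices : ∀ {L} u v w → key u ≡ just (inj₁ L) → key v ≡ just (inj₁ L) → key w ≡ just (inj₁ L) → u ≡ v ⊎ u ≡ w ⊎ v ≡ w
  three-vertices {L} u v w ku kv kw with x , eu ← key⇒pt (ψ u) ku | y , ev ← key⇒pt (ψ v) kv | z , ew ← key⇒pt (ψ w) kw
    with two-of-Fin2 x y z
  ... | inj₁ refl        = inj₁ (ψ-inj (trans eu (sym ev)))
  ... | inj₂ (inj₁ refl) = inj₂ (inj₁ (ψ-inj (trans eu (sym ew))))
  ... | inj₂ (inj₂ refl) = inj₂ (inj₂ (ψ-inj (trans ev (sym ew))))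

  touchˡ : ∀ {j u v} → Ends j u v → Touches j u
  touchˡ = ends⇒touchesˡ

  touchʳ : ∀ {j u v} → Ends j u v → Touches j v
  touchʳ = ends⇒touchesˡ ∘ Ends-swap

  -- With `u` and `v` both outside the four core vertices, all three sides would use hyperedges of
  -- one group, which has only two.
  pair-covered : ∀ {u v w e f g} → Ends e u v → Ends f u w → Ends g v w → IsJust (at u) ⊎ IsJust (at v)
  pair-covered {u} {v} {w} {e} {f} {g} ee ef eg with isJust⊎nothing (at u) | isJust⊎nothing (at v)
  ... | inj₁ ju | _       = inj₁ ju
  ... | inj₂ _  | inj₁ jv = inj₂ jv
  ... | inj₂ nu | inj₂ nv with three-edges e f g (lab-meet {e} {f} nu (touchˡ ee) (touchˡ ef)) (lab-meet {e} {g} nv (touchʳ ee) (touchˡ eg))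
  ...   | inj₁ refl        = ⊥-elim (Ends-≢ eg (Ends-cancel ee ef))
  ...   | inj₂ (inj₁ refl) = ⊥-elim (Ends-≢ ef (Ends-cancel (Ends-swap ee) eg))
  ...   | inj₂ (inj₂ refl) = ⊥-elim (Ends-≢ ee (Ends-cancel (Ends-swap ef) (Ends-swap eg)))

  corner-covered : ∀ a → IsJust (at (corners F T (fst₃ F a))) ⊎ IsJust (at (corners F T (snd₃ F a)))
  corner-covered zero             = pair-covered endsyz (Ends-swap endsxy) (Ends-swap endsxz)
    where open Triangle T
  corner-covered (suc zero)       = pair-covered endsxz endsxy (Ends-swap endsyz)
    where open Triangle T
  corner-covered (suc (suc zero)) = pair-covered endsxy endsxz endsyz
    where open Triangle T

  corner-edge : ∀ {j} a → Touches j (corners F T a) → ∃ λ b → edgesOf F T b ≡ j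
  corner-edge {j} zero             t = among⇒edgesOf F T (proj₂ isolated j t)
  corner-edge {j} (suc zero)       t = among⇒edgesOf F T (proj₁ isolated j (inj₁ t))
  corner-edge {j} (suc (suc zero)) t = among⇒edgesOf F T (proj₁ isolated j (inj₂ t))

  module _ {q : ℕ} (t₁ t₂ x₀ x₁ : Fin q) (x₀≢x₁ : x₀ ≢ x₁) where
    open Gadget 2 q t₁ t₂

    S : Spots F 2 GV GE GI
    S = triangle-spots F {1} t₁ t₂ T (proj₁ isolated)

    avoids : ∀ a {j} → Spots.sr S a ≢ inj₁ (sparing j)
    avoids = triangle-avoids F {1} t₁ t₂ T (proj₁ isolated)

    module _ (g : Partial (Fin P) 2) (keep : ∀ {u} → (∀ a → corners F T a ≢ u) → IsJust (at u) → IsJust (Partial.at g u)) where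

      base : Fin P → Maybe (Maybe (Fin 2))
      base = Instances.baseOf F {q} S sparing sparing-inj avoids g

      Free : Fin P → Set
      Free u = (∀ a → corners F T a ≢ u) × base u ≡ nothing

      status : ∀ u → ((∃ λ a → corners F T a ≡ u) ⊎ IsJust (base u)) ⊎ Free u
      status u with any? (λ a → corners F T a Finₚ.≟ u) | isJust⊎nothing (base u)
      ... | yes sp | _       = inj₁ (inj₁ sp)
      ... | no _   | inj₁ b  = inj₁ (inj₂ b)
      ... | no ¬sp | inj₂ b  = inj₂ ((λ a eq → ¬sp (a , eq)) , b)

      free? : ∀ u → Dec (Free u)
      free? u with status u
      ... | inj₂ f                = yes f
      ... | inj₁ (inj₁ (a , eq))  = no λ f → proj₁ f a eq
      ... | inj₁ (inj₂ (_ , eq))  = no λ f → just≢nothing eq (proj₂ f)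

      free⇒noncore : ∀ {u} → Free u → at u ≡ nothing
      free⇒noncore {u} (¬sp , b) with isJust⊎nothing (at u)
      ... | inj₂ n₀ = n₀
      ... | inj₁ ju = ⊥-elim (just≢nothing (proj₂ (Instances.isJust-base F {q} S sparing sparing-inj avoids g {u} (keep ¬sp ju))) b)

      Chord : Fin m → Set
      Chord i = Free (src i) × Free (tgt i)

      chord-end : ∀ {i u} → Chord i → Touches i u → Free u
      chord-end (fs , _) (inj₁ refl) = fs
      chord-end (_ , ft) (inj₂ refl) = ft

      other-end : ∀ {i u} → Touches i u → ∃ λ v → Ends i u v
      other-end {i} (inj₁ eq) = tgt i , inj₁ (eq , refl)
      other-end {i} (inj₂ eq) = src i , inj₂ (refl , eq)

      -- `u`, the other end of the chord and `w` lie in one group of two vertices. So chords are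
      -- pairwise disjoint, and each can become a group of the layout.
      chord-alone : ∀ {i j u w} → Chord i → Touches i u → Ends j u w → Free w → i ≡ j
      chord-alone {i} {j} {u} {w} chd ti ej fw with v , ei ← other-end {i} ti
        with three-vertices u v w
               (key-at (free⇒noncore (chord-end {i} chd ti)) ti)
               (key-at (free⇒noncore (chord-end {i} chd (touchʳ ei))) (touchʳ ei))
               (trans (key-at (free⇒noncore fw) (touchʳ ej)) (cong (just ∘ inj₁) (lab-meet {j} {i} (free⇒noncore (chord-end {i} chd ti)) (touchˡ ej) ti)))
      ... | inj₁ eq          = ⊥-elim (Ends-≢ ei eq)
      ... | inj₂ (inj₁ eq)   = ⊥-elim (Ends-≢ ej eq)
      ... | inj₂ (inj₂ refl) = edge-unique ei ej

      chord-unique : ∀ {i j u} → Chord i → Chord j → Touches i u → Touches j u → i ≡ j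
      chord-unique {i} {j} ci cj ti tj with w , ej ← other-end {j} tj = chord-alone ci ti ej (chord-end {j} cj (touchʳ ej))

      -- One of the two hyperedges of the group is spent on the chord, which leaves a single one for
      -- all other edges at its two ends.
      spoke-alone : ∀ {i j k v v′} → Chord i → Touches i v → Touches i v′ → Touches j v → Touches k v′ → i ≢ j → i ≢ k → j ≡ k
      spoke-alone {i} {j} {k} chd tv tv′ tj tk i≢j i≢k
        with three-edges i j k (lab-meet (free⇒noncore (chord-end {i} chd tv)) tv tj) (lab-meet (free⇒noncore (chord-end {i} chd tv′)) tv′ tk)
      ... | inj₁ eq        = ⊥-elim (i≢j eq)
      ... | inj₂ (inj₁ eq) = ⊥-elim (i≢k eq)
      ... | inj₂ (inj₂ eq) = eq

      chord? : ∀ u → Dec (∃ λ i → Chord i × Touches i u)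
      chord? u = any? λ i → (free? (src i) ×-dec free? (tgt i)) ×-dec touches? i u

      rlabD : ∀ u → Dec (∃ λ i → Chord i × Touches i u) → Fin P
      rlabD u (yes (i , _)) = src i
      rlabD u (no _)        = u

      rposD : ∀ u → Dec (∃ λ i → Chord i × Touches i u) → Fin q
      rposD u (no _)        = x₀
      rposD u (yes (i , _)) with src i Finₚ.≟ u
      ... | yes _ = x₀
      ... | no _  = x₁

      rlab : Fin P → Fin P
      rlab u = rlabD u (chord? u)

      rpos : Fin P → Fin q
      rpos u = rposD u (chord? u)

      rlab-chord : ∀ {i u} → Chord i → Touches i u → rlab u ≡ src i
      rlab-chord {i} {u} chd t = go (chord? u)
        where
        go : (d : Dec (∃ λ i → Chord i × Touches i u)) → rlabD u d ≡ src i
        go (yes (j , cj , tj)) = cong src (chord-unique {j} {i} cj chd tj t)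
        go (no ¬chd)            = ⊥-elim (¬chd (i , chd , t))

      rpos-src : ∀ {i} → Chord i → rpos (src i) ≡ x₀
      rpos-src {i} chd = go (chord? (src i))
        where
        go : (d : Dec (∃ λ j → Chord j × Touches j (src i))) → rposD (src i) d ≡ x₀
        go (no _) = refl
        go (yes (j , cj , tj)) with refl ← chord-unique {j} {i} cj chd tj (inj₁ refl) with src i Finₚ.≟ src i
        ... | yes _ = refl
        ... | no ≢  = ⊥-elim (≢ refl)

      rpos-tgt : ∀ {i} → Chord i → rpos (tgt i) ≡ x₁
      rpos-tgt {i} chd = go (chord? (tgt i))
        where
        go : (d : Dec (∃ λ j → Chord j × Touches j (tgt i))) → rposD (tgt i) d ≡ x₁
        go (no ¬chd) = ⊥-elim (¬chd (i , chd , inj₂ refl))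
        go (yes (j , cj , tj)) with refl ← chord-unique {j} {i} cj chd tj (inj₂ refl) with src i Finₚ.≟ tgt i
        ... | yes eq = ⊥-elim (src≢tgt i eq)
        ... | no _   = refl

      same-group : ∀ {u v} → rlab u ≡ rlab v → u ≡ v ⊎ ∃ λ i → Chord i × Touches i u × Touches i v
      same-group {u} {v} eq = go (chord? u) (chord? v) eq
        where
        go : (d : Dec (∃ λ i → Chord i × Touches i u)) (d′ : Dec (∃ λ i → Chord i × Touches i v)) → rlabD u d ≡ rlabD v d′ →
             u ≡ v ⊎ ∃ λ i → Chord i × Touches i u × Touches i v
        go (no _)             (no _)             eq = inj₁ eq
        go (yes (i , c , t))  (no _)             eq = inj₂ (i , c , t , inj₁ eq)
        go (no _)             (yes (j , c , t))  eq = inj₂ (j , c , inj₁ (sym eq) , t)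
        go (yes (i , ci , t)) (yes (j , cj , t′)) eq with refl ← chord-unique {i} {j} ci cj (inj₁ eq) (inj₁ refl) = inj₂ (i , ci , t , t′)

      layout : Layout F q 2 GV GE GI
      layout = record
        { spots = S ; base = base ; base-inj = Instances.baseOf-inj F {q} S sparing sparing-inj avoids g
        ; avoid = λ {u} → base-avoid {u}
        -- Colour `zero` is free for chords: its core vertex carries a corner of the isolated
        -- triangle, from which no edge leads to a free vertex.
        ; rlab = rlab ; rpos = rpos ; ic = just zero
        ; cover = cover
        ; r-inj = r-inj
        ; spoke-inj = spoke-inj
        ; inside-inj = λ { {i} {j} (fs , ft , _) (fs′ , ft′ , _) eq → chord-unique {i} {j} (fs , ft) (fs′ , ft′)
            (inj₁ (trans (sym (rlab-chord {i} (fs , ft) (inj₁ refl))) (trans eq (rlab-chord {j} (fs′ , ft′) (inj₁ refl))))) (inj₁ refl) }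
        ; mixed = λ {_} {j} {u} _ ends fv _ → (λ b → base-avoid {u} zero b refl) , λ a eq → no-corner a eq ends fv
        ; ic-old = λ _ () }
        where
        base-avoid : ∀ {u c} a → base u ≡ just c → Spots.sr S a ≢ inj₁ c
        base-avoid {u} = Instances.baseOf-avoid F {q} S sparing sparing-inj avoids g {u}
        cover : ∀ j → (∃ λ w → Touches j w × ((∃ λ a → corners F T a ≡ w) ⊎ IsJust (base w))) ⊎
                      (Free (src j) × Free (tgt j) × rlab (src j) ≡ rlab (tgt j))
        cover j with status (src j) | status (tgt j)
        ... | inj₁ c | _      = inj₁ (src j , inj₁ refl , c)
        ... | inj₂ _ | inj₁ c = inj₁ (tgt j , inj₂ refl , c)
        ... | inj₂ f | inj₂ f′ = inj₂ (f , f′ , trans (rlab-chord {j} (f , f′) (inj₁ refl)) (sym (rlab-chord {j} (f , f′) (inj₂ refl))))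
        r-inj : ∀ {u v} → Free u → Free v → rlab u ≡ rlab v → rpos u ≡ rpos v → u ≡ v
        r-inj {u} {v} fu fv lab≡ pos≡ with same-group {u} {v} lab≡
        ... | inj₁ eq = eq
        ... | inj₂ (i , chd , inj₁ refl , inj₁ refl) = refl
        ... | inj₂ (i , chd , inj₂ refl , inj₂ refl) = refl
        ... | inj₂ (i , chd , inj₁ refl , inj₂ refl) = ⊥-elim (x₀≢x₁ (trans (sym (rpos-src {i} chd)) (trans pos≡ (rpos-tgt {i} chd))))
        ... | inj₂ (i , chd , inj₂ refl , inj₁ refl) = ⊥-elim (x₀≢x₁ (trans (sym (rpos-src {i} chd)) (trans (sym pos≡) (rpos-tgt {i} chd))))
        spoke-inj : ∀ {i j u v u′ v′} → Ends i u v → ¬ Free u → Free v → Ends j u′ v′ → ¬ Free u′ → Free v′ → rlab v ≡ rlab v′ → v ≡ v′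
        spoke-inj {i} {j} {u} {v} {u′} {v′} ei ¬fu fv ej ¬fu′ fv′ eq with same-group {v} {v′} eq
        ... | inj₁ v≡v′ = v≡v′
        ... | inj₂ (k , chd , tv , tv′)
            with refl ← spoke-alone {k} {i} {j} chd tv tv′ (touchʳ ei) (touchʳ ej)
                   (λ { refl → ¬fu (chord-end {k} chd (touchˡ ei)) }) (λ { refl → ¬fu′ (chord-end {k} chd (touchˡ ej)) })
            with v Finₚ.≟ v′
        ...   | yes v≡v′ = v≡v′
        ...   | no v≢v′ = ⊥-elim (¬fu (subst Free (Ends-cancel (touches⇒ends v≢v′ (touchʳ ei) (touchʳ ej)) (Ends-swap ei)) fv′))
        no-corner : ∀ {j u v} a → corners F T a ≡ u → Ends j u v → ¬ Free v
        no-corner {j} {u} {v} a refl ends fv with b , refl ← corner-edge {j} a (touchˡ ends)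
          with touch-end F {Q = λ w → w ≡ v} (edgesOf-ends F T b) (touchʳ ends) refl
        ... | inj₁ eq = proj₁ fv (fst₃ F b) eq
        ... | inj₂ eq = proj₁ fv (snd₃ F b) eq

    -- Two of the four core vertices hold corners of the triangle, so the other vertices of F need
    -- at most two core places, as many as `sparing` has to offer.
    kernel-layout : Layout F q 2 GV GE GI
    kernel-layout with two-of-three F {λ a → IsJust (at (corners F T a))} corner-covered
    ... | a , b , a≢b , ja , jb with g , keep , _ ← drop₂ cores (a≢b ∘ corners-inj F T) ja jb =
      layout g (λ ¬sp → keep (λ eq → ¬sp a (sym eq)) (λ eq → ¬sp b (sym eq)))

-- Realising the model in the hypergraph with kernel

-- In the hypergraph with s = δ = q = 2, the vertices a₀ and d₀ serve as the core, since every group has a hyperedge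
-- through either of them; a₁, d₁ and a reserved vertex carry the triangle.
module ConcreteD (F : Graph) (r G : ℕ) where
  P : ℕ
  P = p F
  open Concrete 2 2 0 (P + 6) r G
  open Trigon F 2

  module _ (tp : Site P (suc P) → Fin q) where
    open Model P q 2 (Fin 3) (Fin 3) TI (tp ∘ shiftSite) using (MV; ME; Inc)
    private module M = Model P q 2 (Fin 3) (Fin 3) TI (tp ∘ shiftSite)

    -- Of the six spare groups, four serve the ordered pairs of core vertices and two the triangle.
    extra : Fin 6 → RawSlot P
    extra x = reserved (P ↑ʳ x)

    slot : Slot P → RawSlot P
    slot (plain u)   = reserved (u ↑ˡ 6)
    slot (touched σ) = touched (shiftSite σ)

    slot⁻ : RawSlot P → Slot P ⊎ Maybe (Fin 6)
    slot⁻ (reserved t) with Data.Fin.splitAt P t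
    ... | inj₁ u = inj₁ (plain u)
    ... | inj₂ x = inj₂ (just x)
    slot⁻ (touched σ) with unshift σ
    ... | just τ  = inj₁ (touched τ)
    ... | nothing = inj₂ nothing

    slot⁻-slot : ∀ σ → slot⁻ (slot σ) ≡ inj₁ σ
    slot⁻-slot (plain u) rewrite Finₚ.splitAt-↑ˡ P u 6 = refl
    slot⁻-slot (touched σ) rewrite unshift-shift σ = refl

    slot⁻-extra : ∀ x → slot⁻ (extra x) ≡ inj₂ (just x)
    slot⁻-extra x rewrite Finₚ.splitAt-↑ʳ P 6 x = refl

    four five : Fin 6
    four = suc (suc (suc (suc zero)))
    five = suc (suc (suc (suc (suc zero))))

    code : Fin 2 → Fin 2 → Fin 6
    code zero       zero       = zero
    code zero       (suc zero) = suc zero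
    code (suc zero) zero       = suc (suc zero)
    code (suc zero) (suc zero) = suc (suc (suc zero))

    corner : Fin 3 → RawV P
    corner zero             = core (suc zero)
    corner (suc zero)       = dk (suc zero)
    corner (suc (suc zero)) = pt (extra four) zero

    vmap : MV → RawV P
    vmap (M.core zero)       = core zero
    vmap (M.core (suc zero)) = dk zero
    vmap (M.pt σ x)          = pt (slot σ) x
    vmap (M.gv g)            = corner g

    vmap⁻ : RawV P → Maybe MV
    vmap⁻ (core zero)       = just (M.core zero)
    vmap⁻ (core (suc zero)) = just (M.gv zero)
    vmap⁻ (dk zero)         = just (M.core (suc zero))
    vmap⁻ (dk (suc zero))   = just (M.gv (suc zero))
    vmap⁻ (pt σ x) = [ (λ τ → just (M.pt τ x)) , (λ _ → just (M.gv (suc (suc zero)))) ]′ (slot⁻ σ)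

    vmap⁻-vmap : ∀ v → vmap⁻ (vmap v) ≡ just v
    vmap⁻-vmap (M.core zero)             = refl
    vmap⁻-vmap (M.core (suc zero))       = refl
    vmap⁻-vmap (M.pt σ x) rewrite slot⁻-slot σ = refl
    vmap⁻-vmap (M.gv zero)               = refl
    vmap⁻-vmap (M.gv (suc zero))         = refl
    vmap⁻-vmap (M.gv (suc (suc zero))) rewrite slot⁻-extra four = refl

    side : Fin 3 → RawE P
    side zero             = h zero (extra four)
    side (suc zero)       = h (suc zero) (extra four)
    side (suc (suc zero)) = h (suc zero) (extra five)

    -- Colour `suc zero` of the model belongs to d₀, which lies in every hyperedge, so a₁ is free to
    -- be a corner. Pairs of core vertices use hyperedges of colour `zero`, which contain both a₀
    -- and d₀.
    emap : ME → RawE P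
    emap (M.h i σ)       = h i (slot σ)
    emap (M.κ i j)       = h zero (extra (code i j))
    emap (M.eh (inj₁ i)) = eh (inj₁ i)
    emap (M.eh (inj₂ i)) = eh (inj₂ (suc i))
    emap (M.ge t)        = side t

    decode : Fin 2 → Fin 6 → Maybe ME
    decode _          zero                                     = just (M.κ zero zero)
    decode _          (suc zero)                               = just (M.κ zero (suc zero))
    decode _          (suc (suc zero))                         = just (M.κ (suc zero) zero)
    decode _          (suc (suc (suc zero)))                   = just (M.κ (suc zero) (suc zero))
    decode zero       (suc (suc (suc (suc zero))))             = just (M.ge zero)
    decode (suc zero) (suc (suc (suc (suc zero))))             = just (M.ge (suc zero))
    decode _          (suc (suc (suc (suc (suc zero)))))       = just (M.ge (suc (suc zero)))

    emap⁻ : RawE P → Maybe ME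
    emap⁻ (h i σ)             = [ (λ τ → just (M.h i τ)) , [ decode i , nothing ]ᵐ ]′ (slot⁻ σ)
      where
      [_,_]ᵐ : (Fin 6 → Maybe ME) → Maybe ME → Maybe (Fin 6) → Maybe ME
      [ f , d ]ᵐ (just x) = f x
      [ f , d ]ᵐ nothing  = d
    emap⁻ (κ _ _)             = nothing
    emap⁻ (eh (inj₁ i))       = just (M.eh (inj₁ i))
    emap⁻ (eh (inj₂ zero))    = nothing
    emap⁻ (eh (inj₂ (suc i))) = just (M.eh (inj₂ i))

    emap⁻-emap : ∀ e → emap⁻ (emap e) ≡ just e
    emap⁻-emap (M.h i σ) rewrite slot⁻-slot σ = refl
    emap⁻-emap (M.κ i j) rewrite slot⁻-extra (code i j) = go i j
      where
      go : ∀ i j → decode zero (code i j) ≡ just (M.κ i j)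
      go zero       zero       = refl
      go zero       (suc zero) = refl
      go (suc zero) zero       = refl
      go (suc zero) (suc zero) = refl
    emap⁻-emap (M.eh (inj₁ i)) = refl
    emap⁻-emap (M.eh (inj₂ i)) = refl
    emap⁻-emap (M.ge zero)             rewrite slot⁻-extra four = refl
    emap⁻-emap (M.ge (suc zero))       rewrite slot⁻-extra four = refl
    emap⁻-emap (M.ge (suc (suc zero))) rewrite slot⁻-extra five = refl

    core-inc : ∀ i {σ} → RawInc tp (vmap (M.core i)) (h zero σ)
    core-inc zero       = ch
    core-inc (suc zero) = dh

    side-inc : ∀ t g → g ≢ t → RawInc tp (corner g) (side t)
    side-inc zero             zero             g≢t = ⊥-elim (g≢t refl)
    side-inc zero             (suc zero)       _   = dh
    side-inc zero             (suc (suc zero)) _   = ph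
    side-inc (suc zero)       zero             _   = ch
    side-inc (suc zero)       (suc zero)       g≢t = ⊥-elim (g≢t refl)
    side-inc (suc zero)       (suc (suc zero)) _   = ph
    side-inc (suc (suc zero)) zero             _   = ch
    side-inc (suc (suc zero)) (suc zero)       _   = dh
    side-inc (suc (suc zero)) (suc (suc zero)) g≢t = ⊥-elim (g≢t refl)

    inc-map : ∀ {v e} → Inc v e → RawInc tp (vmap v) (emap e)
    inc-map (M.ch {zero})     = ch
    inc-map (M.ch {suc zero}) = dh
    inc-map M.ph       = ph
    inc-map (M.κˡ {i}) = core-inc i
    inc-map (M.κʳ {j = j}) = core-inc j
    inc-map M.hubᵢ     = hubᵢ
    inc-map M.leafᵢ    = leafᵢ
    inc-map M.leftᵢ    = leftᵢ
    inc-map M.rightᵢ   = rightᵢ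
    inc-map (M.ggᵢ {t} {g} (ti g≢t)) = side-inc t g g≢t

    embed-raw : EmbedsIn F Inc → EmbedsIn F (RawInc tp)
    embed-raw = embed-map vmap emap (retract-injᵐ vmap⁻ vmap⁻-vmap) (retract-injᵐ emap⁻ emap⁻-emap) inc-map

-- Graphs without a vertex cover of size k

complete-list : ∀ {s} t (vs : List (Fin s)) → Unique vs → length vs ≤ t → t ≤ s →
                ∃ λ ws → Unique ws × length ws ≡ t × (∀ {v} → v ∈ₗ vs → v ∈ₗ ws)
complete-list {s} t vs u vs≤t t≤s = go (t ∸ length vs) vs u (ℕₚ.m∸n+n≡m vs≤t)
  where
  open DecMem (Finₚ._≟_ {s}) using () renaming (_∈?_ to _∈v?_)
  go : ∀ d vs → Unique vs → d + length vs ≡ t → ∃ λ ws → Unique ws × length ws ≡ t × (∀ {v} → v ∈ₗ vs → v ∈ₗ ws)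
  go zero    vs u eq = vs , u , eq , id
  go (suc d) vs u eq with any? (λ v → ¬? (v ∈v? vs))
  ... | yes (v , v∉) with ws , uw , len , sub ← go d (v ∷ vs) (∉⇒All≢ v∉ ∷ u) (trans (ℕₚ.+-suc d (length vs)) eq) =
    ws , uw , len , sub ∘ there
  ... | no all = ⊥-elim (ℕₚ.<⇒≱ (ℕₚ.≤-trans (s≤s (ℕₚ.m≤n+m (length vs) d)) (ℕₚ.≤-trans (ℕₚ.≤-reflexive eq) t≤s)) (begin
    s                 ≡⟨ Listₚ.length-tabulate {n = s} id ⟨
    length (allFin s) ≤⟨ Removal.unique-⊆-length Finₚ._≟_ vs (Uniqueₚ.allFin⁺ s) (λ {v} _ → member v) ⟩
    length vs         ∎))
    where
    open ℕₚ.≤-Reasoning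
    member : ∀ v → v ∈ₗ vs
    member v with v ∈v? vs
    ... | yes v∈ = v∈
    ... | no v∉  = ⊥-elim (all (v , v∉))

-- Distinct c-subsets `around d i` of Fin (d + suc c) with i ∈ around d i.
module Around (c′ : ℕ) where
  c : ℕ
  c = suc c′

  -- A cyclic shift: being injective and without fixed points, it makes the complements of the
  -- points `cyc i` distinct sets, each containing its `i`.
  cyc : Fin (suc c) → Fin (suc c)
  cyc zero    = Data.Fin.fromℕ c
  cyc (suc i) = Data.Fin.inject₁ i

  cyc≢ : ∀ i → cyc i ≢ i
  cyc≢ zero    ()
  cyc≢ (suc i) eq = ℕₚ.<⇒≢ ℕₚ.≤-refl (trans (sym (Finₚ.toℕ-inject₁ i)) (cong toℕ eq))

  cyc-inj : ∀ {i j} → cyc i ≡ cyc j → i ≡ j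
  cyc-inj {zero}  {zero}  _  = refl
  cyc-inj {suc i} {suc j} eq = cong suc (Finₚ.inject₁-injective eq)
  cyc-inj {zero}  {suc j} eq = ⊥-elim (Finₚ.fromℕ≢inject₁ eq)
  cyc-inj {suc i} {zero}  eq = ⊥-elim (Finₚ.fromℕ≢inject₁ (sym eq))

  small : ∀ d → c′ ≤ d + suc c
  small d = ℕₚ.≤-trans (ℕₚ.m≤n+m c′ 2) (ℕₚ.m≤n+m (suc c) d)

  around : ∀ d → Fin (d + suc c) → List (Fin (d + suc c))
  around zero    i       = map (punchIn (cyc i)) (allFin c)
  around (suc d) zero    = zero ∷ map (λ x → suc (Data.Fin.inject≤ x (small d))) (allFin c′)
  around (suc d) (suc i) = map suc (around d i)

  around-unique : ∀ d i → Unique (around d i)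
  around-unique zero    i       = Uniqueₚ.map⁺ (Finₚ.punchIn-injective (cyc i) _ _) (Uniqueₚ.allFin⁺ c)
  around-unique (suc d) zero    = Allₚ.map⁺ (All.universal (λ _ ()) (allFin c′))
    ∷ Uniqueₚ.map⁺ (Finₚ.inject≤-injective (small d) (small d) _ _ ∘ Finₚ.suc-injective) (Uniqueₚ.allFin⁺ c′)
  around-unique (suc d) (suc i) = Uniqueₚ.map⁺ Finₚ.suc-injective (around-unique d i)

  length-around : ∀ d i → length (around d i) ≡ c
  length-around zero    i       = trans (Listₚ.length-map (punchIn (cyc i)) (allFin c)) (Listₚ.length-tabulate {n = c} id)
  length-around (suc d) zero    = cong suc (trans (Listₚ.length-map (λ x → suc (Data.Fin.inject≤ x (small d))) (allFin c′)) (Listₚ.length-tabulate {n = c′} id))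
  length-around (suc d) (suc i) = trans (Listₚ.length-map suc (around d i)) (length-around d i)

  ∈-around : ∀ d i → i ∈ₗ around d i
  ∈-around zero    i       = subst (_∈ₗ around zero i) (Finₚ.punchIn-punchOut (cyc≢ i)) (∈-map⁺ (punchIn (cyc i)) (∈-allFin (punchOut (cyc≢ i))))
  ∈-around (suc d) zero    = here refl
  ∈-around (suc d) (suc i) = ∈-map⁺ suc (∈-around d i)

  around-⊆⇒≡ : ∀ d i j → (∀ {v} → v ∈ₗ around d i → v ∈ₗ around d j) → (∀ {v} → v ∈ₗ around d j → v ∈ₗ around d i) → i ≡ j
  around-⊆⇒≡ zero i j _ sub with cyc j Finₚ.≟ cyc i
  ... | yes eq = cyc-inj (sym eq)
  ... | no ≢   = ⊥-elim (missing (sub (subst (_∈ₗ around zero j) (Finₚ.punchIn-punchOut ≢) (∈-map⁺ (punchIn (cyc j)) (∈-allFin (punchOut ≢))))))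
    where
    missing : cyc i ∉ₗ around zero i
    missing ∈i with _ , _ , eq ← ∈-map⁻ (punchIn (cyc i)) ∈i = Finₚ.punchInᵢ≢i (cyc i) _ (sym eq)
  around-⊆⇒≡ (suc d) zero    zero    _ _ = refl
  around-⊆⇒≡ (suc d) zero    (suc j) sub _ with () ← proj₂ (proj₂ (∈-map⁻ suc (sub (here refl))))
  around-⊆⇒≡ (suc d) (suc i) zero    _ sub with () ← proj₂ (proj₂ (∈-map⁻ suc (sub (here refl))))
  around-⊆⇒≡ (suc d) (suc i) (suc j) sub sub′ = cong suc (around-⊆⇒≡ d i j (strip sub) (strip sub′))
    where
    strip : ∀ {i j} → (∀ {v} → v ∈ₗ map suc (around d i) → v ∈ₗ map suc (around d j)) → ∀ {v} → v ∈ₗ around d i → v ∈ₗ around d j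
    strip sub v∈ with _ , w∈ , refl ← ∈-map⁻ suc (sub (∈-map⁺ suc v∈)) = w∈

-- No vertex cover has size s = d + k: the hypergraph of all k-sets with at most one vertex outside a core of size s.
module Uncovered (F : Graph) (c″ d G : ℕ) where
  open Graphs F
  open Around (suc c″)

  k s b₀ n : ℕ
  k  = suc c
  s  = d + k
  b₀ = (s + s * s) + P
  n  = b₀ + G

  V : Set
  V = ((Fin s ⊎ (Fin s × Fin s)) ⊎ Fin P) ⊎ Fin G

  pattern vcore i  = inj₁ (inj₁ (inj₁ i))
  pattern vκ i j   = inj₁ (inj₁ (inj₂ (i , j)))
  pattern vres u   = inj₁ (inj₂ u)
  pattern vgr g    = inj₂ g

  bij : Fin n ↔ V
  bij = ((((Ident.↔-id _ ⊎-↔ *↔×) Comp.↔-∘ +↔⊎) ⊎-↔ Ident.↔-id _) Comp.↔-∘ +↔⊎ ⊎-↔ Ident.↔-id _) Comp.↔-∘ +↔⊎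

  dec : Fin n → V
  dec = Inverse.to bij

  enc : V → Fin n
  enc = Inverse.from bij

  dec-enc : ∀ v → dec (enc v) ≡ v
  dec-enc = Inverse.strictlyInverseˡ bij

  enc-inj : ∀ {v w} → enc v ≡ enc w → v ≡ w
  enc-inj = retract-inj dec dec-enc

  dec-inj : ∀ {v w} → dec v ≡ dec w → v ≡ w
  dec-inj = retract-inj enc (Inverse.strictlyInverseʳ bij)

  X₀ : List (Fin n)
  X₀ = map (_↑ˡ G) (allFin b₀)

  length-X₀ : length X₀ ≡ b₀
  length-X₀ = trans (Listₚ.length-map _ (allFin b₀)) (Listₚ.length-tabulate id)

  outside-X₀ : ∀ w → w ∉ₗ X₀ → ∃ λ g → dec w ≡ vgr g
  outside-X₀ w w∉ with Data.Fin.splitAt b₀ w in eq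
  ... | inj₁ y = ⊥-elim (w∉ (subst (_∈ₗ X₀) (Finₚ.splitAt⁻¹-↑ˡ eq) (∈-map⁺ _ (∈-allFin y))))
  ... | inj₂ z = _ , refl

  coreV : V → Maybe (Fin s)
  coreV (vcore i) = just i
  coreV (vκ _ _)  = nothing
  coreV (vres _)  = nothing
  coreV (vgr _)   = nothing

  coreV⁻ : ∀ v {i} → coreV v ≡ just i → v ≡ vcore i
  coreV⁻ (vcore i) refl = refl

  coreAt : Fin n → Maybe (Fin s)
  coreAt = coreV ∘ dec

  Outer : Fin n → Set
  Outer v = coreAt v ≡ nothing

  outer? : ∀ v → Dec (Outer v)
  outer? v = case isJust⊎nothing (coreAt v) of λ { (inj₁ (_ , eq)) → no (just≢nothing eq) ; (inj₂ eq) → yes eq }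

  Thin : Subset n → Set
  Thin e = ∣ e ∣ ≡ k × (∀ u v → u ∈ e → v ∈ e → Outer u → Outer v → u ≡ v)

  thin? : ∀ e → Dec (Thin e)
  thin? e = (∣ e ∣ ℕ.≟ k) ×-dec all? λ u → all? λ v → (u ∈? e) →-dec ((v ∈? e) →-dec (outer? u →-dec (outer? v →-dec (u Finₚ.≟ v))))

  H₀ : List (Subset n)
  H₀ = filter thin? (subsets n)

  ∈-H₀ : ∀ {e} → Thin e → e ∈ₗ H₀
  ∈-H₀ {e} thin = ∈-filter⁺ thin? (∈-subsets e) thin

  ∈-H₀⁻ : ∀ {e} → e ∈ₗ H₀ → Thin e
  ∈-H₀⁻ e∈ = proj₂ (∈-filter⁻ thin? {xs = subsets n} e∈)

  H₀-unique : Unique H₀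
  H₀-unique = Uniqueₚ.filter⁺ thin? (subsets-unique n)

  -- A hyperedge has at most one vertex outside the core, so of the two ends of an edge of F one
  -- lies in the core.
  contains⇒cover : ContainsBerge F H₀ → Cover F s
  contains⇒cover con with E , φ∈ ← Berge.contains⇒copy F H₀-unique con = record
    { part = record { at = coreAt ∘ ψ ; at-inj = λ {u} {v} eu ev → ψ-inj (dec-inj (trans (coreV⁻ (dec (ψ u)) eu) (sym (coreV⁻ (dec (ψ v)) ev)))) }
    ; covers = covers }
    where
    open EmbedsIn E
    covers : ∀ i → ∃ λ w → Touches i w × IsJust (coreAt (ψ w))
    covers i with isJust⊎nothing (coreAt (ψ (src i))) | isJust⊎nothing (coreAt (ψ (tgt i)))
    ... | inj₁ j | _      = src i , inj₁ refl , j
    ... | inj₂ _ | inj₁ j = tgt i , inj₂ refl , j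
    ... | inj₂ a | inj₂ b = ⊥-elim (src≢tgt i (ψ-inj (proj₂ (∈-H₀⁻ (φ∈ i)) (ψ (src i)) (ψ (tgt i)) (incˡ i) (incʳ i) a b)))

  cone : Fin n → List (Fin s) → Subset n
  cone v U = ⟪ v ∷ map (λ i → enc (vcore i)) U ⟫

  apex∈ : ∀ v U → v ∈ cone v U
  apex∈ v U = ∈-⟪⟫⁺ {vs = v ∷ map (λ i → enc (vcore i)) U} (here refl)

  coreAt-core : ∀ i → coreAt (enc (vcore i)) ≡ just i
  coreAt-core i = cong coreV (dec-enc (vcore i))

  ∈-cone⁻ : ∀ {v U u} → u ∈ cone v U → u ≡ v ⊎ ∃ λ i → i ∈ₗ U × u ≡ enc (vcore i)
  ∈-cone⁻ {v} {U} u∈ with ∈-⟪⟫⁻ (v ∷ map (λ i → enc (vcore i)) U) u∈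
  ... | here eq   = inj₁ eq
  ... | there u∈′ = inj₂ (∈-map⁻ _ u∈′)

  cone-outer : ∀ {v U u} → u ∈ cone v U → Outer u → u ≡ v
  cone-outer {v} {U} u∈ out with ∈-cone⁻ {v} {U} u∈
  ... | inj₁ eq = eq
  ... | inj₂ (i , _ , refl) = ⊥-elim (just≢nothing (coreAt-core i) out)

  cone-core : ∀ {v U i} → Outer v → enc (vcore i) ∈ cone v U → i ∈ₗ U
  cone-core {v} {U} {i} out i∈ with ∈-cone⁻ {v} {U} i∈
  ... | inj₁ refl = ⊥-elim (just≢nothing (coreAt-core i) out)
  ... | inj₂ (j , j∈ , eq) with refl ← enc-inj {vcore i} {vcore j} eq = j∈

  thin-cone : ∀ {v U} → Outer v → Unique U → length U ≡ c → Thin (cone v U)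
  thin-cone {v} {U} out u len =
    trans (∣⟪⟫∣ (Allₚ.map⁺ (All.universal (λ i eq → just≢nothing (coreAt-core i) (subst Outer eq out)) U)
                 ∷ Uniqueₚ.map⁺ (λ {i} {j} eq → case enc-inj {vcore i} {vcore j} eq of λ { refl → refl }) u))
          (cong suc (trans (Listₚ.length-map _ U) len)) ,
    λ u w u∈ w∈ ou ow → trans (cone-outer {v} {U} u∈ ou) (sym (cone-outer {v} {U} w∈ ow))

  cone-injˡ : ∀ {v w U W} → Outer v → cone v U ≡ cone w W → v ≡ w
  cone-injˡ {v} {w} {U} {W} out eq = cone-outer {w} {W} (subst (v ∈_) eq (apex∈ v U)) out

  cone-⊆ : ∀ {v w U W} → Outer w → cone v U ≡ cone w W → ∀ {i} → i ∈ₗ U → i ∈ₗ W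
  cone-⊆ {v} {w} {U} {W} ow eq {i} i∈ =
    cone-core {w} {W} ow (subst (enc (vcore i) ∈_) eq (∈-⟪⟫⁺ (there (∈-map⁺ _ i∈))))

  both : ∀ a b → ∃ λ ws → Unique ws × length ws ≡ c × a ∈ₗ ws × b ∈ₗ ws
  both a b with a Finₚ.≟ b
  ... | yes refl with ws , u , len , sub ← complete-list c (a ∷ []) ([] ∷ []) (s≤s z≤n) (ℕₚ.≤-trans (ℕₚ.n≤1+n c) (ℕₚ.m≤n+m k d)) =
    ws , u , len , sub (here refl) , sub (here refl)
  both a b | no a≢b with ws , u , len , sub ← complete-list c (a ∷ b ∷ []) ((a≢b ∷ []) ∷ [] ∷ []) (s≤s (s≤s z≤n)) (ℕₚ.≤-trans (ℕₚ.n≤1+n c) (ℕₚ.m≤n+m k d)) =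
    ws , u , len , sub (here refl) , sub (there (here refl))

  cls : Fin n → List (Fin n)
  cls v = v ∷ []

  module _ {Es : List (Subset n)} (H₀⊆ : ∀ {e} → e ∈ₗ H₀ → e ∈ₗ Es)
           (S : Counting.System id cls 1 (λ _ → s≤s z≤n) here P (suc P) X₀ Es) where
    open Counting.System S

    tp : Site P P → Fin 1
    tp _ = zero

    open Model P 1 s ⊥ ⊥ noGI tp

    slot : Slot P → Fin n
    slot (plain u)   = enc (vres u)
    slot (touched σ) = w (shiftSite σ)

    data SlotV : V → Set where
      res : ∀ {u} → SlotV (vres u)
      gr  : ∀ {g} → SlotV (vgr g)

    slotV : ∀ σ → SlotV (dec (slot σ))
    slotV (plain u)   = subst SlotV (sym (dec-enc (vres u))) res
    slotV (touched σ) = subst SlotV (sym (proj₂ (outside-X₀ (w (shiftSite σ)) (w∉ (shiftSite σ))))) gr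

    slot-outer : ∀ σ → Outer (slot σ)
    slot-outer σ = go (slotV σ)
      where
      go : ∀ {v} → SlotV v → coreV v ≡ nothing
      go res = refl
      go gr  = refl

    site-outer : ∀ σ → Outer (w σ)
    site-outer σ = cong coreV (proj₂ (outside-X₀ (w σ) (w∉ σ)))

    slot≢κ : ∀ σ {i j} → slot σ ≢ enc (vκ i j)
    slot≢κ σ {i} {j} eq = go (slotV σ) (trans (cong dec eq) (dec-enc (vκ i j)))
      where
      go : ∀ {v} → SlotV v → v ≢ vκ i j
      go res ()
      go gr  ()

    slot-inj : ∀ {σ τ} → slot σ ≡ slot τ → σ ≡ τ
    slot-inj {plain u}   {plain v}   eq with refl ← enc-inj {vres u} {vres v} eq = refl
    slot-inj {touched σ} {touched τ} eq = cong touched (shiftSite-inj (w-lab eq))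
    slot-inj {plain u}   {touched τ} eq = case trans (sym (dec-enc (vres u))) (trans (cong dec eq) (proj₂ (outside-X₀ _ (w∉ (shiftSite τ))))) of λ ()
    slot-inj {touched σ} {plain v}   eq = case trans (sym (dec-enc (vres v))) (trans (cong dec (sym eq)) (proj₂ (outside-X₀ _ (w∉ (shiftSite σ))))) of λ ()

    vert : MV → Fin n
    vert (core i) = enc (vcore i)
    vert (pt σ _) = slot σ

    vert-inj : ∀ {a b} → vert a ≡ vert b → a ≡ b
    vert-inj {core i}    {core j}    eq with refl ← enc-inj {vcore i} {vcore j} eq = refl
    vert-inj {pt σ zero} {pt τ zero} eq = cong (λ σ → pt σ zero) (slot-inj eq)
    vert-inj {core i}    {pt τ _}    eq = ⊥-elim (just≢nothing (coreAt-core i) (subst Outer (sym eq) (slot-outer τ)))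
    vert-inj {pt σ _}    {core j}    eq = ⊥-elim (just≢nothing (coreAt-core j) (subst Outer eq (slot-outer σ)))

    κ-outer : ∀ i j → Outer (enc (vκ i j))
    κ-outer i j = cong coreV (dec-enc (vκ i j))

    shiftEdge : Fin P ⊎ Fin P → Fin P ⊎ Fin (suc P)
    shiftEdge (inj₁ i) = inj₁ i
    shiftEdge (inj₂ i) = inj₂ (suc i)

    shiftEdge-inj : ∀ {a b} → shiftEdge a ≡ shiftEdge b → a ≡ b
    shiftEdge-inj {inj₁ _} {inj₁ _} refl = refl
    shiftEdge-inj {inj₂ _} {inj₂ _} refl = refl

    -- A vertex outside the core needs one hyperedge for each of the `s` core vertices, all
    -- different; the sets `around d i` provide them, because `s` exceeds `c`.
    edge : ME → Subset n
    edge (h i σ) = cone (slot σ) (around d i)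
    edge (κ i j) = cone (enc (vκ i j)) (proj₁ (both i j))
    edge (eh t)  = e (shiftEdge t)

    two-sites : ∀ t → ∃ λ σ → ∃ λ τ → σ ≢ τ × w σ ∈ e t × w τ ∈ e t
    two-sites (inj₁ i) = hub , leaf i , (λ ()) , hub∈ i , leaf∈ i
    two-sites (inj₂ i) = left i , right i , (λ ()) , left∈ i , right∈ i

    new : ∀ t {v U} → e t ≢ cone v U
    new t {v} {U} eq with σ , τ , σ≢τ , σ∈ , τ∈ ← two-sites t = σ≢τ (w-lab (trans
      (cone-outer {v} {U} (subst (w σ ∈_) eq σ∈) (site-outer σ))
      (sym (cone-outer {v} {U} (subst (w τ ∈_) eq τ∈) (site-outer τ)))))

    edge-inj : ∀ {a b} → edge a ≡ edge b → a ≡ b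
    edge-inj {h i σ} {h j τ} eq with refl ← slot-inj {σ} {τ} (cone-injˡ {U = around d i} {around d j} (slot-outer σ) eq) =
      cong (λ i → h i σ) (around-⊆⇒≡ d i j (cone-⊆ {U = around d i} {around d j} (slot-outer σ) eq) (cone-⊆ {U = around d j} {around d i} (slot-outer σ) (sym eq)))
    edge-inj {h i σ} {κ a b} eq = ⊥-elim (slot≢κ σ (cone-injˡ {U = around d i} {proj₁ (both a b)} (slot-outer σ) eq))
    edge-inj {κ a b} {h i σ} eq = ⊥-elim (slot≢κ σ (cone-injˡ {U = around d i} {proj₁ (both a b)} (slot-outer σ) (sym eq)))
    edge-inj {κ a b} {κ a′ b′} eq with refl ← enc-inj {vκ a b} {vκ a′ b′} (cone-injˡ {U = proj₁ (both a b)} {proj₁ (both a′ b′)} (κ-outer a b) eq) = refl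
    edge-inj {eh t}  {eh t′}  eq = cong eh (shiftEdge-inj (e-inj eq))
    edge-inj {eh t}  {h i σ} eq = ⊥-elim (new (shiftEdge t) {slot σ} {around d i} eq)
    edge-inj {eh t}  {κ a b} eq = ⊥-elim (new (shiftEdge t) {enc (vκ a b)} {proj₁ (both a b)} eq)
    edge-inj {h i σ} {eh t}  eq = ⊥-elim (new (shiftEdge t) {slot σ} {around d i} (sym eq))
    edge-inj {κ a b} {eh t}  eq = ⊥-elim (new (shiftEdge t) {enc (vκ a b)} {proj₁ (both a b)} (sym eq))

    edge∈ : ∀ a → edge a ∈ₗ Es
    edge∈ (h i σ) = H₀⊆ (∈-H₀ (thin-cone (slot-outer σ) (around-unique d i) (length-around d i)))
    edge∈ (κ i j) with both i j
    ... | ws , u , len , _ = H₀⊆ (∈-H₀ (thin-cone (κ-outer i j) u len))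
    edge∈ (eh t)  = e∈ (shiftEdge t)

    inc : ∀ {v a} → Inc v a → vert v ∈ edge a
    inc (ch {i})     = ∈-⟪⟫⁺ (there (∈-map⁺ _ (∈-around d i)))
    inc (ph {i} {σ}) = apex∈ (slot σ) (around d i)
    inc (κˡ {i} {j}) with both i j
    ... | ws , _ , _ , i∈ , _ = ∈-⟪⟫⁺ (there (∈-map⁺ _ i∈))
    inc (κʳ {i} {j}) with both i j
    ... | ws , _ , _ , _ , j∈ = ∈-⟪⟫⁺ (there (∈-map⁺ _ j∈))
    inc (hubᵢ {i})   = hub∈ i
    inc (leafᵢ {i})  = leaf∈ i
    inc (leftᵢ {i})  = left∈ (suc i)
    inc (rightᵢ {i}) = right∈ (suc i)

    -- `newest` sends number `zero` of the cover to the hub, the one place that the core lacks. The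
    -- groups of the model are single vertices here.
    dense : Cover F (suc s) → ContainsBerge F Es
    dense C with D , unobstructed ← Instances.good F (cover-layout F zero C)
      with Drawing.Embed.kinds-or-obstruction F 1 s ⊥ ⊥ noGI D (s≤s z≤n)
    ... | inj₁ kinds = Berge.copy⇒contains F (embed-map vert edge vert-inj edge-inj inc E , λ i → edge∈ (EmbedsIn.φ E i))
      where
      E : EmbedsIn F Inc
      E = Drawing.Embed.embedding F 1 s ⊥ ⊥ noGI D tp kinds
    ... | inj₂ obs   = ⊥-elim (unobstructed obs)

  uncovered-saturation : n > 0 → ¬ Cover F s → Cover F (suc s) → SatAtMost k F n (bound 1 P b₀ * n)
  uncovered-saturation n>0 ¬C C = sparse-saturation F k id cls 1 (λ _ → s≤s z≤n) here {X = X₀} n>0 (ℕₚ.≤-reflexive length-X₀)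
    H₀-unique (All.tabulate λ e∈ → proj₁ (∈-H₀⁻ e∈)) (¬C ∘ contains⇒cover) λ _ H₀⊆ S → dense H₀⊆ S C

-- Deciding covers, and the descent

cover? : ∀ F N → Dec (Cover F N)
cover? F N = map′ to from (anyFun? resp λ f →
    (all? λ u → all? λ v → (f u Finₚ.≟ f v) →-dec ((f u Finₚ.≟ zero) ⊎-dec (u Finₚ.≟ v))) ×-dec
    all? λ i → ¬? (f (src i) Finₚ.≟ zero) ⊎-dec ¬? (f (tgt i) Finₚ.≟ zero))
  where
  open Graphs F
  -- Partial numberings as total functions, with `zero` for undefined, so that `anyFun?` applies.
  Code : (Fin P → Fin (suc N)) → Set
  Code f = (∀ u v → f u ≡ f v → f u ≡ zero ⊎ u ≡ v) × (∀ i → f (src i) ≢ zero ⊎ f (tgt i) ≢ zero)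
  resp : ∀ {f g} → (∀ u → f u ≡ g u) → Code f → Code g
  resp {f} {g} f≗g (inj , cov) =
    (λ u v eq → case inj u v (trans (f≗g u) (trans eq (sym (f≗g v)))) of λ
      { (inj₁ z) → inj₁ (trans (sym (f≗g u)) z) ; (inj₂ u≡v) → inj₂ u≡v }) ,
    λ i → case cov i of λ { (inj₁ a) → inj₁ λ z → a (trans (f≗g (src i)) z) ; (inj₂ b) → inj₂ λ z → b (trans (f≗g (tgt i)) z) }
  newest≢ : ∀ {N} (i : Fin (suc N)) → i ≢ zero → IsJust (newest i)
  newest≢ zero    ≢ = ⊥-elim (≢ refl)
  newest≢ (suc i) _ = i , refl
  newest-zero : ∀ {N} {i : Fin (suc N)} {j} → newest i ≡ just j → i ≢ zero
  newest-zero {i = suc i} _ ()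
  to : Σ (Fin P → Fin (suc N)) Code → Cover F N
  to (f , inj , cov) = record
    { part = record { at = newest ∘ f ; at-inj = λ {u} {v} eu ev → case inj u v (newest-inj (trans eu (sym ev))) of λ
        { (inj₁ z) → ⊥-elim (newest-zero eu z) ; (inj₂ u≡v) → u≡v } }
    ; covers = λ i → case cov i of λ { (inj₁ a) → src i , inj₁ refl , newest≢ _ a ; (inj₂ b) → tgt i , inj₂ refl , newest≢ _ b } }
  from : Cover F N → Σ (Fin P → Fin (suc N)) Code
  from C = code ∘ at , inj , λ i → case covers i of λ
      { (_ , inj₁ refl , j) → inj₁ (code≢ j) ; (_ , inj₂ refl , j) → inj₂ (code≢ j) }
    where
    open Cover C
    code : Maybe (Fin N) → Fin (suc N)
    code nothing  = zero
    code (just i) = suc i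
    code≢ : ∀ {m} → IsJust m → code m ≢ zero
    code≢ (_ , refl) ()
    inj : ∀ u v → code (at u) ≡ code (at v) → code (at u) ≡ zero ⊎ u ≡ v
    inj u v eq with at u in eu | at v in ev
    ... | nothing | _       = inj₁ refl
    ... | just i  | just j  = inj₂ (at-inj eu (trans ev (cong just (sym (Finₚ.suc-injective eq)))))

trivial-cover : ∀ F → Cover F (p F)
trivial-cover F = record { part = record { at = just ; at-inj = λ eu ev → just-injective (trans eu (sym ev)) }
                         ; covers = λ i → Graphs.src F i , inj₁ refl , _ , refl }

SatAtMost-mono : ∀ {k F n m m′} → m ≤ m′ → SatAtMost k F n m → SatAtMost k F n m′
SatAtMost-mono m≤m′ (H , sat , size≤) = H , sat , ℕₚ.≤-trans size≤ m≤m′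

module _ (F : Graph) where
  open Graphs F

  module _ {q s : ℕ} {GV GE : Set} {gi : GE → Fin s ⊎ GV → Set} (tp : Site P P → Fin q) where
    private
      module M₀ = Model P q s ⊥ ⊥ noGI tp
      module M = Model P q s GV GE gi tp

    without-gadget : EmbedsIn F M₀.Inc → EmbedsIn F M.Inc
    without-gadget = embed-map vmap emap (retract-injᵐ vmap⁻ λ { (M₀.core _) → refl ; (M₀.pt _ _) → refl })
      (retract-injᵐ emap⁻ λ { (M₀.h _ _) → refl ; (M₀.eh _) → refl ; (M₀.κ _ _) → refl }) inc
      where
      vmap : M₀.MV → M.MV
      vmap (M₀.core i) = M.core i
      vmap (M₀.pt σ x) = M.pt σ x
      vmap⁻ : M.MV → Maybe M₀.MV
      vmap⁻ (M.core i) = just (M₀.core i)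
      vmap⁻ (M.pt σ x) = just (M₀.pt σ x)
      vmap⁻ (M.gv _)   = nothing
      emap : M₀.ME → M.ME
      emap (M₀.h i σ) = M.h i σ
      emap (M₀.eh t)  = M.eh t
      emap (M₀.κ i j) = M.κ i j
      emap⁻ : M.ME → Maybe M₀.ME
      emap⁻ (M.h i σ) = just (M₀.h i σ)
      emap⁻ (M.eh t)  = just (M₀.eh t)
      emap⁻ (M.κ i j) = just (M₀.κ i j)
      emap⁻ (M.ge _)  = nothing
      inc : ∀ {v e} → M₀.Inc v e → M.Inc (vmap v) (emap e)
      inc M₀.ch     = M.ch
      inc M₀.ph     = M.ph
      inc M₀.κˡ     = M.κˡ
      inc M₀.κʳ     = M.κʳ
      inc M₀.hubᵢ   = M.hubᵢ
      inc M₀.leafᵢ  = M.leafᵢ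
      inc M₀.leftᵢ  = M.leftᵢ
      inc M₀.rightᵢ = M.rightᵢ

  -- The invariant of the descent, for all touched positions, including the ends `t₁` and `t₂` of
  -- the matching edge set aside for the extra piece.
  Solvable : ℕ → ℕ → Set
  Solvable q s = ∀ t₁ t₂ (tp : Site P P → Fin q) → EmbedsIn F (Model.Inc P q s (Gadget.GV s q t₁ t₂) (Gadget.GE s q t₁ t₂) (Gadget.GI s q t₁ t₂) tp)

  layout-embeds : ∀ {q s GV GE gi} → q ≤ 4 → Layout F q s GV GE gi → (tp : Site P P → Fin q) → EmbedsIn F (Model.Inc P q s GV GE gi tp)
  layout-embeds {q} {s} {GV} {GE} {gi} q≤4 L tp with Drawing.Embed.kinds-or-obstruction F q s GV GE gi (FromLayout.drawn L) q≤4
  ... | inj₁ kinds = Drawing.Embed.embedding F q s GV GE gi (FromLayout.drawn L) tp kinds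
  ... | inj₂ obs   = ⊥-elim (FromLayout.unobstructed L obs)

  -- `baseᴷ` is `b₀` for `s = δ = q = 2` without the remainder `r`, and the added 2 bounds that
  -- remainder.
  baseᴷ boundᴷ : ℕ
  baseᴷ  = (2 + 2) + (2 * 2 + (P + 6)) * 2
  boundᴷ = bound 2 P (baseᴷ + 2)

  -- Makes every large `n` attainable: the vertices that do not fill a group become the `r` vertices
  -- in no hyperedge of `H₀`.
  decompose : ∀ q′ {b n} → b ≤ n → ∃ λ r → ∃ λ G → r ≤ suc q′ × n ≡ (b + r) + G * suc q′
  decompose q′ {b} {n} b≤n = (n ∸ b) % suc q′ , (n ∸ b) / suc q′ , ℕₚ.<⇒≤ (m%n<n (n ∸ b) (suc q′)) , (begin
    n                                                       ≡⟨ ℕₚ.m+[n∸m]≡n b≤n ⟨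
    b + (n ∸ b)                                             ≡⟨ cong (b +_) (m≡m%n+[m/n]*n (n ∸ b) (suc q′)) ⟩
    b + ((n ∸ b) % suc q′ + (n ∸ b) / suc q′ * suc q′)      ≡⟨ ℕₚ.+-assoc b _ _ ⟨
    b + (n ∸ b) % suc q′ + (n ∸ b) / suc q′ * suc q′        ∎)
    where open ≡-Reasoning

  kernel-embeds : ∀ r G → Cover F 5 → (T : Cycles.Triangle F) → Cycles.Triangle.Isolated T →
    (tp : Site P (suc P) → Fin 2) → EmbedsIn F (Concrete.RawInc 2 2 0 (P + 6) r G tp)
  kernel-embeds r G C₅ T iso tp = ConcreteD.embed-raw F r G tp
    (layout-embeds (s≤s (s≤s z≤n)) (Trigon.trigon-layout F 2 zero T iso C₅) (tp ∘ shiftSite))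

  kernel-attempt : ∀ {n} → n > 0 → baseᴷ ≤ n → Cover F 5 → (T : Cycles.Triangle F) → Cycles.Triangle.Isolated T →
    SatAtMost 5 F n (boundᴷ * n) ⊎ ∃ λ r → ∃ λ G → EmbedsIn F (Concrete.In 2 2 0 (P + 6) r G)
  kernel-attempt {n} n>0 base≤n C₅ T iso = go (decompose 1 base≤n)
    where
    go : (∃ λ r → ∃ λ G → r ≤ 2 × n ≡ (baseᴷ + r) + G * 2) →
         SatAtMost 5 F n (boundᴷ * n) ⊎ ∃ λ r → ∃ λ G → EmbedsIn F (Concrete.In 2 2 0 (P + 6) r G)
    go (r , G , r≤2 , refl) = Data.Sum.map
      (SatAtMost-mono {F = F} (ℕₚ.*-monoˡ-≤ n (bound-mono 2 P (ℕₚ.+-monoʳ-≤ baseᴷ r≤2)))) (λ E → r , G , E)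
      (Concrete.saturated-or-embeds 2 2 0 (P + 6) r G F n>0 (kernel-embeds r G C₅ T iso))

  module Descent (edge : Fin m) (q″ : ℕ) (q≤4 : suc (suc q″) ≤ 4) (C : Cover F (3 + q″)) where
    q k : ℕ
    q = suc (suc q″)
    k = suc q

    C₅ : Cover F 5
    C₅ = widen-cover (s≤s q≤4) C

    Outcome : ℕ → Set
    Outcome s = Solvable q s ⊎ (s ≡ 2 × ¬ Cover F 4 × Σ (Cycles.Triangle F) Cycles.Triangle.Isolated)

    solvable₄ : Solvable q 4
    solvable₄ t₁ t₂ tp = without-gadget tp (layout-embeds q≤4 (cover-layout F zero C₅) tp)

    other : Fin q → Fin q
    other zero    = suc zero
    other (suc _) = zero

    other≢ : ∀ x → other x ≢ x
    other≢ zero    ()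
    other≢ (suc _) ()

    -- At `s = 3` the cover of size 5 is enough to redraw a triangle or a 4-cycle; at `s = 2` only a
    -- triangle can occur, and it asks for a cover of size 4; smaller cores have too few colours for
    -- an obstruction.
    step : ∀ s → s ≤ 3 → ∀ {r G} → EmbedsIn F (Concrete.In (suc s) 0 q″ (P + 0) r G) → Outcome s
    step s s≤3 {r} {G} E with Drawing.Embed.kinds-or-obstruction F q s ⊥ ⊥ noGI (FromConcrete.drawn F s q″ (P + 0) r G E) q≤4
    ... | inj₁ kinds = inj₁ λ t₁ t₂ tp → without-gadget tp (Drawing.Embed.embedding F q s ⊥ ⊥ noGI (FromConcrete.drawn F s q″ (P + 0) r G E) tp kinds)
    ... | inj₂ (_ , obs) with s | s≤3 | Cycles.Obstructed.obstructed F q s ⊥ ⊥ noGI (FromConcrete.drawn F s q″ (P + 0) r G E) s≤3 obs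
    ...   | suc (suc (suc zero)) | _ | inj₁ (_ , (T , pen) , _) =
      inj₁ λ t₁ t₂ tp → layout-embeds q≤4 (triangle-layout F t₁ t₂ T pen C₅) tp
    ...   | suc (suc (suc zero)) | _ | inj₂ (_ , Sq) =
      inj₁ λ t₁ t₂ tp → layout-embeds q≤4 (square-layout F t₁ t₂ (other t₂) (other≢ t₂) Sq C₅) tp
    ...   | suc (suc zero) | _ | inj₁ (_ , (T , pen) , iso) = case cover? F 4 of λ
      { (yes C₄) → inj₁ λ t₁ t₂ tp → layout-embeds q≤4 (triangle-layout F t₁ t₂ T pen C₄) tp
      ; (no ¬C₄) → inj₂ (refl , ¬C₄ , iso refl) }
    ...   | suc (suc zero) | _ | inj₂ (s≤s (s≤s ()) , _)
    ...   | suc zero | _ | inj₁ (s≤s () , _)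
    ...   | suc zero | _ | inj₂ (s≤s () , _)
    ...   | zero | _ | inj₁ (() , _)
    ...   | zero | _ | inj₂ (() , _)
    ...   | suc (suc (suc (suc _))) | s≤s (s≤s (s≤s ())) | _

    -- The copy met at each stage depends on `n`, so the descent may end at different stages for
    -- different `n`; `total` sums over all of them and the detour through the kernel.
    base boundˢ total : ℕ → ℕ
    base s  = (s + 0) + (s * s + (P + 0)) * q
    boundˢ s = bound q P (base s + q)
    total zero    = boundˢ zero + boundᴷ
    total (suc s) = boundˢ (suc s) + total s

    base-mono : ∀ {s t} → s ≤ t → base s ≤ base t
    base-mono s≤t = ℕₚ.+-mono-≤ (ℕₚ.+-monoˡ-≤ 0 s≤t) (ℕₚ.*-monoˡ-≤ q (ℕₚ.+-monoˡ-≤ (P + 0) (ℕₚ.*-mono-≤ s≤t s≤t)))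

    boundᴷ≤total : ∀ s → boundᴷ ≤ total s
    boundᴷ≤total zero    = ℕₚ.m≤n+m boundᴷ (boundˢ zero)
    boundᴷ≤total (suc s) = ℕₚ.≤-trans (boundᴷ≤total s) (ℕₚ.m≤n+m (total s) (boundˢ (suc s)))

    module _ {n : ℕ} (n>0 : n > 0) (base≤n : base 4 ≤ n) (baseᴷ≤n : baseᴷ ≤ n) where

      attempt : ∀ s → s ≤ 4 → Solvable q s →
                SatAtMost k F n (boundˢ s * n) ⊎ ∃ λ r → ∃ λ G → EmbedsIn F (Concrete.In s 0 q″ (P + 0) r G)
      attempt s s≤4 solve = go (decompose (suc q″) (ℕₚ.≤-trans (base-mono s≤4) base≤n))
        where
        go : (∃ λ r → ∃ λ G → r ≤ q × n ≡ (base s + r) + G * q) →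
             SatAtMost k F n (boundˢ s * n) ⊎ ∃ λ r → ∃ λ G → EmbedsIn F (Concrete.In s 0 q″ (P + 0) r G)
        go (r , G , r≤q , refl) = Data.Sum.map
          (SatAtMost-mono {F = F} (ℕₚ.*-monoˡ-≤ n (bound-mono q P (ℕₚ.+-monoʳ-≤ (base s) r≤q)))) (λ E → r , G , E)
          (Concrete.saturated-or-embeds s 0 q″ (P + 0) r G F n>0
            λ tp → ConcreteS.embed-raw P s q″ 0 r G tp (solve (tp (left zero)) (tp (right zero)) (tp ∘ shiftSite)))

      resolve : ∀ s → Outcome s → SatAtMost k F n (total s * n) ⊎ Solvable q s
      resolve s  (inj₁ solve)                  = inj₂ solve
      resolve .2 (inj₂ (refl , ¬C₄ , T , iso)) = kernel q″ refl
        where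
        kernel : ∀ q‴ → q‴ ≡ q″ → SatAtMost k F n (total 2 * n) ⊎ Solvable q 2
        -- For `k` equal to 3 or 4 the given cover of size `k` already refutes `¬C₄`.
        kernel zero refl                 = ⊥-elim (¬C₄ (widen-cover (s≤s (s≤s (s≤s z≤n))) C))
        kernel (suc zero) refl           = ⊥-elim (¬C₄ C)
        kernel (suc (suc (suc _))) refl  = ⊥-elim (ℕₚ.<⇒≱ (s≤s (s≤s (s≤s (s≤s (s≤s z≤n))))) q≤4)
        kernel (suc (suc zero)) refl     = Data.Sum.map
          (SatAtMost-mono {F = F} (ℕₚ.*-monoˡ-≤ n (boundᴷ≤total 2)))
          (λ (r , G , E) t₁ t₂ tp → layout-embeds q≤4 (FromKernel.kernel-layout F (P + 6) r G E T iso t₁ t₂ zero (suc zero) (λ ())) tp)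
          (kernel-attempt n>0 baseᴷ≤n C₅ T iso)

      descend : ∀ s → s ≤ 4 → Solvable q s → SatAtMost k F n (total s * n)
      descend zero s≤4 solve = go (attempt zero s≤4 solve)
        where
        no-tag : ∀ {r G} → ¬ Concrete.Tag 0 0 q″ (P + 0) r G
        no-tag (Concrete.hT () _)
        no-tag (Concrete.κT () _)
        go : SatAtMost k F n (boundˢ zero * n) ⊎ (∃ λ r → ∃ λ G → EmbedsIn F (Concrete.In zero 0 q″ (P + 0) r G)) →
             SatAtMost k F n (total zero * n)
        go (inj₁ sat)         = SatAtMost-mono {F = F} (ℕₚ.*-monoˡ-≤ n (ℕₚ.m≤m+n (boundˢ zero) boundᴷ)) sat
        -- Without core vertices there are no hyperedges, but `edge` would need one.
        go (inj₂ (r , G , E)) = ⊥-elim (no-tag (EmbedsIn.φ E edge))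
      descend (suc s) s≤4 solve = go (attempt (suc s) s≤4 solve)
        where
        go : SatAtMost k F n (boundˢ (suc s) * n) ⊎ (∃ λ r → ∃ λ G → EmbedsIn F (Concrete.In (suc s) 0 q″ (P + 0) r G)) →
             SatAtMost k F n (total (suc s) * n)
        go (inj₁ sat)         = SatAtMost-mono {F = F} (ℕₚ.*-monoˡ-≤ n (ℕₚ.m≤m+n (boundˢ (suc s)) (total s))) sat
        go (inj₂ (r , G , E)) = SatAtMost-mono {F = F} (ℕₚ.*-monoˡ-≤ n (ℕₚ.m≤n+m (total s) (boundˢ (suc s))))
          ([ id , descend s (ℕₚ.≤-trans (ℕₚ.n≤1+n s) s≤4) ]′ (resolve s (step s (ℕₚ.≤-pred s≤4) E)))

      covered-saturation : SatAtMost k F n (total 4 * n)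
      covered-saturation = descend 4 ℕₚ.≤-refl solvable₄

    covered-linear : Σ ℕ λ C → Σ ℕ λ N → (n : ℕ) → N ≤ n → SatAtMost k F n (C * n)
    covered-linear = total 4 , suc (base 4 + baseᴷ) , λ n N≤n → covered-saturation (ℕₚ.≤-trans (s≤s z≤n) N≤n)
      (ℕₚ.≤-trans (ℕₚ.m≤m+n (base 4) baseᴷ) (ℕₚ.≤-trans (ℕₚ.n≤1+n _) N≤n))
      (ℕₚ.≤-trans (ℕₚ.m≤n+m baseᴷ (base 4)) (ℕₚ.≤-trans (ℕₚ.n≤1+n _) N≤n))

  -- The search ends because all `P` vertices of F form a cover.
  threshold : ∀ k fuel d → ¬ Cover F (d + k) → P ≤ fuel + d → ∃ λ d → ¬ Cover F (d + k) × Cover F (suc (d + k))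
  threshold k zero       d ¬C P≤ = ⊥-elim (¬C (widen-cover (ℕₚ.≤-trans P≤ (ℕₚ.m≤m+n d k)) (trivial-cover F)))
  threshold k (suc fuel) d ¬C P≤ with cover? F (suc (d + k))
  ... | yes C  = d , ¬C , C
  ... | no ¬C′ = threshold k fuel (suc d) ¬C′ (ℕₚ.≤-trans P≤ (ℕₚ.≤-reflexive (sym (ℕₚ.+-suc fuel d))))

  uncovered-linear : ∀ c″ → ¬ Cover F (3 + c″) → Σ ℕ λ C → Σ ℕ λ N → (n : ℕ) → N ≤ n → SatAtMost (3 + c″) F n (C * n)
  uncovered-linear c″ ¬C with d , ¬Cd , Cd ← threshold (3 + c″) P 0 ¬C (ℕₚ.m≤m+n P 0) =
    -- `b₀` does not involve `G`, so `G = 0` serves to name it before `n` is known.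
    bound 1 P (Uncovered.b₀ F c″ d 0) , suc (Uncovered.b₀ F c″ d 0) , λ n N≤n →
      subst (λ n → n > 0 → SatAtMost (3 + c″) F n (bound 1 P (Uncovered.b₀ F c″ d 0) * n)) (ℕₚ.m+[n∸m]≡n (ℕₚ.≤-trans (ℕₚ.n≤1+n (Uncovered.b₀ F c″ d 0)) N≤n))
        (λ n>0 → Uncovered.uncovered-saturation F c″ d (n ∸ Uncovered.b₀ F c″ d 0) n>0 ¬Cd Cd) (ℕₚ.≤-trans (s≤s z≤n) N≤n)

theorem1 : (F : Graph) → length (edges F) > 0 → (k : ℕ) → 3 ≤ k → k ≤ 5 →
    Σ ℕ λ C → Σ ℕ λ N → (n : ℕ) → N ≤ n → SatAtMost k F n (C * n)
theorem1 F m>0 (suc (suc (suc q″))) (s≤s (s≤s (s≤s z≤n))) (s≤s q≤4) with cover? F (3 + q″)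
... | yes C = Descent.covered-linear F (fromℕ< m>0) q″ q≤4 C
... | no ¬C = uncovered-linear F q″ ¬C
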